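{- Let $n\ge2$, $a\ge1$ and $1\le m\le k\le n-1$ be integers, $\lambda=(a^k,1^{n-k-1},0)$, $\nu=\lambda-(e_m+e_{m+1}+\cdots+e_k)$, and let $\mu,\rho$ be such that $\lambda,\mu,\nu,\rho$ are partitions (vectors in $\mathbb{Z}^n$ with last entry $0$) with $\lambda+\mu=\nu+\rho$ and $\nu,\rho\in P_{\lambda,\mu}$. Then the procedure $\theta$ described in the context is well defined on every $\lambda\circledast\mu$-peelable tableau (every square it requires exists and the procedure terminates), and $\theta$ is an injection from the set of $\lambda\circledast\mu$-peelable tableaux to the set of $\nu\circledast\rho$-peelable tableaux.
   Context: $e_i$ is the $i$-th standard basis vector of $\mathbb{Z}^n$. For weights $\lambda,\mu$, $P_{\lambda,\mu}$ is the minimal alcoved polytope containing $\lambda,\mu$ (alcoved polytope: intersection of half-spaces bounded by hyperplanes $\tau_i-\tau_j=c$, $c\in\mathbb{Z}$); equivalently $\tau\in P_{\lambda,\mu}$ iff for all $1\le i,j\le n$, $\tau_i-\tau_j$ lies weakly between $\lambda_i-\lambda_j$ and $\mu_i-\mu_j$. English convention: $(i,j)$ is row $i$ (top to bottom), column $j$; North = up, East = right, West = left. For partitions $\alpha,\beta$ the shuffle diagram $\alpha\circledast\beta$ has a square at $(2i-1,2j-1)$ for each square $(i,j)$ of $\alpha$ and at $(2i,2j)$ for each square $(i,j)$ of $\beta$; let $a_i$ be the number of its columns containing squares in both rows $i$ and $i+2$. An $\alpha\circledast\beta$-peelable tableau is a semistandard Young tableau with content $(\alpha_1,\beta_1,\alpha_2,\beta_2,\ldots)$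 such that for every $i\ge1$ there are at least $a_i$ pairwise disjoint pairs (square containing $i$, square containing $i+2$) with the $i$-square in a row weakly above and a column weakly right of the $(i+2)$-square. In a semistandard tableau, a square containing $2i-1$ is changeable if it is the rightmost $(2i-1)$-square in its row and the square directly below it does not contain $2i$ (so it can be increased to $2i$ keeping semistandardness); a square containing $2i$ is changeable if it is the leftmost $2i$-square in its row and the square directly above it does not contain $2i-1$ (so it can be decreased to $2i-1$). The procedure $\theta$ applied to a $\lambda\circledast\mu$-peelable tableau $T$: (1) let $s_m$ be the leftmost changeable $(2m-1)$-square and change its entry to $2m$; (2) for $j=m+1,\ldots,k$ in turn, let $s_j$ be the leftmost changeable $(2j-1)$-square weakly East of $s_{j-1}$ in the current tableau, and change its entry to $2j$; (3) if the current tableau is $\nu\circledast\rho$-peelable, stop; otherwise let $s_{k+1}$ be the unique $(2k+1)$-square and $t_{k+1}$ the rightmost changeable $(2k+2)$-square, increase $s_{k+1}$ to $2k+2$ and decrease $t_{k+1}$ to $2k+1$; (4) if the current tableau is $\nu\circledast\rho$-peelable, stop; otherwise repeat step (3) with $2k+3,2k+4$ in place of $2k+1,2k+2$ (squares $s_{k+2},t_{k+2}$), then with $2k+5,2k+6$, and so on, until the current tableau is $\nu\circledast\rho$-peelable. $\theta(T)$ is the resulting tableau. -}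

module Defs where

open import Data.Nat using (ℕ; zero; suc; _+_; _*_; _∸_; _≤_; _<_; _≤ᵇ_; _<ᵇ_; _≡ᵇ_)
open import Data.Integer using (ℤ; _⊖_) renaming (_≤_ to _≤ℤ_)
open import Data.Bool using (Bool; true; false; if_then_else_; _∧_)
open import Data.Fin using (Fin; toℕ) renaming (zero to fzero; suc to fsuc; _≤_ to _≤F_)
open import Data.Maybe using (Maybe; just; nothing; _>>=_) renaming (map to mapMaybe)
open import Data.List using (List; []; _∷_; length; map)
open import Data.List.Relation.Unary.All using (All)
open import Data.List.Relation.Unary.Unique.Propositional using (Unique)
open import Data.Product using (Σ; ∃; _×_; _,_; proj₁; proj₂)
open import Data.Sum using (_⊎_)
open import Relation.Nullary using (¬_)
open import Relation.Binary.PropositionalEquality using (_≡_)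

-- Weights: vectors in ℕ^n (0-based Fin index i ↔ paper index i+1).
-- Partitions with last entry 0 are non-negative, so ℕ loses nothing.

Weight : ℕ → Set
Weight n = Fin n → ℕ

IsPartition : ∀ {n} → Weight n → Set
IsPartition {n} v =
  (∀ (i j : Fin n) → i ≤F j → v j ≤ v i) × (∀ (i : Fin n) → suc (toℕ i) ≡ n → v i ≡ 0)

-- paper-indexed (1-based) entry of a weight; 0 outside 1..n
at : ∀ {n} → Weight n → ℕ → ℕ
at {zero}  v _                   = 0
at {suc n} v zero                = 0
at {suc n} v (suc zero)          = v fzero
at {suc n} v (suc (suc i))       = at {n} (λ j → v (fsuc j)) (suc i)

sumW : ∀ {n} → Weight n → ℕ
sumW {zero}  v = 0
sumW {suc n} v = v fzero + sumW {n} (λ j → v (fsuc j))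

lamV : (n a k : ℕ) → Weight n
lamV n a k i = if toℕ i <ᵇ k then a else (if suc (toℕ i) <ᵇ n then 1 else 0)

-- ν = λ - (e_m + ... + e_k)  (the subtraction is exact since λ_i = a ≥ 1 there)
nuV : (n a m k : ℕ) → Weight n
nuV n a m k i =
  if (m ≤ᵇ suc (toℕ i)) ∧ (suc (toℕ i) ≤ᵇ k) then lamV n a k i ∸ 1 else lamV n a k i

Between : ℤ → ℤ → ℤ → Set
Between x y z = (y ≤ℤ x × x ≤ℤ z) ⊎ (z ≤ℤ x × x ≤ℤ y)

InP : ∀ {n} → Weight n → Weight n → Weight n → Set
InP {n} lam mu tau =
  ∀ (i j : Fin n) → Between (tau i ⊖ tau j) (lam i ⊖ lam j) (mu i ⊖ mu j)

-- Tableaux: list of rows (top to bottom), each row a list of entries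
-- (left to right).  Rows and columns are 1-indexed.

Tab : Set
Tab = List (List ℕ)

Pos : Set
Pos = ℕ × ℕ

idx : ∀ {A : Set} → List A → ℕ → Maybe A
idx []       _             = nothing
idx (x ∷ xs) zero          = nothing
idx (x ∷ xs) (suc zero)    = just x
idx (x ∷ xs) (suc (suc i)) = idx xs (suc i)

entry : Tab → ℕ → ℕ → Maybe ℕ
entry T r c = idx T r >>= λ row → idx row c

Has : Tab → ℕ → ℕ → ℕ → Set
Has T r c v = entry T r c ≡ just v

record SSYT (T : Tab) : Set where
  field
    rowsNonempty : ∀ r row → idx T r ≡ just row → 1 ≤ length row
    shapeDecr    : ∀ r row row' → idx T r ≡ just row → idx T (suc r) ≡ just row' →
                   length row' ≤ length row
    positive     : ∀ r c v → Has T r c v → 1 ≤ v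
    rowWeak      : ∀ r c v w → Has T r c v → Has T r (suc c) w → v ≤ w
    colStrict    : ∀ r c v w → Has T r c v → Has T (suc r) c w → v < w

countRow : ℕ → List ℕ → ℕ
countRow v []       = 0
countRow v (x ∷ xs) = (if v ≡ᵇ x then 1 else 0) + countRow v xs

count : ℕ → Tab → ℕ
count v []         = 0
count v (row ∷ T)  = countRow v row + count v T

-- the content sequence (α1, β1, α2, β2, ...) indexed from 1 (α, β paper-indexed)
seqC : (ℕ → ℕ) → (ℕ → ℕ) → ℕ → ℕ
seqC a b zero                = 0
seqC a b (suc zero)          = a 1
seqC a b (suc (suc zero))    = b 1
seqC a b (suc (suc (suc c))) = seqC (λ i → a (suc i)) (λ i → b (suc i)) (suc c)

HasContent : ∀ {n} → Weight n → Weight n → Tab → Set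
HasContent al be T = ∀ v → 1 ≤ v → count v T ≡ seqC (at al) (at be) v

oddHalf : ℕ → Maybe ℕ
oddHalf zero          = nothing
oddHalf (suc zero)    = just 1
oddHalf (suc (suc x)) = mapMaybe suc (oddHalf x)

evenHalf : ℕ → Maybe ℕ
evenHalf x = oddHalf (x ∸ 1)

inShuffle : (ℕ → ℕ) → (ℕ → ℕ) → ℕ → ℕ → Bool
inShuffle a b r c = oddPart (oddHalf r) (oddHalf c) ∨' evenPart (evenHalf r) (evenHalf c)
  where
  _∨'_ : Bool → Bool → Bool
  true  ∨' _ = true
  false ∨' y = y
  oddPart : Maybe ℕ → Maybe ℕ → Bool
  oddPart (just i) (just j) = j ≤ᵇ a i
  oddPart _ _ = false
  evenPart : Maybe ℕ → Maybe ℕ → Bool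
  evenPart (just i) (just j) = j ≤ᵇ b i
  evenPart _ _ = false

countCols : (ℕ → ℕ) → (ℕ → ℕ) → ℕ → ℕ → ℕ
countCols a b i zero    = 0
countCols a b i (suc c) =
  countCols a b i c + (if inShuffle a b i (suc c) ∧ inShuffle a b (i + 2) (suc c) then 1 else 0)

-- a_i for α ⊛ β; all squares lie in columns ≤ 2 (Σα + Σβ)
aNum : ∀ {n} → Weight n → Weight n → ℕ → ℕ
aNum al be i = countCols (at al) (at be) i (2 * (sumW al + sumW be))

ValidPair : Tab → ℕ → Pos × Pos → Set
ValidPair T i ((r₁ , c₁) , (r₂ , c₂)) =
  Has T r₁ c₁ i × Has T r₂ c₂ (i + 2) × r₁ ≤ r₂ × c₂ ≤ c₁

Peelable : ∀ {n} → Weight n → Weight n → Tab → Set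
Peelable al be T =
  SSYT T × HasContent al be T ×
  (∀ i → 1 ≤ i → Σ (List (Pos × Pos)) λ ps →
     aNum al be i ≤ length ps × All (ValidPair T i) ps ×
     Unique (map proj₁ ps) × Unique (map proj₂ ps))

ChOdd : Tab → ℕ → ℕ → ℕ → Set
ChOdd T i r c =
  Has T r c (2 * i ∸ 1) × (∀ c' → Has T r c' (2 * i ∸ 1) → c' ≤ c) × ¬ Has T (suc r) c (2 * i)

ChEven : Tab → ℕ → ℕ → ℕ → Set
ChEven T i r c =
  Has T r c (2 * i) × (∀ c' → Has T r c' (2 * i) → c ≤ c') × ¬ Has T (r ∸ 1) c (2 * i ∸ 1)

setL : ∀ {A : Set} → List A → ℕ → (A → A) → List A
setL []       _             f = []
setL (x ∷ xs) zero          f = x ∷ xs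
setL (x ∷ xs) (suc zero)    f = f x ∷ xs
setL (x ∷ xs) (suc (suc i)) f = x ∷ setL xs (suc i) f

setEntry : Tab → ℕ → ℕ → ℕ → Tab
setEntry T r c v = setL T r (λ row → setL row c (λ _ → v))

LeftmostChOddFrom : Tab → ℕ → ℕ → ℕ → ℕ → Set
LeftmostChOddFrom T j c₀ r c =
  ChOdd T j r c × c₀ ≤ c × (∀ r' c' → ChOdd T j r' c' → c₀ ≤ c' → c ≤ c')

RightmostChEven : Tab → ℕ → ℕ → ℕ → Set
RightmostChEven T l r c = ChEven T l r c × (∀ r' c' → ChEven T l r' c' → c' ≤ c)

UniqueSq : Tab → ℕ → ℕ → ℕ → Set
UniqueSq T v r c = Has T r c v × (∀ r' c' → Has T r' c' v → (r' , c') ≡ (r , c))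

-- steps (1),(2): Phase1 k j c₀ T T' : handling j, j+1, ..., k starting from T
-- (previous chosen square in column c₀; c₀ = 0 imposes no constraint) ends in T'
data Phase1 (k : ℕ) : ℕ → ℕ → Tab → Tab → Set where
  p1-done : ∀ {j c₀ T} → k < j → Phase1 k j c₀ T T
  p1-step : ∀ {j c₀ T T'} r c → j ≤ k → LeftmostChOddFrom T j c₀ r c →
            Phase1 k (suc j) c (setEntry T r c (2 * j)) T' → Phase1 k j c₀ T T'

data Phase2 {n} (nu rho : Weight n) : ℕ → Tab → Tab → Set where
  p2-done : ∀ {l T} → Peelable nu rho T → Phase2 nu rho l T T
  p2-step : ∀ {l T T'} r c r' c' → ¬ Peelable nu rho T →
            UniqueSq T (2 * l ∸ 1) r c → RightmostChEven T l r' c' →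
            Phase2 nu rho (suc l)
              (setEntry (setEntry T r c (2 * l)) r' c' (2 * l ∸ 1)) T' →
            Phase2 nu rho l T T'

ThetaRun : ∀ {n} → Weight n → Weight n → ℕ → ℕ → Tab → Tab → Set
ThetaRun nu rho m k T T' = Σ Tab λ T₁ → Phase1 k m 0 T T₁ × Phase2 nu rho (suc k) T₁ T'

{-# OPTIONS --safe #-}
-- Write o_j = 2j − 1 and e_j = 2j. The v-squares of a semistandard tableau are ordered by column, so the pairs
-- (v, v + 2) demanded by peelability exist iff for every column c there are at least as many v's as (v + 2)'s in
-- the columns ≥ c. As λ_1 = … = λ_k = a, this forces o_1, …, o_k to fill exactly the columns 1, …, a each, and an
-- o_j (j ≤ k) can be raised at the end of its row iff its column contains no e_j. Counting e_j's from the first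
-- such column on, starting from μ_m < a, shows that the first phase never gets stuck, and the leftmost choice of
-- s_j preserves all inequalities but the one between o_k and o_{k+1}; that one fails only if s_k and o_{k+1} both
-- lie in column a. Each repetition of step (3) moves the unique o_l to the start of the easternmost row of e_l's,
-- which restores the broken inequality and can only break the next one, between o_l and o_{l+1}.
-- Both phases can be undone: s_j lies in the one column ≤ a without an o_j, and the squares exchanged in step (3)
-- are the only o_l and the easternmost e_l. Runs of different lengths cannot merge, because the extra exchange
-- puts an e_l into a column from which on a peelable tableau that agrees below e_l has none.
module Submission where

open import Defs
open import Data.Nat
open import Data.Nat.Properties
open import Data.Bool using (true; false; if_then_else_; _∧_; T)
open import Data.Maybe using (Maybe; just; nothing; _>>=_)
open import Data.Maybe.Properties using (just-injective; ≡-dec)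
open import Data.List using (List; []; _∷_; length; map)
open import Data.List.Properties using (length-map)
open import Data.List.Relation.Unary.All using (All; []; _∷_)
open import Data.List.Relation.Unary.AllPairs using ([]; _∷_)
open import Data.List.Relation.Unary.Unique.Propositional using (Unique)
import Data.List.Relation.Unary.All as All
import Data.List.Relation.Unary.All.Properties as Allₚ
open import Data.Product using (∃; _×_; _,_; proj₁; proj₂)
open import Data.Sum using (_⊎_; inj₁; inj₂)
open import Data.Empty using (⊥; ⊥-elim)
open import Relation.Nullary using (¬_; Dec; yes; no)
open import Relation.Binary using (tri<; tri≈; tri>)
open import Relation.Binary.PropositionalEquality
open import Data.Fin using (Fin; toℕ; fromℕ<) renaming (suc to fsuc)
open import Data.Fin.Properties using (toℕ-fromℕ<)
open import Data.Integer using (ℤ; _⊖_) renaming (_+_ to _+ℤ_; _≤_ to _≤ℤ_)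
import Data.Integer.Properties as ℤₚ

-- Counting entries by column

-- The polytope enters through μ_m + λ_j < λ_m + μ_j for j outside m, ..., k. Taking j = n gives μ_m
-- < a, the room needed by the first phase. Taking j = m - 1 gives μ_m < μ_{m-1}, so e_m can gain a
-- square without overtaking e_{m-1}. If k < n - 1 and μ_{n-1} = 0, then j = n - 1 gives μ_m ≤ a -
-- 2, and this leaves no room for the first phase to end in a break. So after a break every e_l with
-- k < l < n occurs, which is why step (3) always finds a square to decrease. The obstacle in step
-- (3) is the pair (e_{l-1}, e_l). The exchange moves an o_l west from column d to column x and an
-- e_l east from x to d, so in the columns x + 1, ..., d there must have been strictly fewer e_l's
-- than e_{l-1}'s. The record `Critical` carries this strictness east of the column τ of the
-- previous decrease; between x and τ it has to be recovered from the shape of the row in which that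
-- decrease took place.

idx-≤ : {A : Set} (xs : List A) (i : ℕ) {x : A} → idx xs i ≡ just x → i ≤ length xs
idx-≤ (x ∷ xs) zero          ()
idx-≤ (x ∷ xs) (suc zero)    _ = s≤s z≤n
idx-≤ (x ∷ xs) (suc (suc i)) e = s≤s (idx-≤ xs (suc i) e)

idx-pos : {A : Set} (xs : List A) (i : ℕ) {x : A} → idx xs i ≡ just x → 1 ≤ i
idx-pos (x ∷ xs) zero    ()
idx-pos (x ∷ xs) (suc i) _ = s≤s z≤n

idx-get : {A : Set} (xs : List A) (i : ℕ) → 1 ≤ i → i ≤ length xs → ∃ λ x → idx xs i ≡ just x
idx-get (x ∷ xs) (suc zero)    _ _         = x , refl
idx-get (x ∷ xs) (suc (suc i)) _ (s≤s i≤n) = idx-get xs (suc i) (s≤s z≤n) i≤n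

Has-row : ∀ t {r c v} → Has t r c v → ∃ λ row → idx t r ≡ just row × idx row c ≡ just v
Has-row t {r} h with idx t r
... | just row = row , refl , h

row-Has : ∀ t {r c v row} → idx t r ≡ just row → idx row c ≡ just v → Has t r c v
row-Has t {r} e h rewrite e = h

Has-pos : ∀ t {r c v} → Has t r c v → 1 ≤ r × 1 ≤ c
Has-pos t {r} {c} h with Has-row t h
... | row , e , e' = idx-pos t r e , idx-pos row c e'

Has-functional : ∀ t {r c v w} → Has t r c v → Has t r c w → v ≡ w
Has-functional t h h' = just-injective (trans (sym h) h')

In : Tab → ℕ → ℕ → Set
In t c v = ∃ λ r → Has t r c v

hit : Maybe ℕ → ℕ → ℕ
hit (just x) v = if v ≡ᵇ x then 1 else 0
hit nothing  v = 0

mult : Tab → ℕ → ℕ → ℕ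
mult []        v c = 0
mult (row ∷ t) v c = hit (idx row c) v + mult t v c

sumFrom : (ℕ → ℕ) → ℕ → ℕ → ℕ
sumFrom g c zero    = 0
sumFrom g c (suc n) = g c + sumFrom g (suc c) n

width : Tab → ℕ
width []        = 0
width (row ∷ t) = length row ⊔ width t

abstract
  -- The number of summands does not depend on `c`: for `c ≥ 1`, `width t` columns reach at least to
  -- the last one, and the surplus columns contribute 0.
  east : Tab → ℕ → ℕ → ℕ
  east t v c = sumFrom (mult t v) c (width t)

  east-sum : ∀ t v c → east t v c ≡ sumFrom (mult t v) c (width t)
  east-sum t v c = refl

hit-self : ∀ v → hit (just v) v ≡ 1
hit-self v with v ≡ᵇ v in e
... | true  = refl
... | false with () ← subst T e (≡⇒≡ᵇ v v refl)

hit-other : ∀ {x v} → x ≢ v → hit (just x) v ≡ 0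
hit-other {x} {v} x≢v with v ≡ᵇ x in e
... | false = refl
... | true  = ⊥-elim (x≢v (sym (≡ᵇ⇒≡ v x (subst T (sym e) _))))

hit-pos : ∀ m v → 1 ≤ hit m v → m ≡ just v
hit-pos (just x) v p with x ≟ v
... | yes refl = refl
... | no x≢v with () ← subst (1 ≤_) (hit-other x≢v) p

hit-≤1 : ∀ m v → hit m v ≤ 1
hit-≤1 nothing v = z≤n
hit-≤1 (just x) v with v ≡ᵇ x
... | true  = s≤s z≤n
... | false = z≤n

In-mult : ∀ t {v c} → In t c v → 1 ≤ mult t v c
In-mult (row ∷ t) {v} {c} (suc zero , h) =
  ≤-trans (≤-reflexive (sym (trans (cong (λ m → hit m v) h) (hit-self v)))) (m≤m+n _ _)
In-mult (row ∷ t) (suc (suc r) , h) = ≤-trans (In-mult t (suc r , h)) (m≤n+m _ _)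

tail-Has : ∀ {row t r c v} → Has t r c v → Has (row ∷ t) (suc r) c v
tail-Has {t = t} {zero} h with () ← proj₁ (Has-pos t h)
tail-Has {t = t} {suc r} h = h

mult-In : ∀ t {v c} → 1 ≤ mult t v c → In t c v
mult-In (row ∷ t) {v} {c} p with hit (idx row c) v in e
... | suc _ = 1 , hit-pos (idx row c) v (subst (1 ≤_) (sym e) (s≤s z≤n))
... | zero with mult-In t p
...   | r , h = suc r , tail-Has {row} {t} {r} h

OncePerColumn : Tab → ℕ → ℕ → Set
OncePerColumn t v c = ∀ {r r'} → Has t r c v → Has t r' c v → r ≡ r'

mult-≤1 : ∀ t {v c} → OncePerColumn t v c → mult t v c ≤ 1
mult-≤1 [] _ = z≤n
mult-≤1 (row ∷ t) {v} {c} once with hit (idx row c) v in e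
... | zero = mult-≤1 t λ {r} {r'} h h' → suc-injective (once (tail-Has {row} {t} {r} h) (tail-Has {row} {t} {r'} h'))
... | suc n with mult t v c in e'
...   | zero = subst (_≤ 1) (trans e (sym (+-identityʳ (suc n)))) (hit-≤1 (idx row c) v)
...   | suc k with mult-In t (subst (1 ≤_) (sym e') (s≤s z≤n))
...     | r , h with once {1} {suc r} (hit-pos (idx row c) v (subst (1 ≤_) (sym e) (s≤s z≤n))) (tail-Has {row} {t} {r} h)
...       | refl with () ← proj₁ (Has-pos t h)

sumFrom-cong : ∀ {g h c} n → (∀ x → c ≤ x → g x ≡ h x) → sumFrom g c n ≡ sumFrom h c n
sumFrom-cong zero    e = refl
sumFrom-cong (suc n) e = cong₂ _+_ (e _ ≤-refl) (sumFrom-cong n λ x p → e x (<⇒≤ p))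

sumFrom-0 : ∀ {g c} n → (∀ x → c ≤ x → g x ≡ 0) → sumFrom g c n ≡ 0
sumFrom-0 zero    e = refl
sumFrom-0 (suc n) e = cong₂ _+_ (e _ ≤-refl) (sumFrom-0 n λ x p → e x (<⇒≤ p))

sumFrom-shift : ∀ g c n → sumFrom g (suc c) n ≡ sumFrom (λ x → g (suc x)) c n
sumFrom-shift g c zero    = refl
sumFrom-shift g c (suc n) = cong (g (suc c) +_) (sumFrom-shift g (suc c) n)

+-interchange : ∀ a b x y → (a + b) + (x + y) ≡ (a + x) + (b + y)
+-interchange a b x y = trans (+-assoc a b _) (trans (cong (a +_) (trans (sym (+-assoc b x y))
  (trans (cong (_+ y) (+-comm b x)) (+-assoc x b y)))) (sym (+-assoc a x _)))

sumFrom-+ : ∀ g h c n → sumFrom (λ x → g x + h x) c n ≡ sumFrom g c n + sumFrom h c n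
sumFrom-+ g h c zero    = refl
sumFrom-+ g h c (suc n) = trans (cong (g c + h c +_) (sumFrom-+ g h (suc c) n))
  (+-interchange (g c) (h c) (sumFrom g (suc c) n) (sumFrom h (suc c) n))

sumFrom-last : ∀ g c n → sumFrom g c (suc n) ≡ sumFrom g c n + g (c + n)
sumFrom-last g c zero    = trans (+-identityʳ (g c)) (cong g (sym (+-identityʳ c)))
sumFrom-last g c (suc n) = trans (cong (g c +_) (sumFrom-last g (suc c) n))
  (trans (sym (+-assoc (g c) _ _)) (cong (λ x → g c + sumFrom g (suc c) n + g x) (sym (+-suc c n))))

idx-beyond : {A : Set} (xs : List A) (i : ℕ) → length xs < i → idx xs i ≡ nothing
idx-beyond []       i             p = refl
idx-beyond (x ∷ xs) (suc zero)    (s≤s ())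
idx-beyond (x ∷ xs) (suc (suc i)) (s≤s p) = idx-beyond xs (suc i) p

mult-beyond : ∀ t v c → width t < c → mult t v c ≡ 0
mult-beyond []        v c p = refl
mult-beyond (row ∷ t) v c p
  rewrite idx-beyond row c (≤-<-trans (m≤m⊔n (length row) (width t)) p)
  = mult-beyond t v c (≤-<-trans (m≤n⊔m (length row) (width t)) p)

east-step : ∀ t v c → 1 ≤ c → east t v c ≡ mult t v c + east t v (suc c)
east-step t v c 1≤c rewrite east-sum t v c | east-sum t v (suc c) = sym (trans (sumFrom-last (mult t v) c (width t))
  (trans (cong (sumFrom (mult t v) c (width t) +_) (mult-beyond t v (c + width t) (m<n+m (width t) 1≤c))) (+-identityʳ _)))

east-beyond : ∀ t v c → width t < c → east t v c ≡ 0
east-beyond t v c p = trans (east-sum t v c) (sumFrom-0 (width t) λ x q → mult-beyond t v x (<-≤-trans p q))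

countRow-sum : ∀ v row n → length row ≤ n → countRow v row ≡ sumFrom (λ c → hit (idx row c) v) 1 n
countRow-sum v []       n _ = sym (sumFrom-0 n λ _ _ → refl)
countRow-sum v (x ∷ xs) (suc n) (s≤s p) = cong (hit (just x) v +_)
  (trans (countRow-sum v xs n p) (sym (trans (sumFrom-shift _ 1 n) (sumFrom-cong n λ { (suc c) _ → refl }))))

count-sum : ∀ v t n → width t ≤ n → count v t ≡ sumFrom (mult t v) 1 n
count-sum v []        n _ = sym (sumFrom-0 n λ _ _ → refl)
count-sum v (row ∷ t) n p = trans
  (cong₂ _+_ (countRow-sum v row n (≤-trans (m≤m⊔n (length row) (width t)) p))
             (count-sum v t n (≤-trans (m≤n⊔m (length row) (width t)) p)))
  (sym (sumFrom-+ (λ c → hit (idx row c) v) (mult t v) 1 n))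

count-east : ∀ v t → count v t ≡ east t v 1
count-east v t = trans (count-sum v t (width t) ≤-refl) (sym (east-sum t v 1))

In? : ∀ t c v → Dec (In t c v)
In? t c v with mult t v c in e
... | zero  = no λ h → n≮0 (subst (1 ≤_) e (In-mult t h))
... | suc _ = yes (mult-In t (subst (1 ≤_) (sym e) (s≤s z≤n)))

east-out : ∀ t {v c} → 1 ≤ c → ¬ In t c v → east t v c ≡ east t v (suc c)
east-out t {v} {c} 1≤c ∉ with mult t v c in e
... | zero  = trans (east-step t v c 1≤c) (cong (_+ east t v (suc c)) e)
... | suc _ = ⊥-elim (∉ (mult-In t (subst (1 ≤_) (sym e) (s≤s z≤n))))

east-anti : ∀ t {v c} → 1 ≤ c → east t v (suc c) ≤ east t v c
east-anti t {v} {c} 1≤c = subst (east t v (suc c) ≤_) (sym (east-step t v c 1≤c)) (m≤n+m _ _)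

east-mono : ∀ t {v c c'} → 1 ≤ c → c ≤ c' → east t v c' ≤ east t v c
east-mono t {v} {c} {c'} 1≤c c≤c' with m≤n⇒∃[o]m+o≡n c≤c'
... | o , refl = go o
  where
  go : ∀ o → east t v (c + o) ≤ east t v c
  go zero    = ≤-reflexive (cong (east t v) (+-identityʳ c))
  go (suc o) = ≤-trans (≤-reflexive (cong (east t v) (+-suc c o)))
    (≤-trans (east-anti t (≤-trans 1≤c (m≤m+n c o))) (go o))

east-In : ∀ t {v c} → 1 ≤ c → In t c v → suc (east t v (suc c)) ≤ east t v c
east-In t {v} {c} 1≤c i = subst (suc (east t v (suc c)) ≤_) (sym (east-step t v c 1≤c))
  (+-monoˡ-≤ (east t v (suc c)) (In-mult t i))

east-In-pos : ∀ t {v c c'} → 1 ≤ c → c ≤ c' → In t c' v → 1 ≤ east t v c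
east-In-pos t 1≤c p i = ≤-trans (≤-trans (s≤s z≤n) (east-In t (≤-trans 1≤c p) i)) (east-mono t 1≤c p)

east-last : ∀ t {v c} → 1 ≤ c → 1 ≤ east t v c →
  ∃ λ c' → c ≤ c' × In t c' v × east t v (suc c') ≡ 0
east-last t {v} {c} 1≤c p = go (width t) c 1≤c (m<n+m (width t) 1≤c) p
  where
  -- `n` columns remain to be searched; at `n = 0` the column lies beyond the width, where nothing
  -- is counted. Later walks east use the same scheme.
  go : ∀ n c → 1 ≤ c → width t < c + n → 1 ≤ east t v c →
    ∃ λ c' → c ≤ c' × In t c' v × east t v (suc c') ≡ 0
  go zero c 1≤c far p rewrite east-beyond t v c (subst (width t <_) (+-identityʳ c) far) with () ← p
  go (suc n) c 1≤c far p with east t v (suc c) in e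
  ... | zero  = c , ≤-refl ,
    mult-In t (subst (1 ≤_) (trans (east-step t v c 1≤c) (trans (cong (mult t v c +_) e) (+-identityʳ _))) p) , e
  ... | suc _ with go n (suc c) (s≤s z≤n) (subst (width t <_) (+-suc c n) far) (subst (1 ≤_) (sym e) (s≤s z≤n))
  ...   | c' , q , i , z = c' , <⇒≤ q , i , z

-- Comparing entries of a semistandard tableau by position

module _ {t : Tab} (ss : SSYT t) where
  open SSYT ss

  west₁ : ∀ {r c v} → 1 ≤ c → Has t r (suc c) v → ∃ λ w → Has t r c w × w ≤ v
  west₁ {r} {c} 1≤c h with Has-row t h
  ... | row , e , e' with idx-get row c 1≤c (<⇒≤ (idx-≤ row (suc c) e'))
  ...   | w , e'' = w , row-Has t e e'' , rowWeak r c w _ (row-Has t e e'') h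

  north₁ : ∀ {r c v} → 1 ≤ r → Has t (suc r) c v → ∃ λ w → Has t r c w × w < v
  north₁ {r} {c} 1≤r h with Has-row t h
  ... | row' , e , e' with idx-get t r 1≤r (<⇒≤ (idx-≤ t (suc r) e))
  ...   | row , f with idx-get row c (proj₂ (Has-pos t h)) (≤-trans (idx-≤ row' c e') (shapeDecr r row row' f e))
  ...     | w , f' = w , row-Has t f f' , colStrict r c w _ (row-Has t f f') h

  west : ∀ {r c c' v} → 1 ≤ c' → c' ≤ c → Has t r c v → ∃ λ w → Has t r c' w × w ≤ v
  west {r} {c} {c'} {v} 1≤c' c'≤c h with m≤n⇒∃[o]m+o≡n c'≤c
  ... | o , refl = go o h
    where
    go : ∀ o {v} → Has t r (c' + o) v → ∃ λ w → Has t r c' w × w ≤ v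
    go zero {v} h = v , subst (λ x → Has t r x v) (+-identityʳ c') h , ≤-refl
    go (suc o) {v} h with west₁ (≤-trans 1≤c' (m≤m+n c' o)) (subst (λ x → Has t r x v) (+-suc c' o) h)
    ... | w , h' , p with go o h'
    ...   | w' , h'' , p' = w' , h'' , ≤-trans p' p

  north : ∀ {r r' c v} → 1 ≤ r' → r' ≤ r → Has t r c v → ∃ λ w → Has t r' c w × w ≤ v × (r' < r → w < v)
  north {r} {r'} {c} {v} 1≤r' r'≤r h with m≤n⇒∃[o]m+o≡n r'≤r
  ... | o , refl = go o h
    where
    go : ∀ o {v} → Has t (r' + o) c v → ∃ λ w → Has t r' c w × w ≤ v × (r' < r' + o → w < v)
    go zero {v} h = v , subst (λ x → Has t x c v) (+-identityʳ r') h , ≤-refl ,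
      λ p → ⊥-elim (<-irrefl (sym (+-identityʳ r')) p)
    go (suc o) {v} h with north₁ (≤-trans 1≤r' (m≤m+n r' o)) (subst (λ x → Has t x c v) (+-suc r' o) h)
    ... | w , h' , p with go o h'
    ...   | w' , h'' , p' , _ = w' , h'' , <⇒≤ (≤-<-trans p' p) , λ _ → ≤-<-trans p' p

  nw-≤ : ∀ {r r' c c' v v'} → Has t r c v → Has t r' c' v' → r ≤ r' → c ≤ c' → v ≤ v'
  nw-≤ h h' p q with north (proj₁ (Has-pos t h)) p h'
  ... | w , k , w≤ , _ with west (proj₂ (Has-pos t h)) q k
  ...   | x , k' , x≤ rewrite Has-functional t h k' = ≤-trans x≤ w≤

  nw-< : ∀ {r r' c c' v v'} → Has t r c v → Has t r' c' v' → r < r' → c ≤ c' → v < v'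
  nw-< h h' p q with north (proj₁ (Has-pos t h)) (<⇒≤ p) h'
  ... | w , k , _ , w< with west (proj₂ (Has-pos t h)) q k
  ...   | x , k' , x≤ rewrite Has-functional t h k' = ≤-<-trans x≤ (w< p)

  row-unique : ∀ {r r' c v} → Has t r c v → Has t r' c v → r ≡ r'
  row-unique {r} {r'} h h' with <-cmp r r'
  ... | tri< p _ _ = ⊥-elim (<-irrefl refl (nw-< h h' p ≤-refl))
  ... | tri≈ _ e _ = e
  ... | tri> _ _ p = ⊥-elim (<-irrefl refl (nw-< h' h p ≤-refl))

  -- A square strictly below and weakly east of another has a strictly larger entry. Hence a
  -- `v`-square weakly east of a `(2 + v)`-square is automatically weakly above it, and pairing
  -- becomes a matter of columns alone.
  strip : ∀ {r r' c c' v w} → Has t r c v → Has t r' c' w → w ≤ v → c ≤ c' → r' ≤ r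
  strip {r} {r'} h h' w≤v c≤c' with r' ≤? r
  ... | yes p = p
  ... | no p = ⊥-elim (<-irrefl refl (<-≤-trans (nw-< h h' (≰⇒> p) c≤c') w≤v))

  below : ∀ {r r' c v w} → Has t r c v → Has t r' c w → v < w → r < r'
  below {r} {r'} h h' p with suc r ≤? r'
  ... | yes q = q
  ... | no q = ⊥-elim (<-irrefl refl (<-≤-trans p (nw-≤ h' h (≤-pred (≰⇒> q)) ≤-refl)))

  next : ∀ {r c v w} → Has t r c v → In t c w → v < w → ∃ λ x → Has t (suc r) c x × v < x × x ≤ w
  next h (r' , h') p with north (s≤s z≤n) (below h h' p) h'
  ... | x , k , x≤ , _ = x , k , nw-< h k ≤-refl ≤-refl , x≤

  next₁ : ∀ {r c v} → Has t r c v → In t c (suc v) → Has t (suc r) c (suc v)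
  next₁ h i with next h i ≤-refl
  ... | x , k , p , q rewrite ≤-antisym q p = k

  next₂ : ∀ {r c v} → Has t r c v → ¬ In t c (suc v) → In t c (suc (suc v)) → Has t (suc r) c (suc (suc v))
  next₂ {r} {c} {v} h ∉ i with next h i (<⇒≤ ≤-refl)
  ... | x , k , p , q with m≤n⇒m<n∨m≡n p
  ...   | inj₁ p' rewrite ≤-antisym q p' = k
  ...   | inj₂ refl = ⊥-elim (∉ (suc r , k))

  between : ∀ {r c c' x v v'} → Has t r c v → Has t r c' v' → c ≤ x → x ≤ c' →
    ∃ λ w → Has t r x w × v ≤ w × w ≤ v'
  between h h' p q with west (≤-trans (proj₂ (Has-pos t h)) p) q h'
  ... | w , k , w≤ = w , k , nw-≤ h k ≤-refl p , w≤

  between≡ : ∀ {r c c' x v} → Has t r c v → Has t r c' v → c ≤ x → x ≤ c' → Has t r x v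
  between≡ h h' p q with between h h' p q
  ... | w , k , p' , q' rewrite ≤-antisym q' p' = k

  mult-once : ∀ v c → mult t v c ≤ 1
  mult-once v c = mult-≤1 t λ h h' → row-unique h h'

  east-in : ∀ {v c} → 1 ≤ c → In t c v → east t v c ≡ suc (east t v (suc c))
  east-in {v} {c} 1≤c i = trans (east-step t v c 1≤c)
    (cong (_+ east t v (suc c)) (≤-antisym (mult-once v c) (In-mult t i)))

  east-≤suc : ∀ {v c} → 1 ≤ c → east t v c ≤ suc (east t v (suc c))
  east-≤suc {v} {c} 1≤c = subst (_≤ suc (east t v (suc c))) (sym (east-step t v c 1≤c))
    (+-monoˡ-≤ _ (mult-once v c))

module _ {t t' : Tab} (ss : SSYT t) (ss' : SSYT t') (w≡ : width t' ≡ width t) where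

  mult-cong : ∀ {v c} → (In t c v → In t' c v) → (In t' c v → In t c v) → mult t' v c ≡ mult t v c
  mult-cong {v} {c} f g with In? t c v
  ... | yes i = trans (≤-antisym (mult-once ss' v c) (In-mult t' (f i)))
                      (sym (≤-antisym (mult-once ss v c) (In-mult t i)))
  ... | no ∉ = trans (zero? t' λ i → ∉ (g i)) (sym (zero? t ∉))
    where
    zero? : ∀ u → ¬ In u c v → mult u v c ≡ 0
    zero? u ∉ with mult u v c in e
    ... | zero  = refl
    ... | suc _ = ⊥-elim (∉ (mult-In u (subst (1 ≤_) (sym e) (s≤s z≤n))))

  east-cong : ∀ {v} c → (∀ x → c ≤ x → In t x v → In t' x v) → (∀ x → c ≤ x → In t' x v → In t x v) →
    east t' v c ≡ east t v c
  east-cong {v} c f g rewrite east-sum t' v c | east-sum t v c | w≡ = sumFrom-cong (width t) λ x p → mult-cong (f x p) (g x p)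

  east-added : ∀ {v d} → 1 ≤ d → ¬ In t d v → In t' d v →
    (∀ x → x ≢ d → In t x v → In t' x v) → (∀ x → x ≢ d → In t' x v → In t x v) →
    ∀ {c} → 1 ≤ c → c ≤ d → east t' v c ≡ suc (east t v c)
  east-added {v} {d} 1≤d ∉ i f g {c} 1≤c c≤d with m≤n⇒∃[o]m+o≡n c≤d
  ... | o , refl = go o c 1≤c refl
    where
    go : ∀ n c → 1 ≤ c → c + n ≡ d → east t' v c ≡ suc (east t v c)
    go zero c 1≤c e with trans (sym (+-identityʳ c)) e
    ... | refl = trans (east-in ss' 1≤c i) (cong suc (trans
            (east-cong (suc c) (λ x p → f x (λ { refl → <-irrefl refl p })) (λ x p → g x (λ { refl → <-irrefl refl p })))
            (sym (east-out t 1≤c ∉))))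
    go (suc n) c 1≤c e = trans (east-step t' v c 1≤c) (trans
        (cong₂ _+_ (mult-cong (f c c≢d) (g c c≢d)) (go n (suc c) (s≤s z≤n) (trans (sym (+-suc c n)) e)))
        (trans (+-suc (mult t v c) _) (cong suc (sym (east-step t v c 1≤c)))))
      where
      c≢d : c ≢ d
      c≢d refl = m≢1+m+n c (trans (sym e) (+-suc c n))

-- Peelability as a counting condition

countAt : List ℕ → ℕ → ℕ
countAt []       c = 0
countAt (x ∷ xs) c = hit (just x) c + countAt xs c

countFrom : List ℕ → ℕ → ℕ
countFrom []       c = 0
countFrom (x ∷ xs) c = (if c ≤ᵇ x then 1 else 0) + countFrom xs c

≤ᵇ-true : ∀ {x y} → x ≤ y → (x ≤ᵇ y) ≡ true
≤ᵇ-true {x} {y} p with x ≤ᵇ y in e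
... | true  = refl
... | false = ⊥-elim (subst T e (≤⇒≤ᵇ p))

≤ᵇ-false : ∀ {x y} → ¬ (x ≤ y) → (x ≤ᵇ y) ≡ false
≤ᵇ-false {x} {y} ¬p with x ≤ᵇ y in e
... | false = refl
... | true  = ⊥-elim (¬p (≤ᵇ⇒≤ x y (subst T (sym e) _)))

countFrom-step : ∀ xs c → countFrom xs c ≡ countAt xs c + countFrom xs (suc c)
countFrom-step []       c = refl
countFrom-step (x ∷ xs) c = trans (cong₂ _+_ (one x) (countFrom-step xs c))
  (+-interchange (hit (just x) c) _ (countAt xs c) (countFrom xs (suc c)))
  where
  one : ∀ x → (if c ≤ᵇ x then 1 else 0) ≡ hit (just x) c + (if suc c ≤ᵇ x then 1 else 0)
  one x with <-cmp c x
  ... | tri< p ne _ rewrite ≤ᵇ-true (<⇒≤ p) | ≤ᵇ-true p | hit-other (≢-sym ne) = refl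
  ... | tri≈ np refl _ rewrite ≤ᵇ-true (≤-refl {c}) | ≤ᵇ-false np | hit-self c = refl
  ... | tri> np ne p rewrite ≤ᵇ-false (<⇒≱ p) | ≤ᵇ-false np | hit-other (≢-sym ne) = refl

countFrom-length : ∀ xs → All (1 ≤_) xs → countFrom xs 1 ≡ length xs
countFrom-length []       []       = refl
countFrom-length (x ∷ xs) (p ∷ ps) rewrite ≤ᵇ-true p = cong suc (countFrom-length xs ps)

countFrom-beyond : ∀ xs c → All (_< c) xs → countFrom xs c ≡ 0
countFrom-beyond []       c []       = refl
countFrom-beyond (x ∷ xs) c (p ∷ ps) rewrite ≤ᵇ-false (<⇒≱ p) = countFrom-beyond xs c ps

Square : Tab → ℕ → Pos → Set
Square t v (r , c) = Has t r c v

In-≤width : ∀ t {v c} → In t c v → c ≤ width t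
In-≤width t {v} {c} i with c ≤? width t
... | yes p = p
... | no p with () ← subst (1 ≤_) (mult-beyond t v c (≰⇒> p)) (In-mult t i)

countAt-duplicate : ∀ {t} → SSYT t → ∀ {v r c} L → Has t r c v → All ((r , c) ≢_) L → All (Square t v) L →
  countAt (map proj₂ L) c ≡ 0
countAt-duplicate ss [] h _ _ = refl
countAt-duplicate ss {v} {r} {c} ((r' , y) ∷ L) h (d ∷ ds) (k ∷ ks) with y ≟ c
... | no y≢x rewrite hit-other y≢x = countAt-duplicate ss L h ds ks
... | yes refl = ⊥-elim (d (cong (_, y) (row-unique ss h k)))

countAt-mult : ∀ {t} → SSYT t → ∀ {v} c (L : List Pos) → Unique L → All (Square t v) L →
  countAt (map proj₂ L) c ≤ mult t v c
countAt-mult ss c [] _ _ = z≤n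
countAt-mult {t} ss {v} c ((r , x) ∷ L) (d ∷ u) (h ∷ hs) with x ≟ c
... | no x≢c rewrite hit-other x≢c = countAt-mult ss c L u hs
... | yes refl rewrite hit-self x | countAt-duplicate ss L h d hs = In-mult t (r , h)

countFrom-east : ∀ {t} → SSYT t → ∀ {v} (L : List Pos) → Unique L → All (Square t v) L →
  ∀ {c} → 1 ≤ c → countFrom (map proj₂ L) c ≤ east t v c
countFrom-east {t} ss {v} L u hs {c} 1≤c = go (width t) c 1≤c (m<n+m (width t) 1≤c)
  where
  go : ∀ n c → 1 ≤ c → width t < c + n → countFrom (map proj₂ L) c ≤ east t v c
  go zero c 1≤c far rewrite countFrom-beyond (map proj₂ L) c (Allₚ.map⁺
      (All.map (λ {p} h → ≤-<-trans (In-≤width t (proj₁ p , h)) (subst (width t <_) (+-identityʳ c) far)) hs)) = z≤n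
  go (suc n) c 1≤c far rewrite countFrom-step (map proj₂ L) c | east-step t v c 1≤c =
    +-mono-≤ (countAt-mult ss c L u hs) (go n (suc c) (s≤s z≤n) (subst (width t <_) (+-suc c n) far))

-- At column 1 the list is as long as the number of squares, and each step east removes from the
-- list at most what it removes from the tableau, so the inequality persists.
east-countFrom : ∀ {t} → SSYT t → ∀ {v} (L : List Pos) → Unique L → All (Square t v) L →
  count v t ≤ length L → ∀ {c} → 1 ≤ c → east t v c ≤ countFrom (map proj₂ L) c
east-countFrom {t} ss {v} L u hs full {suc c} _ = go c
  where
  open ≤-Reasoning
  go : ∀ c → east t v (suc c) ≤ countFrom (map proj₂ L) (suc c)
  go zero = begin
    east t v 1                    ≡⟨ count-east v t ⟨
    count v t                     ≤⟨ full ⟩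
    length L                      ≡⟨ length-map proj₂ L ⟨
    length (map proj₂ L)          ≡⟨ countFrom-length (map proj₂ L)
                                       (Allₚ.map⁺ (All.map (λ h → proj₂ (Has-pos t h)) hs)) ⟨
    countFrom (map proj₂ L) 1     ∎
  go (suc c) = +-cancelˡ-≤ (mult t v (suc c)) _ _ (begin
    mult t v (suc c) + east t v (2 + c)                              ≡⟨ east-step t v (suc c) (s≤s z≤n) ⟨
    east t v (suc c)                                                 ≤⟨ go c ⟩
    countFrom (map proj₂ L) (suc c)                                  ≡⟨ countFrom-step (map proj₂ L) (suc c) ⟩
    countAt (map proj₂ L) (suc c) + countFrom (map proj₂ L) (2 + c)  ≤⟨ +-monoˡ-≤ _ (countAt-mult ss (suc c) L u hs) ⟩
    mult t v (suc c) + countFrom (map proj₂ L) (2 + c)               ∎)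

-- The pairs use up every `(2 + v)`-square. Those from column `c` on have distinct partners, which
-- also lie in columns from `c` on.
pairs⇒east : ∀ {t} → SSYT t → ∀ {v} (ps : List (Pos × Pos)) → All (ValidPair t v) ps →
  Unique (map proj₁ ps) → Unique (map proj₂ ps) → count (2 + v) t ≤ length ps →
  ∀ {c} → 1 ≤ c → east t (2 + v) c ≤ east t v c
pairs⇒east {t} ss {v} ps valid u₁ u₂ full {c} 1≤c = begin
  east t (2 + v) c                         ≤⟨ east-countFrom ss (map proj₂ ps) u₂
                                                (Allₚ.map⁺ (All.map (λ { (_ , h , _) → subst (Has t _ _) (+-comm v 2) h }) valid))
                                                (subst (count (2 + v) t ≤_) (sym (length-map proj₂ ps)) full) 1≤c ⟩
  countFrom (map proj₂ (map proj₂ ps)) c   ≤⟨ shift ps valid ⟩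
  countFrom (map proj₂ (map proj₁ ps)) c   ≤⟨ countFrom-east ss (map proj₁ ps) u₁ (Allₚ.map⁺ (All.map proj₁ valid)) 1≤c ⟩
  east t v c                               ∎
  where
  open ≤-Reasoning
  shift : ∀ ps → All (ValidPair t v) ps →
    countFrom (map proj₂ (map proj₂ ps)) c ≤ countFrom (map proj₂ (map proj₁ ps)) c
  shift [] [] = z≤n
  shift (((r₁ , c₁) , (r₂ , c₂)) ∷ ps) ((_ , _ , _ , c₂≤c₁) ∷ vs) with c ≤? c₂
  ... | yes p rewrite ≤ᵇ-true p | ≤ᵇ-true (≤-trans p c₂≤c₁) = s≤s (shift ps vs)
  ... | no p rewrite ≤ᵇ-false p = ≤-trans (shift ps vs) (m≤n+m _ _)

-- Invariant of a sweep from east to west: `free` holds the `v`-squares already passed but not yet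
-- paired. The western limits `c₁` and `c₂` are separate because a column releases its `v`-square
-- before its `(2 + v)`-square is paired.
record Matching (t : Tab) (v c₁ c₂ paired total : ℕ) : Set where
  field
    pairs     : List (Pos × Pos)
    free      : List Pos
    size      : length pairs ≡ paired
    sizes     : length pairs + length free ≡ total
    valid     : All (ValidPair t v) pairs
    unique₁   : Unique (map proj₁ pairs)
    unique₂   : Unique (map proj₂ pairs)
    uniqueF   : Unique free
    disjoint  : All (λ p → All (p ≢_) (map proj₁ pairs)) free
    east₁     : All (λ p → c₁ ≤ proj₂ p) (map proj₁ pairs)
    east₂     : All (λ p → c₂ ≤ proj₂ p) (map proj₂ pairs)
    eastF     : All (λ p → c₁ ≤ proj₂ p) free
    squares   : All (Square t v) free

module _ {t : Tab} (ss : SSYT t) {v : ℕ} where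
  open Matching

  fresh : ∀ {r c} {L : List Pos} → All (λ p → suc c ≤ proj₂ p) L → All ((r , c) ≢_) L
  fresh = All.map λ { p refl → <-irrefl refl p }

  weaken : ∀ {c₁ c₂ d₁ d₂ n k} → d₁ ≤ c₁ → d₂ ≤ c₂ → Matching t v c₁ c₂ n k → Matching t v d₁ d₂ n k
  weaken p q M = record
    { pairs = pairs M ; free = free M ; size = size M ; sizes = sizes M ; valid = valid M
    ; unique₁ = unique₁ M ; unique₂ = unique₂ M ; uniqueF = uniqueF M ; disjoint = disjoint M
    ; east₁ = All.map (≤-trans p) (east₁ M) ; east₂ = All.map (≤-trans q) (east₂ M)
    ; eastF = All.map (≤-trans p) (eastF M) ; squares = squares M }

  addFree : ∀ {r c c₂ n k} → Has t r c v → Matching t v (suc c) c₂ n k → Matching t v c c₂ n (suc k)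
  addFree {r} {c} h M = record
    { pairs    = pairs M
    ; free     = (r , c) ∷ free M
    ; size     = size M
    ; sizes    = trans (+-suc (length (pairs M)) _) (cong suc (sizes M))
    ; valid    = valid M
    ; unique₁  = unique₁ M
    ; unique₂  = unique₂ M
    ; uniqueF  = fresh (eastF M) ∷ uniqueF M
    ; disjoint = fresh (east₁ M) ∷ disjoint M
    ; east₁    = All.map <⇒≤ (east₁ M)
    ; east₂    = east₂ M
    ; eastF    = ≤-refl ∷ All.map <⇒≤ (eastF M)
    ; squares  = h ∷ squares M
    }

  addPair : ∀ {r c n k} → n < k → Has t r c (2 + v) → Matching t v c (suc c) n k → Matching t v c c (suc n) k
  addPair {r} {c} n<k h M with free M | sizes M | uniqueF M | disjoint M | eastF M | squares M
  ... | [] | e | _ | _ | _ | _ = ⊥-elim (<-irrefl (trans (sym (size M)) (trans (sym (+-identityʳ _)) e)) n<k)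
  ... | x ∷ free' | e | d ∷ u | ds ∷ dss | p ∷ ps | k ∷ ks = record
    { pairs    = (x , (r , c)) ∷ pairs M
    ; free     = free'
    ; size     = cong suc (size M)
    ; sizes    = trans (sym (+-suc (length (pairs M)) _)) e
    ; valid    = (k , subst (Has t r c) (+-comm 2 v) h , strip ss h k (m≤n+m v 2) p , p) ∷ valid M
    ; unique₁  = ds ∷ unique₁ M
    ; unique₂  = fresh (east₂ M) ∷ unique₂ M
    ; uniqueF  = u
    ; disjoint = All.zipWith (λ { (x≢y , q) → ≢-sym x≢y ∷ q }) (d , dss)
    ; east₁    = p ∷ east₁ M
    ; east₂    = ≤-refl ∷ All.map <⇒≤ (east₂ M)
    ; eastF    = ps
    ; squares  = ks
    }

  -- Sweeping the columns from right to left, each (2 + v)-square is paired with any unused v-square.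
  match : (∀ {c} → 1 ≤ c → east t (2 + v) c ≤ east t v c) →
    ∀ {c} → 1 ≤ c → Matching t v c c (east t (2 + v) c) (east t v c)
  match dom {c} 1≤c = go (width t) c 1≤c (m<n+m (width t) 1≤c)
    where
    go : ∀ n c → 1 ≤ c → width t < c + n → Matching t v c c (east t (2 + v) c) (east t v c)
    go zero c 1≤c far
      rewrite east-beyond t (2 + v) c (subst (width t <_) (+-identityʳ c) far)
            | east-beyond t v c (subst (width t <_) (+-identityʳ c) far) = record
      { pairs = [] ; free = [] ; size = refl ; sizes = refl ; valid = [] ; unique₁ = [] ; unique₂ = []
      ; uniqueF = [] ; disjoint = [] ; east₁ = [] ; east₂ = [] ; eastF = [] ; squares = [] }
    go (suc n) c 1≤c far = second (first (go n (suc c) (s≤s z≤n) (subst (width t <_) (+-suc c n) far)))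
      where
      first : Matching t v (suc c) (suc c) (east t (2 + v) (suc c)) (east t v (suc c)) →
        Matching t v c (suc c) (east t (2 + v) (suc c)) (east t v c)
      first M with In? t c v
      ... | yes (r , h) = subst (Matching t v c (suc c) _) (sym (east-in ss 1≤c (r , h))) (addFree h M)
      ... | no ∉ = subst (Matching t v c (suc c) _) (sym (east-out t 1≤c ∉)) (weaken (n≤1+n c) ≤-refl M)
      second : Matching t v c (suc c) (east t (2 + v) (suc c)) (east t v c) →
        Matching t v c c (east t (2 + v) c) (east t v c)
      second M with In? t c (2 + v)
      ... | yes (r , h) = subst (λ n → Matching t v c c n (east t v c)) (sym (east-in ss 1≤c (r , h)))
              (addPair (subst (_≤ east t v c) (east-in ss 1≤c (r , h)) (dom 1≤c)) h M)
      ... | no ∉ = subst (λ n → Matching t v c c n (east t v c)) (sym (east-out t 1≤c ∉)) (weaken ≤-refl (n≤1+n c) M)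

Content : (ℕ → ℕ) → Tab → Set
Content K t = ∀ v → 1 ≤ v → count v t ≡ K v

Dominated : Tab → ℕ → Set
Dominated t v = ∀ {c} → 1 ≤ c → east t (2 + v) c ≤ east t v c

-- The lattice condition of Yamanouchi tableaux, imposed separately on the odd and on the even
-- entries.
Yamanouchi : (ℕ → ℕ) → Tab → Set
Yamanouchi K t = SSYT t × Content K t × (∀ v → 1 ≤ v → Dominated t v)

module _ {n : ℕ} {al be : Weight n} (full : ∀ v → 1 ≤ v → aNum al be v ≡ seqC (at al) (at be) (2 + v)) where

  peelable⇒ : ∀ {t} → Peelable al be t → Yamanouchi (seqC (at al) (at be)) t
  peelable⇒ {t} (ss , co , P) = ss , co , dom
    where
    dom : ∀ v → 1 ≤ v → Dominated t v
    dom v 1≤v with P v 1≤v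
    ... | ps , enough , valid , u₁ , u₂ = pairs⇒east ss ps valid u₁ u₂
          (subst (_≤ length ps) (trans (full v 1≤v) (sym (co (2 + v) (s≤s z≤n)))) enough)

  peelable⇐ : ∀ {t} → Yamanouchi (seqC (at al) (at be)) t → Peelable al be t
  peelable⇐ {t} (ss , co , dom) = ss , co , λ v 1≤v →
    let M = match ss (dom v 1≤v) ≤-refl
        open Matching M
    in pairs , ≤-reflexive (trans (full v 1≤v) (trans (sym (co (2 + v) (s≤s z≤n))) (trans (count-east (2 + v) t) (sym size))))
       , valid , unique₁ , unique₂

-- Changing an entry

idx-setL : {A : Set} (xs : List A) (i : ℕ) (f : A → A) {x : A} → idx xs i ≡ just x → idx (setL xs i f) i ≡ just (f x)
idx-setL (x ∷ xs) zero          f ()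
idx-setL (x ∷ xs) (suc zero)    f refl = refl
idx-setL (x ∷ xs) (suc (suc i)) f e    = idx-setL xs (suc i) f e

idx-setL-≢ : {A : Set} (xs : List A) (i j : ℕ) (f : A → A) → i ≢ j → idx (setL xs i f) j ≡ idx xs j
idx-setL-≢ []       i             j             f i≢j = refl
idx-setL-≢ (x ∷ xs) zero          j             f i≢j = refl
idx-setL-≢ (x ∷ xs) (suc zero)    zero          f i≢j = refl
idx-setL-≢ (x ∷ xs) (suc zero)    (suc zero)    f i≢j = ⊥-elim (i≢j refl)
idx-setL-≢ (x ∷ xs) (suc zero)    (suc (suc j)) f i≢j = refl
idx-setL-≢ (x ∷ xs) (suc (suc i)) zero          f i≢j = refl
idx-setL-≢ (x ∷ xs) (suc (suc i)) (suc zero)    f i≢j = refl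
idx-setL-≢ (x ∷ xs) (suc (suc i)) (suc (suc j)) f i≢j = idx-setL-≢ xs (suc i) (suc j) f λ e → i≢j (cong suc e)

length-setL : {A : Set} (xs : List A) (i : ℕ) (f : A → A) → length (setL xs i f) ≡ length xs
length-setL []       i             f = refl
length-setL (x ∷ xs) zero          f = refl
length-setL (x ∷ xs) (suc zero)    f = refl
length-setL (x ∷ xs) (suc (suc i)) f = cong suc (length-setL xs (suc i) f)

setL-undo : {A : Set} (xs : List A) (i : ℕ) (f g : A → A) {x : A} → idx xs i ≡ just x → g (f x) ≡ x →
  setL (setL xs i f) i g ≡ xs
setL-undo (x ∷ xs) zero          f g ()   e'
setL-undo (x ∷ xs) (suc zero)    f g refl e' = cong (_∷ xs) e'
setL-undo (x ∷ xs) (suc (suc i)) f g e    e' = cong (x ∷_) (setL-undo xs (suc i) f g e e')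

width-setL : ∀ t i f → (∀ row → length (f row) ≡ length row) → width (setL t i f) ≡ width t
width-setL []        i             f e = refl
width-setL (row ∷ t) zero          f e = refl
width-setL (row ∷ t) (suc zero)    f e = cong (_⊔ width t) (e row)
width-setL (row ∷ t) (suc (suc i)) f e = cong (length row ⊔_) (width-setL t (suc i) f e)

width-setEntry : ∀ t r c v → width (setEntry t r c v) ≡ width t
width-setEntry t r c v = width-setL t r _ λ row → length-setL row c _

setEntry-undo : ∀ t {r c v w} → Has t r c v → setEntry (setEntry t r c w) r c v ≡ t
setEntry-undo t {r} {c} h with Has-row t h
... | row , e , e' = setL-undo t r _ _ e (setL-undo row c _ _ e' refl)

Has-set : ∀ t {r c v w} → Has t r c v → Has (setEntry t r c w) r c w
Has-set t {r} {c} {v} {w} h with Has-row t h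
... | row , e , e' = row-Has (setEntry t r c w) (idx-setL t r _ e) (idx-setL row c _ e')

entry-set-≢ : ∀ t {r c w r' c'} → (r' , c') ≢ (r , c) → entry (setEntry t r c w) r' c' ≡ entry t r' c'
entry-set-≢ t {r} {c} {w} {r'} {c'} ne with r ≟ r'
... | no r≢r' = cong (_>>= λ row → idx row c') (idx-setL-≢ t r r' _ r≢r')
... | yes refl with idx t r in e
...   | just row = trans (cong (_>>= λ row → idx row c') (idx-setL t r _ e))
                         (idx-setL-≢ row c c' _ λ { refl → ne refl })
...   | nothing = cong (_>>= λ row → idx row c') (absent t r e)
  where
  absent : ∀ (t : Tab) i {f} → idx t i ≡ nothing → idx (setL t i f) i ≡ nothing
  absent []        i             e = refl
  absent (row ∷ t) zero          e = refl
  absent (row ∷ t) (suc (suc i)) e = absent t (suc i) e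

pos≟ : ∀ (r c r' c' : ℕ) → ((r , c) ≡ (r' , c')) ⊎ ((r , c) ≢ (r' , c'))
pos≟ r c r' c' with r ≟ r' | c ≟ c'
... | yes refl | yes refl = inj₁ refl
... | no r≢r'  | _        = inj₂ λ { refl → r≢r' refl }
... | yes _    | no c≢c'  = inj₂ λ { refl → c≢c' refl }

set-Has : ∀ t {r c x w r' c' u} → Has t r c x → Has (setEntry t r c w) r' c' u →
  ((r' , c') ≡ (r , c) × u ≡ w) ⊎ ((r' , c') ≢ (r , c) × Has t r' c' u)
set-Has t {r} {c} {x} {w} {r'} {c'} h k with pos≟ r' c' r c
... | inj₁ refl = inj₁ (refl , Has-functional (setEntry t r c w) k (Has-set t h))
... | inj₂ ne   = inj₂ (ne , trans (sym (entry-set-≢ t ne)) k)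

idx-setL⁻ : {A : Set} (xs : List A) (i j : ℕ) (f : A → A) {y : A} → idx (setL xs i f) j ≡ just y →
  ∃ λ x → idx xs j ≡ just x × (y ≡ x ⊎ y ≡ f x)
idx-setL⁻ (x ∷ xs) zero          j             f e = _ , e , inj₁ refl
idx-setL⁻ (x ∷ xs) (suc zero)    (suc zero)    f refl = x , refl , inj₂ refl
idx-setL⁻ (x ∷ xs) (suc zero)    (suc (suc j)) f e = _ , e , inj₁ refl
idx-setL⁻ (x ∷ xs) (suc (suc i)) (suc zero)    f e = _ , e , inj₁ refl
idx-setL⁻ (x ∷ xs) (suc (suc i)) (suc (suc j)) f e = idx-setL⁻ xs (suc i) (suc j) f e

set-row-length : ∀ t r c w r' {row} → idx (setEntry t r c w) r' ≡ just row →
  ∃ λ row₀ → idx t r' ≡ just row₀ × length row ≡ length row₀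
set-row-length t r c w r' e with idx-setL⁻ t r r' _ e
... | row₀ , e₀ , inj₁ refl = row₀ , e₀ , refl
... | row₀ , e₀ , inj₂ refl = row₀ , e₀ , length-setL row₀ c _

SSYT-set : ∀ {t r c x w} → SSYT t → Has t r c x → 1 ≤ w →
  (∀ {c' u} → suc c' ≡ c → Has t r c' u → u ≤ w) → (∀ {u} → Has t r (suc c) u → w ≤ u) →
  (∀ {r' u} → suc r' ≡ r → Has t r' c u → u < w) → (∀ {u} → Has t (suc r) c u → w < u) →
  SSYT (setEntry t r c w)
SSYT-set {t} {r} {c} {x} {w} ss h 1≤w left right up down = record
  { rowsNonempty = λ r' row e → case₁ {row = row} (set-row-length t r c w r' e)
  ; shapeDecr = λ r' row row' e e' → case₂ {row = row} {row'} (set-row-length t r c w r' e) (set-row-length t r c w (suc r') e')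
  ; positive = λ r' c' v k → case₃ (set-Has t h k)
  ; rowWeak = λ r' c' v v' k k' → case₄ (set-Has t h k) (set-Has t h k')
  ; colStrict = λ r' c' v v' k k' → case₅ (set-Has t h k) (set-Has t h k')
  }
  where
  open SSYT ss
  case₁ : ∀ {r'} {row : List ℕ} → (∃ λ row₀ → idx t r' ≡ just row₀ × length row ≡ length row₀) → 1 ≤ length row
  case₁ (row₀ , e , l) = subst (1 ≤_) (sym l) (rowsNonempty _ row₀ e)
  case₂ : ∀ {r'} {row row' : List ℕ} → (∃ λ row₀ → idx t r' ≡ just row₀ × length row ≡ length row₀) →
    (∃ λ row₀ → idx t (suc r') ≡ just row₀ × length row' ≡ length row₀) → length row' ≤ length row
  case₂ (row₀ , e , l) (row₁ , e' , l') = subst₂ _≤_ (sym l') (sym l) (shapeDecr _ row₀ row₁ e e')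
  case₃ : ∀ {r' c' v} → ((r' , c') ≡ (r , c) × v ≡ w) ⊎ ((r' , c') ≢ (r , c) × Has t r' c' v) → 1 ≤ v
  case₃ (inj₁ (_ , refl)) = 1≤w
  case₃ (inj₂ (_ , k))    = positive _ _ _ k
  case₄ : ∀ {r' c' v v'} → ((r' , c') ≡ (r , c) × v ≡ w) ⊎ ((r' , c') ≢ (r , c) × Has t r' c' v) →
    ((r' , suc c') ≡ (r , c) × v' ≡ w) ⊎ ((r' , suc c') ≢ (r , c) × Has t r' (suc c') v') → v ≤ v'
  case₄ (inj₁ (refl , refl)) (inj₁ (() , _))
  case₄ (inj₁ (refl , refl)) (inj₂ (_ , k'))      = right k'
  case₄ (inj₂ (_ , k))       (inj₁ (refl , refl)) = left refl k
  case₄ (inj₂ (_ , k))       (inj₂ (_ , k'))      = rowWeak _ _ _ _ k k'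
  case₅ : ∀ {r' c' v v'} → ((r' , c') ≡ (r , c) × v ≡ w) ⊎ ((r' , c') ≢ (r , c) × Has t r' c' v) →
    ((suc r' , c') ≡ (r , c) × v' ≡ w) ⊎ ((suc r' , c') ≢ (r , c) × Has t (suc r') c' v') → v < v'
  case₅ (inj₁ (refl , refl)) (inj₁ (() , _))
  case₅ (inj₁ (refl , refl)) (inj₂ (_ , k'))      = down k'
  case₅ (inj₂ (_ , k))       (inj₁ (refl , refl)) = up refl k
  case₅ (inj₂ (_ , k))       (inj₂ (_ , k'))      = colStrict _ _ _ _ k k'

-- Both tableaux are semistandard, so the relation can be read from either end: lowering an entry is
-- a `Bump` with the two tableaux exchanged, and one set of counting lemmas serves both changes in
-- step (3).
record Bump (t t' : Tab) (v r c : ℕ) : Set where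
  field
    ss  : SSYT t
    ss' : SSYT t'
    sq  : Has t r c v
    eq  : t' ≡ setEntry t r c (suc v)

  sq' : Has t' r c (suc v)
  sq' rewrite eq = Has-set t sq

  undo : t ≡ setEntry t' r c v
  undo rewrite eq = sym (setEntry-undo t sq)

  width≡ : width t' ≡ width t
  width≡ rewrite eq = width-setEntry t r c (suc v)

  1≤c : 1 ≤ c
  1≤c = proj₂ (Has-pos t sq)

  to : ∀ {r' c' u} → (r' , c') ≢ (r , c) → Has t r' c' u → Has t' r' c' u
  to ne h rewrite eq = trans (entry-set-≢ t ne) h

  from : ∀ {r' c' u} → (r' , c') ≢ (r , c) → Has t' r' c' u → Has t r' c' u
  from ne h rewrite eq = trans (sym (entry-set-≢ t ne)) h

  to-value : ∀ {r' c' u} → u ≢ v → Has t r' c' u → Has t' r' c' u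
  to-value u≢v h = to (λ { refl → u≢v (Has-functional t h sq) }) h

  from-value : ∀ {r' c' u} → u ≢ suc v → Has t' r' c' u → Has t r' c' u
  from-value u≢v h = from (λ { refl → u≢v (Has-functional t' h sq') }) h

  to-col : ∀ {c' u} → c' ≢ c → In t c' u → In t' c' u
  to-col c'≢c (r' , h) = r' , to (λ { refl → c'≢c refl }) h

  from-col : ∀ {c' u} → c' ≢ c → In t' c' u → In t c' u
  from-col c'≢c (r' , h) = r' , from (λ { refl → c'≢c refl }) h

  not-hi : ¬ In t c (suc v)
  not-hi (r' , h) with row-unique ss' (to-value (λ e → m≢1+m+n v (trans (sym e) (cong suc (sym (+-identityʳ v))))) h) sq'
  ... | refl = <-irrefl (Has-functional t sq h) ≤-refl

  not-lo : ¬ In t' c v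
  not-lo (r' , h) with row-unique ss (from-value (λ e → <-irrefl e ≤-refl) h) sq
  ... | refl = <-irrefl (Has-functional t' h sq') ≤-refl

  east-other : ∀ {u} d → u ≢ v → u ≢ suc v → east t' u d ≡ east t u d
  east-other d p q = east-cong ss ss' width≡ d (λ x _ (r' , h) → r' , to-value p h) (λ x _ (r' , h) → r' , from-value q h)

  east-hi≤ : ∀ {d} → 1 ≤ d → d ≤ c → east t' (suc v) d ≡ suc (east t (suc v) d)
  east-hi≤ = east-added ss ss' width≡ 1≤c not-hi (r , sq') (λ x ne → to-col ne) (λ x ne → from-col ne)

  east-lo≤ : ∀ {d} → 1 ≤ d → d ≤ c → east t v d ≡ suc (east t' v d)
  east-lo≤ = east-added ss' ss (sym width≡) 1≤c not-lo (r , sq) (λ x ne → from-col ne) (λ x ne → to-col ne)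

  east-> : ∀ {u d} → c < d → east t' u d ≡ east t u d
  east-> {u} {d} c<d = east-cong ss ss' width≡ d (λ x p → to-col (ne p)) (λ x p → from-col (ne p))
    where
    ne : ∀ {x} → d ≤ x → x ≢ c
    ne p refl = <⇒≱ c<d p

  east-hi-≥ : ∀ {d} → 1 ≤ d → east t (suc v) d ≤ east t' (suc v) d
  east-hi-≥ {d} 1≤d with d ≤? c
  ... | yes p = ≤-trans (n≤1+n _) (≤-reflexive (sym (east-hi≤ 1≤d p)))
  ... | no p  = ≤-reflexive (sym (east-> (≰⇒> p)))

  east-lo-≤ : ∀ {d} → 1 ≤ d → east t' v d ≤ east t v d
  east-lo-≤ {d} 1≤d with d ≤? c
  ... | yes p = ≤-trans (n≤1+n _) (≤-reflexive (sym (east-lo≤ 1≤d p)))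
  ... | no p  = ≤-reflexive (east-> (≰⇒> p))

  count-hi : count (suc v) t' ≡ suc (count (suc v) t)
  count-hi = trans (count-east (suc v) t') (trans (east-hi≤ ≤-refl 1≤c) (cong suc (sym (count-east (suc v) t))))

  count-lo : count v t ≡ suc (count v t')
  count-lo = trans (count-east v t) (trans (east-lo≤ ≤-refl 1≤c) (cong suc (sym (count-east v t'))))

  count-other : ∀ {u} → u ≢ v → u ≢ suc v → count u t' ≡ count u t
  count-other {u} p q = trans (count-east u t') (trans (east-other 1 p q) (sym (count-east u t)))

raise : ∀ {t r c v} → SSYT t → Has t r c v → ¬ Has t r (suc c) v → ¬ Has t (suc r) c (suc v) →
  Bump t (setEntry t r c (suc v)) v r c
raise {t} {r} {c} {v} ss h right down = record
  { ss = ss ; sq = h ; eq = refl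
  ; ss' = SSYT-set ss h (s≤s z≤n)
      (λ { refl k → ≤-trans (rowWeak _ _ _ _ k h) (n≤1+n v) })
      (λ k → ≤∧≢⇒< (rowWeak _ _ _ _ h k) λ { refl → right k })
      (λ { refl k → ≤-trans (colStrict _ _ _ _ k h) (n≤1+n v) })
      (λ k → ≤∧≢⇒< (colStrict _ _ _ _ h k) λ { refl → down k }) }
  where open SSYT ss

lower : ∀ {t r c v} → SSYT t → 1 ≤ v → Has t r c (suc v) → (∀ {c'} → suc c' ≡ c → ¬ Has t r c' (suc v)) →
  (∀ {r'} → suc r' ≡ r → ¬ Has t r' c v) → Bump (setEntry t r c v) t v r c
lower {t} {r} {c} {v} ss 1≤v h left up = record
  { ss' = ss ; sq = Has-set t h ; eq = sym (setEntry-undo t h)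
  ; ss = SSYT-set ss h 1≤v
      (λ { refl k → ≤-pred (≤∧≢⇒< (rowWeak _ _ _ _ k h) λ { refl → left refl k }) })
      (λ k → <⇒≤ (rowWeak _ _ _ _ h k))
      (λ { refl k → ≤∧≢⇒< (≤-pred (colStrict _ _ _ _ k h)) λ { refl → up refl k } })
      (λ k → <-trans (n<1+n v) (colStrict _ _ _ _ h k)) }
  where open SSYT ss

-- Stretches of equal entries

dbl : ℕ → ℕ
dbl zero    = 0
dbl (suc i) = 2 + dbl i

dbl-< : ∀ {i j} → i < j → 2 + dbl i ≤ dbl j
dbl-< {zero}  {suc j} _       = s≤s (s≤s z≤n)
dbl-< {suc i} {suc j} (s≤s p) = s≤s (s≤s (dbl-< p))

dbl-≤ : ∀ {i j} → i ≤ j → dbl i ≤ dbl j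
dbl-≤ z≤n     = z≤n
dbl-≤ (s≤s p) = s≤s (s≤s (dbl-≤ p))

Has? : ∀ t r c v → Dec (Has t r c v)
Has? t r c v = ≡-dec _≟_ (entry t r c) (just v)

module _ (t : Tab) where

  east-zero-∉ : ∀ {v c x} → 1 ≤ c → east t v c ≡ 0 → c ≤ x → ¬ In t x v
  east-zero-∉ 1≤c z c≤x i with () ← subst (1 ≤_) z (east-In-pos t 1≤c c≤x i)

  east-zero-bound : ∀ {v c x} → east t v (suc c) ≡ 0 → In t x v → x ≤ c
  east-zero-bound {c = c} {x} z i with x ≤? c
  ... | yes p = p
  ... | no p  = ⊥-elim (east-zero-∉ (s≤s z≤n) z (≰⇒> p) i)

  ∉-east-zero : ∀ {v c} → 1 ≤ c → (∀ x → c ≤ x → ¬ In t x v) → east t v c ≡ 0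
  ∉-east-zero {v} {c} 1≤c f with east t v c in e
  ... | zero  = refl
  ... | suc _ with east-last t 1≤c (subst (1 ≤_) (sym e) (s≤s z≤n))
  ...   | x , p , i , _ = ⊥-elim (f x p i)

  east-gap : ∀ {v c d} → 1 ≤ c → c ≤ d → (∀ x → c ≤ x → x < d → ¬ In t x v) → east t v c ≡ east t v d
  east-gap {v} {c} 1≤c c≤d f with m≤n⇒∃[o]m+o≡n c≤d
  ... | o , refl = go o f
    where
    go : ∀ o → (∀ x → c ≤ x → x < c + o → ¬ In t x v) → east t v c ≡ east t v (c + o)
    go zero    f = cong (east t v) (sym (+-identityʳ c))
    go (suc o) f rewrite +-suc c o = trans (go o λ x p q → f x p (m<n⇒m<1+n q))
      (east-out t (≤-trans 1≤c (m≤m+n c o)) (f (c + o) (m≤m+n c o) ≤-refl))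

module _ {t : Tab} (ss : SSYT t) where

  east-range : ∀ {v c} o → 1 ≤ c → east t v c ≤ o + east t v (c + o)
  east-range {v} {c} zero    1≤c = ≤-reflexive (cong (east t v) (sym (+-identityʳ c)))
  east-range {v} {c} (suc o) 1≤c rewrite +-suc c o = ≤-trans (east-range o 1≤c)
    (≤-trans (+-monoʳ-≤ o (east-≤suc ss (≤-trans 1≤c (m≤m+n c o)))) (≤-reflexive (+-suc o _)))

  east-run : ∀ {v c} o → 1 ≤ c → (∀ x → c ≤ x → x < c + o → In t x v) → east t v c ≡ o + east t v (c + o)
  east-run {v} {c} zero    1≤c f = cong (east t v) (sym (+-identityʳ c))
  east-run {v} {c} (suc o) 1≤c f rewrite +-suc c o = trans (east-run o 1≤c λ x p q → f x p (m<n⇒m<1+n q))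
    (trans (cong (o +_) (east-in ss (≤-trans 1≤c (m≤m+n c o)) (f (c + o) (m≤m+n c o) ≤-refl))) (+-suc o _))

  -- Pigeonhole: `a` squares in the columns 1, ..., `a`, at most one per column.
  filled : ∀ {v a} → east t v (suc a) ≡ 0 → east t v 1 ≡ a → ∀ {x} → 1 ≤ x → x ≤ a → In t x v
  filled {v} {a} z e {suc x} _ x<a with In? t (suc x) v
  ... | yes i = i
  ... | no ∉ with m≤n⇒∃[o]m+o≡n x<a
  ...   | o , refl = ⊥-elim (<-irrefl refl (begin-strict
    x + o                             <⟨ n<1+n _ ⟩
    suc x + o                         ≡⟨ e ⟨
    east t v 1                        ≤⟨ east-range x ≤-refl ⟩
    x + east t v (suc x)              ≡⟨ cong (x +_) (east-out t (s≤s z≤n) ∉) ⟩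
    x + east t v (2 + x)              ≤⟨ +-monoʳ-≤ x (east-range o (s≤s z≤n)) ⟩
    x + (o + east t v (2 + x + o))    ≡⟨ cong (λ y → x + (o + y)) z ⟩
    x + (o + 0)                       ≡⟨ cong (x +_) (+-identityʳ o) ⟩
    x + o                             ∎))
    where open ≤-Reasoning

  ones-bound : ∀ {a} → east t 1 1 ≡ a → east t 1 (suc a) ≡ 0
  ones-bound {a} e = ∉-east-zero t (s≤s z≤n) λ { x a<x (r , h) → <-irrefl refl (begin-strict
      a                                ≤⟨ m≤m+n a _ ⟩
      a + east t 1 (2 + a)             <⟨ n<1+n _ ⟩
      suc a + east t 1 (1 + suc a)     ≡⟨ east-run (suc a) ≤-refl (λ y 1≤y y≤a → row₁ h 1≤y (≤-trans (≤-pred y≤a) a<x)) ⟨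
      east t 1 1                       ≡⟨ e ⟩
      a                                ∎) }
    where
    open ≤-Reasoning
    row₁ : ∀ {r x y} → Has t r x 1 → 1 ≤ y → y ≤ x → In t y 1
    row₁ {r} {x} {y} h 1≤y y≤x with north ss ≤-refl (proj₁ (Has-pos t h)) h
    ... | w , k , w≤1 , _ with west ss 1≤y y≤x k
    ...   | w' , k' , w'≤w = 1 , subst (Has t 1 y)
            (≤-antisym (≤-trans w'≤w w≤1) (SSYT.positive ss _ _ _ k')) k'

  rowEnd : ∀ {r x v} → Has t r x v → ∃ λ y → x ≤ y × Has t r y v × (∀ z → Has t r z v → z ≤ y)
  rowEnd {r} {x} {v} h = go (width t) x h (m<n+m (width t) (proj₂ (Has-pos t h)))
    where
    go : ∀ n x → Has t r x v → width t < x + n → ∃ λ y → x ≤ y × Has t r y v × (∀ z → Has t r z v → z ≤ y)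
    go zero x h far = ⊥-elim (<⇒≱ (subst (width t <_) (+-identityʳ x) far) (In-≤width t (r , h)))
    go (suc n) x h far with Has? t r (suc x) v
    ... | yes h' with go n (suc x) h' (subst (width t <_) (+-suc x n) far)
    ...   | y , p , k , m = y , <⇒≤ p , k , m
    go (suc n) x h far | no ∉ = x , ≤-refl , h , last
      where
      last : ∀ z → Has t r z v → z ≤ x
      last z k with z ≤? x
      ... | yes p = p
      ... | no p  = ⊥-elim (∉ (between≡ ss h k (n≤1+n x) (≰⇒> p)))

  -- The `suc v` stands directly below `(r , y)`; the square below `(r , x)` is at most that and
  -- exceeds `v`. So one column without `suc v` below frees all columns east of it in the same row,
  -- in particular the end of the row.
  hi-west : ∀ {r x y v} → Has t r x v → Has t r y v → x ≤ y → In t y (suc v) → In t x (suc v)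
  hi-west {r} {x} h h' p i with west ss (proj₂ (Has-pos t h)) p (next₁ ss h' i)
  ... | w , k , w≤ = suc r , subst (Has t (suc r) x) (≤-antisym w≤ (nw-< ss h k ≤-refl ≤-refl)) k

firstOutside : ∀ t v c n → (∃ λ x → c ≤ x × x < c + n × ¬ In t x v × (∀ y → c ≤ y → y < x → In t y v))
  ⊎ (∀ y → c ≤ y → y < c + n → In t y v)
firstOutside t v c zero = inj₂ λ y p q → ⊥-elim (<⇒≱ (subst (y <_) (+-identityʳ c) q) p)
firstOutside t v c (suc n) with In? t c v
... | no ∉ = inj₁ (c , ≤-refl , m<m+n c (s≤s z≤n) , ∉ , λ y p q → ⊥-elim (<⇒≱ q p))
... | yes i with firstOutside t v (suc c) n
...   | inj₁ (x , p , q , ∉ , f) = inj₁ (x , <⇒≤ p , subst (x <_) (sym (+-suc c n)) q , ∉ , g)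
  where
  g : ∀ y → c ≤ y → y < x → In t y v
  g y c≤y y<x with m≤n⇒m<n∨m≡n c≤y
  ... | inj₁ c<y  = f y c<y y<x
  ... | inj₂ refl = i
...   | inj₂ f = inj₂ g
  where
  g : ∀ y → c ≤ y → y < c + suc n → In t y v
  g y c≤y y<x with m≤n⇒m<n∨m≡n c≤y
  ... | inj₁ c<y  = f y c<y (subst (y <_) (+-suc c n) y<x)
  ... | inj₂ refl = i

Free : Tab → ℕ → ℕ → ℕ → Set
Free t v r c = Has t r c v × (∀ c' → Has t r c' v → c' ≤ c) × ¬ Has t (suc r) c (suc v)

LeftmostFree : Tab → ℕ → ℕ → ℕ → ℕ → Set
LeftmostFree t v c₀ r c = Free t v r c × c₀ ≤ c × (∀ r' c' → Free t v r' c' → c₀ ≤ c' → c ≤ c')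

leftmost-unique : ∀ {t} → SSYT t → ∀ {v c₀ r c r' c'} → LeftmostFree t v c₀ r c → LeftmostFree t v c₀ r' c' →
  (r , c) ≡ (r' , c')
leftmost-unique ss (f , p , l) (f' , p' , l') with ≤-antisym (l _ _ f' p') (l' _ _ f p)
... | refl with row-unique ss (proj₁ f) (proj₁ f')
...   | refl = refl

-- The contents K of λ ⊛ μ and K' of ν ⊛ ρ, with λ_{i+1} = K (1 + dbl i), μ_{i+1} = K (2 + dbl i) and m = s + 1.
record Params : Set where
  field
    a s k n β : ℕ
    K K' : ℕ → ℕ
    s<k       : s < k
    k<n       : k < n
    odd-full  : ∀ {i} → i < k → K (1 + dbl i) ≡ a
    odd-one   : ∀ {i} → k ≤ i → suc i < n → K (1 + dbl i) ≡ 1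
    odd-zero  : ∀ {i} → n ≤ suc i → K (1 + dbl i) ≡ 0
    before    : ∀ {v} → v ≤ dbl s → K' v ≡ K v
    after     : ∀ {v} → dbl k < v → K' v ≡ K v
    drop      : ∀ {i} → s ≤ i → i < k → K (1 + dbl i) ≡ suc (K' (1 + dbl i))
    gain      : ∀ {i} → s ≤ i → i < k → K' (2 + dbl i) ≡ suc (K (2 + dbl i))
    -- `β` bounds μ_m + 1. `β≤a` makes the counting in the first phase succeed, while `β-tight`
    -- allows `β = a` only if all the even entries that step (3) may have to decrease occur.
    β≤a       : β ≤ a
    K<β       : K (2 + dbl s) < β
    β-tight   : a ≤ β → ∀ {i} → k ≤ i → suc i < n → 1 ≤ K (2 + dbl i)
    -- Keeps e_m dominated by e_{m-1} after e_m has gained a square.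
    separated : 1 ≤ s → K (2 + dbl s) < K (dbl s)

-- The first phase

module _ (P : Params) where
  open Params P

  -- The square of the last step, in column c, has been raised from q to p = suc q; before that, the squares
  -- in columns u, …, c of its row all contained q with no p below.
  record Moved (t : Tab) (p c u : ℕ) : Set where
    field
      q      : ℕ
      q≡     : suc q ≡ p
      u≤c    : u ≤ c
      c≤a    : c ≤ a
      r      : ℕ
      sq     : Has t r c p
      run    : ∀ x → u ≤ x → x < c → Has t r x q
      run∉   : ∀ x → u ≤ x → x < c → ¬ In t x p
      others : ∀ x → 1 ≤ x → x ≤ a → x ≢ c → In t x q
      -- The bound `tight` of the preceding stage plus one for the raised square. It is spent at the
      -- start of the second phase, where `u = a` leaves room for a single `p` from column `a` on.
      slack  : u + east t p u ≤ suc β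

  -- The state of the procedure before the entries 1 + p are treated, where p = dbl i; c is the column of the
  -- preceding square (0 at the start).
  record Stage (i p c : ℕ) (t : Tab) : Set where
    field
      p≡         : p ≡ dbl i
      ss         : SSYT t
      s≤i        : s ≤ i
      count-done : ∀ v → 1 ≤ v → v ≤ p → count v t ≡ K' v
      count-todo : ∀ v → p < v → count v t ≡ K v
      -- With `suc q ≡ p`, only the pair of `q` and `2 + q` may be broken; by the next two fields
      -- this happens in columns up to `c` only, and by at most one.
      dom        : ∀ v → 1 ≤ v → suc v ≢ p → Dominated t v
      dom>       : ∀ q → suc q ≡ p → ∀ {d} → 1 ≤ d → c < d → east t (2 + q) d ≤ east t q d
      dom-suc    : ∀ q → suc q ≡ p → ∀ {d} → 1 ≤ d → east t (2 + q) d ≤ suc (east t q d)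
      full       : ∀ j → i ≤ j → j < k → ∀ {d} → 1 ≤ d → d ≤ a → In t d (1 + dbl j)
      bound      : east t (1 + p) (suc a) ≡ 0
      u          : ℕ
      1≤u        : 1 ≤ u
      -- As `β ≤ a`, the entries `2 + p` from column `u` on are too few to fill the columns `u`,
      -- ..., `a`.
      tight      : u + east t (2 + p) u ≤ β
      -- The alternative `d ≤ 1` covers the initial stage, where `c = 0`, and provides the base of
      -- the induction in `even-strict`.
      strict     : 1 ≤ p → ∀ {d} → 1 ≤ d → d ≤ c ⊎ d ≤ 1 → east t (2 + p) d < east t p d
      origin     : (c ≡ 0 × u ≡ 1 × i ≡ s) ⊎ Moved t p c u

  module _ {i p c t} (S : Stage i p c t) (i<k : i < k) where
    open Stage S

    o∈ : ∀ {d} → 1 ≤ d → d ≤ a → In t d (1 + p)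
    o∈ = subst (λ p → ∀ {d} → 1 ≤ d → d ≤ a → In t d (1 + p)) (sym p≡) (full i ≤-refl i<k)

    o-bound : ∀ {d} → In t d (1 + p) → d ≤ a
    o-bound = east-zero-bound t bound

    u≤a : u ≤ a
    u≤a = ≤-trans (≤-trans (m≤m+n u _) tight) β≤a

    -- If all columns `u`, ..., `a` contained `2 + p`, these `a + 1 − u` squares would violate
    -- `tight`.
    first∉ : ∃ λ u' → u ≤ u' × u' ≤ a × ¬ In t u' (2 + p) × (∀ y → u ≤ y → y < u' → In t y (2 + p))
    first∉ with m≤n⇒∃[o]m+o≡n u≤a
    ... | o , e with firstOutside t (2 + p) u (suc o)
    ...   | inj₁ (u' , q , l , ∉ , f) = u' , q , ≤-pred (subst (u' <_) (trans (+-suc u o) (cong suc e)) l) , ∉ , f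
    ...   | inj₂ f = ⊥-elim (<-irrefl refl (begin-strict
              a                                        <⟨ ≤-reflexive (sym (trans (+-suc u o) (cong suc e))) ⟩
              u + suc o                                ≤⟨ +-monoʳ-≤ u (m≤m+n (suc o) _) ⟩
              u + (suc o + east t (2 + p) (u + suc o)) ≡⟨ cong (u +_) (east-run ss (suc o) 1≤u f) ⟨
              u + east t (2 + p) u                     ≤⟨ tight ⟩
              β                                        ≤⟨ β≤a ⟩
              a                                        ∎))
      where open ≤-Reasoning

    o-row : Moved t p c u → ∃ λ r → ∀ x → u ≤ x → x ≤ c → Has t r x (1 + p)
    o-row M = suc r , go
      where
      open Moved M
      go : ∀ x → u ≤ x → x ≤ c → Has t (suc r) x (1 + p)
      go x u≤x x≤c with m≤n⇒m<n∨m≡n x≤c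
      ... | inj₁ x<c  = subst (λ p → Has t (suc r) x (1 + p)) q≡ (next₂ ss (run x u≤x x<c)
              (λ i → run∉ x u≤x x<c (subst (In t x) q≡ i))
              (subst (λ p → In t x (1 + p)) (sym q≡) (o∈ (≤-trans 1≤u u≤x) (≤-trans x≤c c≤a))))
      ... | inj₂ refl = next₁ ss sq (o∈ (≤-trans 1≤u u≤x) c≤a)

    -- The next square is found at the end of the row of x = max(c, u'), where u' is the first column
    -- from u on without 2 + p.
    chosen : ∃ λ u' → ∃ λ r → ∃ λ c' → LeftmostFree t (1 + p) c r c' × u ≤ u' × u' ≤ c' × c' ≤ a
      × (∀ y → u' ≤ y → y ≤ c' → Has t r y (1 + p)) × ¬ In t u' (2 + p) × (∀ y → u ≤ y → y < u' → In t y (2 + p))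
    chosen with first∉
    ... | u' , u≤u' , u'≤a , ∉u' , filledBefore = finish start
      where
      start : ∃ λ r → ∃ λ x → c ≤ x × u' ≤ x × (u' ≡ x ⊎ c ≡ x) × (∀ y → u' ≤ y → y ≤ x → Has t r y (1 + p))
      start with c ≤? u'
      ... | yes c≤u' with o∈ (≤-trans 1≤u u≤u') u'≤a
      ...   | r , h = r , u' , c≤u' , ≤-refl , inj₁ refl , λ y p' q' → subst (λ y → Has t r y (1 + p)) (≤-antisym p' q') h
      start | no c≰u' with origin
      ... | inj₁ (refl , _) = ⊥-elim (c≰u' z≤n)
      ... | inj₂ M with o-row M
      ...   | r , f = r , c , ≤-refl , <⇒≤ (≰⇒> c≰u') , inj₂ refl , λ y p' q' → f y (≤-trans u≤u' p') q'
      u≤ : ∀ {y} → 1 ≤ y → c ≤ y → u ≤ y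
      u≤ {y} 1≤y c≤y with origin
      ... | inj₁ (_ , e , _) = subst (_≤ y) (sym e) 1≤y
      ... | inj₂ M = ≤-trans (Moved.u≤c M) c≤y
      finish : (∃ λ r → ∃ λ x → c ≤ x × u' ≤ x × (u' ≡ x ⊎ c ≡ x) × (∀ y → u' ≤ y → y ≤ x → Has t r y (1 + p))) → _
      finish (r , x , c≤x , u'≤x , x≡ , row) with rowEnd ss (row x u'≤x ≤-refl)
      ... | c' , x≤c' , h , last = u' , r , c' ,
              ((h , last , λ k → ∉u' (hi-west ss hu' h u'≤c' (suc r , k))) , ≤-trans c≤x x≤c' , leftmost)
              , u≤u' , u'≤c' , o-bound (r , h) , row' , ∉u' , filledBefore
        where
        u'≤c' : u' ≤ c'
        u'≤c' = ≤-trans u'≤x x≤c'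
        hu' : Has t r u' (1 + p)
        hu' = row u' ≤-refl u'≤x
        row' : ∀ y → u' ≤ y → y ≤ c' → Has t r y (1 + p)
        row' y p' q' = between≡ ss hu' h p' q'
        -- From `u'` to `c'` the `1 + p` lies in this row and only the last one is at its end; in
        -- the columns from `u` up to `u'` a `2 + p` stands below it.
        leftmost : ∀ r'' y → Free t (1 + p) r'' y → c ≤ y → c' ≤ y
        leftmost r'' y (k , last' , below∉) c≤y with c' ≤? y
        ... | yes q = q
        ... | no c'≰y with u' ≤? y
        ...   | yes u'≤y with row-unique ss (row' y u'≤y (<⇒≤ (≰⇒> c'≰y))) k
        ...     | refl = last' c' h
        leftmost r'' y (k , last' , below∉) c≤y | no c'≰y | no u'≰y =
          ⊥-elim (below∉ (next₁ ss k (filledBefore y (u≤ (proj₂ (Has-pos t k)) c≤y) (≰⇒> u'≰y))))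

    module _ {r c'} (L : LeftmostFree t (1 + p) c r c') (c'≤a : c' ≤ a) (∉c' : ¬ In t c' (2 + p)) where

      -- If column d contains p but not 2 + p, then c' is the end of the row of the 1 + p in column d,
      -- and all squares above this stretch of the row contain p.
      even-jump : 1 ≤ p → ∀ {d} → c ≤ d → d < c' → In t d p → ¬ In t d (2 + p) →
        east t (2 + p) (suc d) < east t p (suc d)
      even-jump 1≤p {d} c≤d d<c' (r₀ , hp) ∉₂ = begin-strict
        east t (2 + p) (suc d)    ≡⟨ east-gap t {2 + p} (s≤s z≤n) (m≤n⇒m≤1+n d<c') (λ x q q' → ∉run x (<⇒≤ q) (≤-pred q')) ⟩
        east t (2 + p) (suc c')   ≤⟨ dom p 1≤p 1+n≢n (s≤s z≤n) ⟩
        east t p (suc c')         <⟨ ≤-reflexive (sym (east-in ss {p} 1≤c' (r₀ , hp'))) ⟩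
        east t p c'               ≤⟨ east-mono t {p} (s≤s z≤n) d<c' ⟩
        east t p (suc d)          ∎
        where
        open ≤-Reasoning
        1≤c' : 1 ≤ c'
        1≤c' = ≤-trans (s≤s z≤n) d<c'
        ho : Has t (suc r₀) d (1 + p)
        ho = next₁ ss hp (o∈ (proj₂ (Has-pos t hp)) (≤-trans (<⇒≤ d<c') c'≤a))
        ho' : Has t (suc r₀) c' (1 + p)
        ho' = let y , d≤y , hy , last = rowEnd ss ho in between≡ ss ho hy (<⇒≤ d<c')
              (proj₂ (proj₂ L) (suc r₀) y
                (hy , last , λ k → ∉₂ (hi-west ss ho hy d≤y (suc (suc r₀) , k)))
                (≤-trans c≤d d≤y))
        hp' : Has t r₀ c' p
        hp' = let w , hw , _ , w< = north ss (proj₁ (Has-pos t hp)) (n≤1+n r₀) ho' in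
              subst (Has t r₀ c') (≤-antisym (≤-pred (w< ≤-refl)) (nw-≤ ss hp hw ≤-refl (<⇒≤ d<c'))) hw
        ∉run : ∀ x → d ≤ x → x ≤ c' → ¬ In t x (2 + p)
        ∉run x d≤x x≤c' i = ∉₂ (hi-west ss ho (between≡ ss ho ho' d≤x x≤c') d≤x i)

      -- Raising adds a `2 + p` to every count up to `c'`, so strictness is needed there. Going east
      -- it can only be lost by passing a column with `p` but without `2 + p`, and that is the case
      -- settled by `even-jump`.
      even-strict : 1 ≤ p → ∀ d → d < c' → east t (2 + p) (suc d) < east t p (suc d)
      even-strict 1≤p zero _ = strict 1≤p ≤-refl (inj₂ ≤-refl)
      even-strict 1≤p (suc d) d<c' with even-strict 1≤p d (<⇒≤ d<c') | 2 + d ≤? c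
      ... | _  | yes d≤c = strict 1≤p (s≤s z≤n) (inj₁ d≤c)
      ... | ih | no d≰c with In? t (suc d) (2 + p) | In? t (suc d) p
      ...   | yes i₂ | _      = ≤-pred (≤-trans (s≤s (≤-reflexive (sym (east-in ss {2 + p} (s≤s z≤n) i₂))))
                (≤-trans ih (east-≤suc ss {p} (s≤s z≤n))))
      ...   | no ∉₂  | no ∉p  = subst₂ _<_ (east-out t {2 + p} (s≤s z≤n) ∉₂) (east-out t {p} (s≤s z≤n) ∉p) ih
      ...   | no ∉₂  | yes ip = even-jump 1≤p (≤-pred (≰⇒> d≰c)) d<c' ip ∉₂

    module _ {r c' t' u'} (L : LeftmostFree t (1 + p) c r c') (B : Bump t t' (1 + p) r c')
      (u≤u' : u ≤ u') (u'≤c' : u' ≤ c') (c'≤a : c' ≤ a)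
      (row : ∀ y → u' ≤ y → y ≤ c' → Has t r y (1 + p)) (∉row : ∀ y → u' ≤ y → y ≤ c' → ¬ In t y (2 + p))
      (before∈ : ∀ y → u ≤ y → y < u' → In t y (2 + p)) where
      open Bump B using (ss'; sq'; 1≤c; count-hi; count-lo; count-other; east-other; east->; east-hi≤; east-hi-≥;
        east-lo≤; east-lo-≤; to; to-value; from)

      c≤c' : c ≤ c'
      c≤c' = proj₁ (proj₂ L)

      1≤u' : 1 ≤ u'
      1≤u' = ≤-trans 1≤u u≤u'

      drop' : K (1 + p) ≡ suc (K' (1 + p))
      drop' = subst (λ p → K (1 + p) ≡ suc (K' (1 + p))) (sym p≡) (drop s≤i i<k)

      gain' : K' (2 + p) ≡ suc (K (2 + p))
      gain' = subst (λ p → K' (2 + p) ≡ suc (K (2 + p))) (sym p≡) (gain s≤i i<k)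

      done' : ∀ v → 1 ≤ v → v ≤ 2 + p → count v t' ≡ K' v
      done' v 1≤v v≤ with m≤n⇒m<n∨m≡n v≤
      ... | inj₂ refl = trans count-hi (trans (cong suc (count-todo (2 + p) (m≤n+m (suc p) 1))) (sym gain'))
      ... | inj₁ (s≤s v≤') with m≤n⇒m<n∨m≡n v≤'
      ...   | inj₂ refl = suc-injective (trans (sym count-lo) (trans (count-todo (1 + p) ≤-refl) drop'))
      ...   | inj₁ (s≤s v≤p) = trans (count-other (<⇒≢ (s≤s v≤p)) (<⇒≢ (s≤s (m≤n⇒m≤1+n v≤p)))) (count-done v 1≤v v≤p)

      todo' : ∀ v → 2 + p < v → count v t' ≡ K v
      todo' v l = trans (count-other (≢-sym (<⇒≢ (<-trans ≤-refl l))) (≢-sym (<⇒≢ l)))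
                        (count-todo v (<-trans (m≤n+m (suc p) 1) l))

      o-dom : ∀ {d} → 1 ≤ d → east t (3 + p) d ≤ east t (1 + p) d
      o-dom = dom (1 + p) (s≤s z≤n) (≢-sym (m≢1+n+m p {1}))

      e-dom : 1 ≤ p → ∀ {d} → 1 ≤ d → east t' (2 + p) d ≤ east t' p d
      e-dom 1≤p {suc d} 1≤d rewrite east-other {p} (suc d) (m≢1+n+m p {0}) (m≢1+n+m p {1}) with suc d ≤? c'
      ... | yes l rewrite east-hi≤ 1≤d l = even-strict L c'≤a (∉row c' u'≤c' ≤-refl) 1≤p d l
      ... | no l rewrite east-> {2 + p} (≰⇒> l) = dom p 1≤p 1+n≢n 1≤d

      -- The inequality broken by the preceding step fails by at most one and not beyond `c ≤ c'`;
      -- the removal of a `1 + p` from column `c'` lowers its left side by one in all columns up to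
      -- `c'`.
      q-dom : ∀ q → 1 ≤ q → suc q ≡ p → ∀ {d} → 1 ≤ d → east t' (2 + q) d ≤ east t' q d
      q-dom q 1≤q refl {d} 1≤d rewrite east-other {q} d (m≢1+n+m q {1}) (m≢1+n+m q {2}) with d ≤? c'
      ... | yes l = ≤-pred (subst (_≤ suc (east t q d)) (east-lo≤ 1≤d l) (dom-suc q refl 1≤d))
      ... | no l rewrite east-> {2 + q} (≰⇒> l) = dom> q refl 1≤d (≤-<-trans c≤c' (≰⇒> l))

      dom' : ∀ v → 1 ≤ v → suc v ≢ 2 + p → Dominated t' v
      dom' v 1≤v ne with v ≟ 2 + p | v ≟ p | suc v ≟ p
      ... | yes refl | _ | _ = λ 1≤d → ≤-trans
              (≤-reflexive (east-other _ (≢-sym (m≢1+n+m (1 + p) {2})) (≢-sym (m≢1+n+m (2 + p) {1}))))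
              (≤-trans (dom (2 + p) 1≤v (≢-sym (m≢1+n+m p {2})) 1≤d) (east-hi-≥ 1≤d))
      ... | no _ | yes refl | _ = e-dom 1≤v
      ... | no _ | no _ | yes e = q-dom v 1≤v e
      ... | no v≢e | no v≢p | no v≢q = λ 1≤d → subst₂ _≤_
              (sym (east-other {2 + v} _ (λ e → v≢q (suc-injective e)) (λ e → v≢p (suc-injective (suc-injective e)))))
              (sym (east-other {v} _ (λ e → ne (cong suc e)) v≢e)) (dom v 1≤v v≢q 1≤d)

      advanceStage : Stage (suc i) (2 + p) c' t'
      advanceStage = record
        { p≡         = cong (2 +_) p≡
        ; ss         = ss'
        ; s≤i        = m≤n⇒m≤1+n s≤i
        ; count-done = done'
        ; count-todo = todo'
        ; dom        = dom'
        ; dom>       = λ { q refl {d} 1≤d l → subst₂ _≤_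
                         (sym (east-other d (≢-sym (m≢1+n+m (1 + p) {1})) (≢-sym (m≢1+n+m (2 + p) {0}))))
                         (sym (east-> {1 + p} l)) (o-dom 1≤d) }
        ; dom-suc    = λ { q refl {d} 1≤d → ≤-trans
                         (≤-reflexive (east-other d (≢-sym (m≢1+n+m (1 + p) {1})) (≢-sym (m≢1+n+m (2 + p) {0}))))
                         (≤-trans (o-dom 1≤d) (lo-suc 1≤d)) }
        ; full       = λ j i<j j<k {d} 1≤d d≤a → to-In (o≢ i<j)
                         (full j (<⇒≤ i<j) j<k 1≤d d≤a)
        ; bound      = n≤0⇒n≡0 (≤-trans
                         (≤-reflexive (east-other (suc a) (≢-sym (m≢1+n+m (1 + p) {1})) (≢-sym (m≢1+n+m (2 + p) {0}))))
                         (≤-trans (o-dom (s≤s z≤n)) (≤-reflexive bound)))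
        ; u          = u'
        ; 1≤u        = 1≤u'
        ; tight      = ≤-trans (+-monoʳ-≤ u' (≤-trans
                         (≤-reflexive (east-other u' (≢-sym (m≢1+n+m (1 + p) {2})) (≢-sym (m≢1+n+m (2 + p) {1}))))
                         (dom (2 + p) (s≤s z≤n) (≢-sym (m≢1+n+m p {2})) 1≤u'))) tight'
        ; strict     = λ _ {d} 1≤d l → strict' 1≤d (l' 1≤d l)
        ; origin     = inj₂ record
          { q = 1 + p ; q≡ = refl ; u≤c = u'≤c' ; c≤a = c'≤a ; r = r ; sq = sq'
          ; run = λ x p' q' → to (λ { refl → <-irrefl refl q' }) (row x p' (<⇒≤ q'))
          ; run∉ = λ { x p' q' (r' , h) → ∉row x p' (<⇒≤ q') (r' , from (λ { refl → <-irrefl refl q' }) h) }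
          ; others = λ x 1≤x x≤a ne → Bump.to-col B ne (o∈ 1≤x x≤a)
          ; slack = ≤-trans (+-monoʳ-≤ u' (≤-reflexive (east-hi≤ 1≤u' u'≤c'))) (≤-trans (≤-reflexive (+-suc u' _)) (s≤s tight')) }
        }
        where
        to-In : ∀ {v d} → v ≢ 1 + p → In t d v → In t' d v
        to-In ne (r' , h) = r' , to-value ne h
        o≢ : ∀ {j} → i < j → 1 + dbl j ≢ 1 + p
        o≢ i<j e = <⇒≢ (≤-trans (n≤1+n _) (dbl-< i<j)) (trans (sym p≡) (sym (suc-injective e)))
        lo-suc : ∀ {d} → 1 ≤ d → east t (1 + p) d ≤ suc (east t' (1 + p) d)
        lo-suc {d} 1≤d with d ≤? c'
        ... | yes l = ≤-reflexive (east-lo≤ 1≤d l)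
        ... | no l  = ≤-trans (≤-reflexive (sym (east-> (≰⇒> l)))) (n≤1+n _)
        strict' : ∀ {d} → 1 ≤ d → d ≤ c' → east t' (4 + p) d < east t' (2 + p) d
        strict' {d} 1≤d l = begin-strict
          east t' (4 + p) d       ≡⟨ east-other d (≢-sym (m≢1+n+m (1 + p) {2})) (≢-sym (m≢1+n+m (2 + p) {1})) ⟩
          east t (4 + p) d        ≤⟨ dom (2 + p) (s≤s z≤n) (≢-sym (m≢1+n+m p {2})) 1≤d ⟩
          east t (2 + p) d        <⟨ ≤-reflexive (sym (east-hi≤ 1≤d l)) ⟩
          east t' (2 + p) d       ∎
          where open ≤-Reasoning
        l' : ∀ {d} → 1 ≤ d → d ≤ c' ⊎ d ≤ 1 → d ≤ c'
        l' 1≤d (inj₁ l) = l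
        l' 1≤d (inj₂ l) = ≤-trans l 1≤c
        -- Each of the columns skipped between `u` and `u'` contains a `2 + p`, so the sum does not
        -- change.
        tight' : u' + east t (2 + p) u' ≤ β
        tight' with m≤n⇒∃[o]m+o≡n u≤u'
        ... | o , refl = ≤-trans (≤-reflexive (trans (+-assoc u o _) (cong (u +_) (sym (east-run ss o 1≤u before∈))))) tight

    advance : ∃ λ r → ∃ λ c' → LeftmostFree t (1 + p) c r c'
      × Bump t (setEntry t r c' (2 + p)) (1 + p) r c' × Stage (suc i) (2 + p) c' (setEntry t r c' (2 + p))
    advance =
      let u' , r , c' , L , u≤u' , u'≤c' , c'≤a , row , ∉u' , before∈ = chosen
          (h , last , below∉) , _ = L
          B = raise ss h (λ k → <-irrefl refl (last (suc c') k)) below∉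
      in r , c' , L , B , advanceStage L B u≤u' u'≤c' c'≤a row
           (λ y u'≤y y≤c' i₂ → ∉u' (hi-west ss (row u' ≤-refl u'≤c') (row y u'≤y y≤c') u'≤y i₂)) before∈

-- The second phase

east-drop : ∀ t {v c d} → 1 ≤ c → c ≤ d → east t v d < east t v c → ∃ λ y → c ≤ y × y < d × In t y v
east-drop t {v} {c} 1≤c c≤d p with m≤n⇒∃[o]m+o≡n c≤d
... | o , refl = go o p
  where
  go : ∀ o → east t v (c + o) < east t v c → ∃ λ y → c ≤ y × y < c + o × In t y v
  go zero p = ⊥-elim (<-irrefl (cong (east t v) (+-identityʳ c)) p)
  go (suc o) p with In? t (c + o) v
  ... | yes i = c + o , m≤m+n c o , ≤-reflexive (sym (+-suc c o)) , i
  ... | no ∉ with go o (subst (_< east t v c)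
        (trans (cong (east t v) (+-suc c o)) (sym (east-out t (≤-trans 1≤c (m≤m+n c o)) ∉))) p)
  ...   | y , q , l , i = y , q , ≤-trans l (+-monoʳ-≤ c (n≤1+n o)) , i

not-twice : ∀ t {v x y} → count v t ≤ 1 → In t x v → In t y v → ¬ (x < y)
not-twice t {v} {x} {y} le (r , h) j l = <⇒≱ (begin-strict
  1                        ≤⟨ east-In-pos t (s≤s z≤n) l j ⟩
  east t v (suc x)         <⟨ east-In t (proj₂ (Has-pos t h)) (r , h) ⟩
  east t v x               ≤⟨ east-mono t ≤-refl (proj₂ (Has-pos t h)) ⟩
  east t v 1               ≡⟨ count-east v t ⟨
  count v t                ∎) le
  where open ≤-Reasoning

once : ∀ t {v x y} → count v t ≤ 1 → In t x v → In t y v → x ≡ y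
once t {v} {x} {y} le i j = ≤-antisym (≮⇒≥ (not-twice t le j i)) (≮⇒≥ (not-twice t le i j))

rowStart : ∀ {t} → SSYT t → ∀ {r x v} → Has t r x v → ∃ λ y → y ≤ x × Has t r y v × (∀ z → Has t r z v → y ≤ z)
rowStart {t} ss {r} {x} {v} h = go x h
  where
  go : ∀ x → Has t r x v → ∃ λ y → y ≤ x × Has t r y v × (∀ z → Has t r z v → y ≤ z)
  go zero h = 0 , ≤-refl , h , λ _ _ → z≤n
  go (suc x) h with Has? t r x v
  ... | yes h' with go x h'
  ...   | y , p , k , m = y , m≤n⇒m≤1+n p , k , m
  go (suc x) h | no ∉ = suc x , ≤-refl , h , first
    where
    first : ∀ z → Has t r z v → suc x ≤ z
    first z k with suc x ≤? z
    ... | yes p = p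
    ... | no p = ⊥-elim (∉ (between≡ ss k h (≤-pred (≰⇒> p)) (n≤1+n x)))

module _ (P : Params) where
  open Params P

  odd-≤1 : ∀ {i} → k ≤ i → K (1 + dbl i) ≤ 1
  odd-≤1 {i} k≤i with suc i <? n
  ... | yes p = ≤-reflexive (odd-one k≤i p)
  ... | no p = ≤-trans (≤-reflexive (odd-zero (≮⇒≥ p))) z≤n

  odd-columns : ∀ {t} → Yamanouchi K t → ∀ i → i < k →
    east t (1 + dbl i) (suc a) ≡ 0 × (∀ {d} → 1 ≤ d → d ≤ a → In t d (1 + dbl i))
  odd-columns {t} (ss , co , dom) i i<k = bound i i<k , filled ss (bound i i<k) (total i i<k)
    where
    total : ∀ i → i < k → east t (1 + dbl i) 1 ≡ a
    total i i<k = trans (sym (count-east (1 + dbl i) t)) (trans (co (1 + dbl i) (s≤s z≤n)) (odd-full i<k))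
    bound : ∀ i → i < k → east t (1 + dbl i) (suc a) ≡ 0
    bound zero    i<k = ones-bound ss (total 0 i<k)
    bound (suc i) i<k = n≤0⇒n≡0 (≤-trans (dom (1 + dbl i) (s≤s z≤n) (s≤s z≤n)) (≤-reflexive (bound i (<⇒≤ i<k))))

  initial : ∀ {t} → Yamanouchi K t → Stage P s (dbl s) 0 t
  initial {t} Y@(ss , co , dom) = record
    { p≡         = refl
    ; ss         = ss
    ; s≤i        = ≤-refl
    ; count-done = λ v 1≤v v≤ → trans (co v 1≤v) (sym (before v≤))
    ; count-todo = λ v l → co v (≤-trans (s≤s z≤n) l)
    ; dom        = λ v 1≤v _ → dom v 1≤v
    ; dom>       = λ q e 1≤d _ → dom q (1≤q s e) 1≤d
    ; dom-suc    = λ q e 1≤d → m≤n⇒m≤1+n (dom q (1≤q s e) 1≤d)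
    ; full       = λ j _ j<k → proj₂ (odd-columns Y j j<k)
    ; bound      = proj₁ (odd-columns Y s s<k)
    ; u          = 1
    ; 1≤u        = ≤-refl
    ; tight      = subst (_< β) (trans (sym (co (2 + dbl s) (s≤s z≤n))) (count-east (2 + dbl s) t)) K<β
    ; strict     = strict
    ; origin     = inj₁ (refl , refl , refl)
    }
    where
    1≤q : ∀ s {q} → suc q ≡ dbl s → 1 ≤ q
    1≤q (suc s) refl = s≤s z≤n
    1≤s : ∀ s → 1 ≤ dbl s → 1 ≤ s
    1≤s (suc s) _ = s≤s z≤n
    strict : 1 ≤ dbl s → ∀ {d} → 1 ≤ d → d ≤ 0 ⊎ d ≤ 1 → east t (2 + dbl s) d < east t (dbl s) d
    strict p (s≤s z≤n) (inj₂ (s≤s z≤n)) = subst₂ _<_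
      (trans (sym (co (2 + dbl s) (s≤s z≤n))) (count-east (2 + dbl s) t))
      (trans (sym (co (dbl s) p)) (count-east (dbl s) t)) (separated (1≤s s p))

  -- What makes a failure of the condition on (q , 2 + q) repairable. The squares of 1 + q other than the one in
  -- column D are those of the original tableau, apart from the one in column τ that was decreased to q (τ = 0 if
  -- there is none).
  record Critical (l q D τ : ℕ) (t : Tab) : Set where
    field
      top    : In t D (1 + q)
      -- Stated for every column `D'` containing `1 + q`, not just for `D`: `no-merge` compares two
      -- tableaux whose `D` may differ.
      strict : ∀ c D' → τ < c → c ≤ D' → D' ≤ a → In t D' (1 + q) → east t (3 + q) c < east t (1 + q) c
      few    : ∀ c → In t c (2 + q) → east t q c ≡ 0 →
                 east t (1 + q) c ≤ 1 × (∀ {i} → l ≤ i → suc i < n → 1 ≤ K (2 + dbl i))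
      τ<D    : τ < D
      -- The first alternative describes the end of the first phase, the second the result of an
      -- exchange that decreased the square `(R , τ)`.
      shape  : (τ ≡ 0 × (∀ c → 1 ≤ c → c < D → In t c q))
               ⊎ (∃ λ R → Has t R τ q × east t q (suc τ) ≡ 0 × ¬ In t τ (1 + q)
                          × (∀ R' c → τ < c → c < D → Has t R' c (1 + q) → R' ≡ R))

  record Late (l q : ℕ) (t : Tab) : Set where
    field
      q≡       : suc q ≡ dbl l
      1≤q      : 1 ≤ q
      k≤l      : k ≤ l
      l<n      : l < n
      ss       : SSYT t
      content  : Content K' t
      dom      : ∀ v → 1 ≤ v → v ≢ q → Dominated t v
      D τ      : ℕ
      D≤a      : D ≤ a
      bound    : east t (2 + q) (suc D) ≡ 0
      critical : ∀ {x} → 1 ≤ x → x ≤ a → east t q x ≡ 0 → Critical l q D τ t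

  -- Every column up to `a` other than `c` still contains o_k. A column `x ≤ a` from which on there
  -- is no o_k therefore forces `c = a`: a break can only come from an s_k in column `a`.
  late : ∀ {c t} → Stage P k (dbl k) c t → ∃ λ q → Late k q t
  late {c} {t} S = fromOrigin origin
    where
    open Stage S
    fromOrigin : (c ≡ 0 × u ≡ 1 × k ≡ s) ⊎ Moved P t (dbl k) c u → ∃ λ q → Late k q t
    fromOrigin (inj₁ (_ , _ , e)) = ⊥-elim (<-irrefl (sym e) s<k)
    fromOrigin (inj₂ M) = q , record
      { q≡ = q≡ ; 1≤q = 1≤q k q≡ ; k≤l = ≤-refl ; l<n = k<n ; ss = ss
      ; content = content
      ; dom = λ v 1≤v ne → dom v 1≤v λ e → ne (suc-injective (trans e (sym q≡)))
      ; D = a ; τ = 0 ; D≤a = ≤-refl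
      ; bound = subst (λ p → east t (1 + p) (suc a) ≡ 0) (sym q≡) bound
      ; critical = critical
      }
      where
      open Moved M
      1≤q : ∀ k {q} → suc q ≡ dbl k → 1 ≤ q
      1≤q (suc k) refl = s≤s z≤n
      content : Content K' t
      content v 1≤v with v ≤? dbl k
      ... | yes p = count-done v 1≤v p
      ... | no p  = trans (count-todo v (≰⇒> p)) (sym (after (≰⇒> p)))
      1≤a : 1 ≤ a
      1≤a = ≤-trans 1≤u (≤-trans u≤c c≤a)
      -- Were `u < c`, the square below `(r , u)` would lie west of the o_{k+1} below `(r , c)`,
      -- exceed `q` and differ from `dbl k`, so it would be a second o_{k+1}.
      u≡c : In t c (1 + dbl k) → u ≡ c
      u≡c i with m≤n⇒m<n∨m≡n u≤c
      ... | inj₂ e = e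
      ... | inj₁ u<c = ⊥-elim (<-irrefl (once t (≤-trans (≤-reflexive (count-todo _ ≤-refl)) (odd-≤1 ≤-refl)) i∈u i) u<c)
        where
        i∈u : In t u (1 + dbl k)
        i∈u = let w , hw , w≤ = west ss 1≤u u≤c (next₁ ss sq i)
                  q<w = nw-< ss (run u ≤-refl u<c) hw ≤-refl ≤-refl
                  w≢ : dbl k ≢ w
                  w≢ = λ e → run∉ u ≤-refl u<c (suc r , subst (Has t (suc r) u) (sym e) hw)
              in suc r , subst (Has t (suc r) u) (≤-antisym w≤ (≤∧≢⇒< (subst (_≤ w) q≡ q<w) w≢)) hw
      critical : ∀ {x} → 1 ≤ x → x ≤ a → east t q x ≡ 0 → Critical k q a 0 t
      critical 1≤x₀ x₀≤a z₀ = record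
        { top = r , subst₂ (Has t r) c≡a (sym q≡) sq
        ; strict = λ x D' 0<x x≤D' D'≤a _ → subst (λ p → east t (2 + p) x < east t p x) (sym q≡)
            (strict (subst (1 ≤_) q≡ (s≤s z≤n)) 0<x (inj₁ (subst (x ≤_) (sym c≡a) (≤-trans x≤D' D'≤a))))
        ; few = few
        ; τ<D = 1≤a
        ; shape = inj₁ (refl , λ x 1≤x x<a → others x 1≤x (<⇒≤ x<a) λ e → <-irrefl (trans e c≡a) x<a)
        }
        where
        z : east t q a ≡ 0
        z = n≤0⇒n≡0 (≤-trans (east-mono t 1≤x₀ x₀≤a) (≤-reflexive z₀))
        c≡a : c ≡ a
        c≡a with c ≟ a
        ... | yes e = e
        ... | no ne = ⊥-elim (east-zero-∉ t 1≤a z ≤-refl (others a 1≤a ≤-refl (≢-sym ne)))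
        few : ∀ x → In t x (2 + q) → east t q x ≡ 0 →
          east t (1 + q) x ≤ 1 × (∀ {i} → k ≤ i → suc i < n → 1 ≤ K (2 + dbl i))
        -- Here `u = x = a`. Then `slack` leaves at most one e_k from column `a` on, and `tight`
        -- gives `a ≤ β`, the premise of `β-tight`.
        few x i z' = subst₂ (λ v y → east t v y ≤ 1) (sym q≡) u≡x
            (+-cancelˡ-≤ u _ _ (≤-trans slack (≤-trans (s≤s β≤a) (≤-reflexive (trans (cong suc (sym u≡a)) (+-comm 1 u))))))
          , β-tight (≤-trans (≤-reflexive (sym u≡a)) (≤-trans (m≤m+n u _) tight))
          where
          i' : In t x (1 + dbl k)
          i' = subst (λ p → In t x (1 + p)) q≡ i
          x≡a : x ≡ a
          x≡a with x ≟ a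
          ... | yes e = e
          ... | no ne = ⊥-elim (east-zero-∉ t 1≤x z' ≤-refl (others x 1≤x x≤a λ e → ne (trans e c≡a)))
            where
            1≤x = proj₂ (Has-pos t (proj₂ i))
            x≤a = east-zero-bound t bound i'
          x≡c : x ≡ c
          x≡c = trans x≡a (sym c≡a)
          u≡c' : u ≡ c
          u≡c' = u≡c (subst (λ x → In t x (1 + dbl k)) x≡c i')
          u≡a : u ≡ a
          u≡a = trans u≡c' c≡a
          u≡x : u ≡ x
          u≡x = trans u≡c' (sym x≡c)

-- One repetition of step (3)

LeftFree : Tab → ℕ → ℕ → ℕ → Set
LeftFree t v r c = Has t r c (suc v) × (∀ c' → Has t r c' (suc v) → c ≤ c') × ¬ Has t (r ∸ 1) c v

RightmostFree : Tab → ℕ → ℕ → ℕ → Set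
RightmostFree t v r c = LeftFree t v r c × (∀ r' c' → LeftFree t v r' c' → c' ≤ c)

rightmost-unique : ∀ {t} → SSYT t → ∀ {v r c r' c'} → RightmostFree t v r c → RightmostFree t v r' c' →
  (r , c) ≡ (r' , c')
rightmost-unique ss (f , l) (f' , l') with ≤-antisym (l' _ _ f) (l _ _ f')
... | refl with row-unique ss (proj₁ f) (proj₁ f')
...   | refl = refl

module _ (P : Params) where
  open Params P

  module _ {l q t} (S : Late P l q t) where
    open Late S

    K-after : ∀ {i} → k ≤ i → ∀ j → K' (suc j + dbl i) ≡ K (suc j + dbl i)
    K-after {i} k≤i j = after (≤-trans (s≤s (dbl-≤ k≤i)) (s≤s (m≤n+m (dbl i) j)))

    count-o : count (2 + q) t ≡ K (1 + dbl l)
    count-o = trans (cong (λ p → count (1 + p) t) q≡) (trans (content _ (s≤s z≤n)) (K-after k≤l 0))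

    o-once : count (2 + q) t ≤ 1
    o-once = ≤-trans (≤-reflexive count-o) (odd-≤1 P k≤l)

    east-o-≤1 : ∀ {c} → 1 ≤ c → east t (2 + q) c ≤ 1
    east-o-≤1 1≤c = ≤-trans (east-mono t ≤-refl 1≤c) (≤-trans (≤-reflexive (sym (count-east (2 + q) t))) o-once)

    -- Since `2 + q` occurs at most once, in a column `d` say, the inequality can only fail by the
    -- absence of `q` from `d` on. This decides whether the procedure stops.
    dominated? : Dominated t q ⊎ (∃ λ d → In t d (2 + q) × east t q d ≡ 0)
    dominated? with 1 ≤? east t (2 + q) 1
    ... | no z = inj₁ λ {c} 1≤c → ≤-trans (east-mono t ≤-refl 1≤c) (≤-trans (≤-pred (≰⇒> z)) z≤n)
    ... | yes p with east-last t ≤-refl p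
    ...   | d , 1≤d , i , z with east t q d in e
    ...     | zero  = inj₂ (d , i , e)
    ...     | suc m = inj₁ dominated
      where
      dominated : Dominated t q
      dominated {c} 1≤c with c ≤? d
      ... | yes c≤d = ≤-trans (east-o-≤1 1≤c) (≤-trans (subst (1 ≤_) (sym e) (s≤s z≤n)) (east-mono t 1≤c c≤d))
      ... | no c≰d = ≤-trans (east-mono t (s≤s z≤n) (≰⇒> c≰d)) (≤-trans (≤-reflexive z) z≤n)

    finished : Dominated t q → Yamanouchi K' t
    finished dq = ss , content , all
      where
      all : ∀ v → 1 ≤ v → Dominated t v
      all v 1≤v with v ≟ q
      ... | yes refl = dq
      ... | no ne    = dom v 1≤v ne

    unfinished : ∀ {d} → In t d (2 + q) → east t q d ≡ 0 → ¬ Dominated t q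
    unfinished {d} (r , h) z dq = n≮0 (≤-trans (east-In-pos t 1≤d ≤-refl (r , h)) (≤-trans (dq 1≤d) (≤-reflexive z)))
      where
      1≤d = proj₂ (Has-pos t h)

    τ< : ∀ {x} → 1 ≤ x → x ≤ a → east t q x ≡ 0 → τ < x
    τ< {x} 1≤x x≤a z = go (Critical.shape (critical 1≤x x≤a z))
      where
      go : _ → τ < x
      go (inj₁ (e , _)) = subst (_< x) (sym e) 1≤x
      go (inj₂ (R , h , _)) = ≰⇒> λ x≤τ → east-zero-∉ t 1≤x z x≤τ (R , h)

    module _ {d rd} (hd : Has t rd d (2 + q)) (z : east t q d ≡ 0) where

      1≤d : 1 ≤ d
      1≤d = proj₂ (Has-pos t hd)

      d≤D : d ≤ D
      d≤D = east-zero-bound t bound (rd , hd)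

      crit : Critical P l q D τ t
      crit = critical 1≤d (≤-trans d≤D D≤a) z

      open Critical crit

      o-unique : ∀ {x} → In t x (2 + q) → x ≡ d
      o-unique i = once t o-once i (rd , hd)

      o∉ : ∀ {x} → x < d → ¬ In t x (2 + q)
      o∉ x<d i = <-irrefl (o-unique i) x<d

      suc-l<n : suc l < n
      suc-l<n with suc l <? n
      ... | yes p = p
      ... | no p with () ← subst (1 ≤_) (trans (sym (count-east _ t)) (trans count-o (odd-zero (≮⇒≥ p)))) (east-In-pos t ≤-refl 1≤d (rd , hd))

      count-e : count (3 + q) t ≡ K (2 + dbl l)
      count-e = trans (cong (λ p → count (2 + p) t) q≡) (trans (content _ (s≤s z≤n)) (K-after k≤l 1))

      many : ∀ {i} → l ≤ i → suc i < n → 1 ≤ K (2 + dbl i)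
      many = proj₂ (few d (rd , hd) z)

      τ<d : τ < d
      τ<d = τ< 1≤d (≤-trans d≤D D≤a) z

      -- From `d` on there are strictly fewer `3 + q` than `1 + q`, and at most one of the latter.
      -- So the `2 + q` can be raised, and every `3 + q` lies strictly west of it.
      e-zero : east t (3 + q) d ≡ 0
      e-zero = n≤0⇒n≡0 (≤-pred (≤-trans (strict d D τ<d d≤D D≤a top) (proj₁ (few d (rd , hd) z))))

      module _ {R x y} (hx : Has t R x (3 + q)) (hy : Has t R y (3 + q)) (first : ∀ z → Has t R z (3 + q) → x ≤ z)
        (last : east t (3 + q) (suc y) ≡ 0) where

        1≤x : 1 ≤ x
        1≤x = proj₂ (Has-pos t hx)

        y<d : y < d
        y<d = ≰⇒> λ d≤y → east-zero-∉ t 1≤d e-zero d≤y (R , hy)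

        x<d : x < d
        x<d = ≤-<-trans (first y hy) y<d

        -- Equal entries move weakly north as they go east. A `3 + q` from `x` on lies between
        -- `(R , x)` and the easternmost one `(R , y)`, which squeezes it into row `R`.
        in-row : ∀ {r' c'} → x ≤ c' → Has t r' c' (3 + q) → r' ≡ R
        in-row {r'} {c'} x≤c' h = ≤-antisym (strip ss hx h ≤-refl x≤c')
          (strip ss h hy ≤-refl (east-zero-bound t last (r' , h)))

        rightmost : RightmostFree t (2 + q) R x
        rightmost = (hx , first , λ k → o∉ x<d (R ∸ 1 , k)) , right
          where
          right : ∀ r' c' → LeftFree t (2 + q) r' c' → c' ≤ x
          right r' c' (h , first' , _) with c' ≤? x
          ... | yes p = p
          ... | no p with in-row (<⇒≤ (≰⇒> p)) h
          ...   | refl = first' x hx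

        -- Above a 3 + q that has a 3 + q to its left there is either a 1 + q in both columns or in neither,
        -- so the numbers of 1 + q and of 3 + q cannot become equal between x and τ.
        strict-τ : (∃ λ R' → Has t R' τ q × east t q (suc τ) ≡ 0 × ¬ In t τ (1 + q)
            × (∀ R'' c → τ < c → c < D → Has t R'' c (1 + q) → R'' ≡ R')) →
          ∀ m c → suc c + m ≡ τ → x ≤ c → east t (3 + q) (suc c) < east t (1 + q) (suc c)
        strict-τ T m c e x≤c with In? t (suc c) (1 + q)
        strict-τ T@(_ , _ , _ , ∉τ , _) zero c e x≤c | yes i =
          ⊥-elim (∉τ (subst (λ c → In t c (1 + q)) (trans (sym (+-identityʳ (suc c))) e) i))
        strict-τ T (suc m) c e x≤c | yes i = begin-strict
          east t (3 + q) (suc c)           ≤⟨ east-≤suc ss (s≤s z≤n) ⟩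
          suc (east t (3 + q) (2 + c))     ≤⟨ strict-τ T m (suc c) (trans (sym (+-suc (suc c) m)) e) (m≤n⇒m≤1+n x≤c) ⟩
          east t (1 + q) (2 + c)           <⟨ east-In t (s≤s z≤n) i ⟩
          east t (1 + q) (suc c)           ∎
          where open ≤-Reasoning
        strict-τ T m c e x≤c | no ∉ with 1 ≤? east t (3 + q) (suc c)
        ... | no zero' = ≤-trans (≰⇒> zero') (east-In-pos t (s≤s z≤n)
                (≤-trans (≤-trans (m≤m+n (suc c) m) (≤-reflexive e)) (<⇒≤ τ<D)) top)
        ... | yes pos = begin-strict
          east t (3 + q) (suc c)           <⟨ east-In t 1≤c (R , at-c) ⟩
          east t (3 + q) c                 ≤⟨ dom (1 + q) (s≤s z≤n) 1+n≢n 1≤c ⟩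
          east t (1 + q) c                 ≡⟨ east-out t 1≤c ∉c ⟩
          east t (1 + q) (suc c)           ∎
          where
          open ≤-Reasoning
          1≤c : 1 ≤ c
          1≤c = ≤-trans 1≤x x≤c
          c<d : suc c < d
          c<d = ≤-<-trans (≤-trans (m≤m+n (suc c) m) (≤-reflexive e)) τ<d
          c<y : suc c ≤ y
          c<y = let y' , p , i , _ = east-last t (s≤s z≤n) pos in ≤-trans p (east-zero-bound t last i)
          at-c : Has t R c (3 + q)
          at-c = between≡ ss hx hy x≤c (<⇒≤ c<y)
          at-suc : Has t R (suc c) (3 + q)
          at-suc = between≡ ss hx hy (m≤n⇒m≤1+n x≤c) c<y
          -- With no `2 + q` in column `c`, a `1 + q` would stand directly above `(R , c)`. The
          -- entry to its right, above `(R , suc c)`, is then at least `1 + q`, less than `3 + q`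
          -- and not `2 + q`, against the assumption on column `suc c`.
          ∉c : ¬ In t c (1 + q)
          ∉c (r' , h) =
            let R≡ = row-unique ss (next₂ ss h (o∉ (<-trans (n<1+n c) c<d)) (R , at-c)) at-c
                w , hw , _ , w< = north ss (proj₁ (Has-pos t h)) (≤-trans (n≤1+n r') (≤-reflexive R≡)) at-suc
                q<w = nw-≤ ss h hw ≤-refl (n≤1+n c)
                w≤ = ≤-pred (w< (≤-reflexive R≡))
                w≢ : w ≢ 2 + q
                w≢ = λ e' → o∉ c<d (r' , subst (Has t r' (suc c)) e' hw)
            in ∉ (r' , subst (Has t r' (suc c)) (≤-antisym (≤-pred (≤∧≢⇒< w≤ w≢)) q<w) hw)

        -- If `τ < x`, then `strict` yields two `1 + q` from `x` on, of which at most one lies from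
        -- `D` on. Another one lies west of `D`, hence in the row `R'` of the decreased square, and
        -- forces a `1 + q` at `(R' , x)`, just above `(R , x)`. No entry is then possible west of
        -- `(R , x)`.
        x≤τ : (∃ λ R' → Has t R' τ q × east t q (suc τ) ≡ 0 × ¬ In t τ (1 + q)
            × (∀ R'' c → τ < c → c < D → Has t R'' c (1 + q) → R'' ≡ R')) → x ≤ τ
        x≤τ (R' , hτ , zτ , ∉τ , rowτ) with x ≤? τ
        ... | yes p = p
        ... | no x≰τ = ⊥-elim contra
          where
          τ<x : τ < x
          τ<x = ≰⇒> x≰τ
          x≤D : x ≤ D
          x≤D = ≤-trans (<⇒≤ x<d) d≤D
          two : 2 ≤ east t (1 + q) x
          two = ≤-trans (s≤s (east-In-pos t 1≤x ≤-refl (R , hx))) (strict x D τ<x x≤D D≤a top)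
          contra : ⊥
          contra =
            let c₁ , x≤c₁ , c₁<D , (r₁ , h₁) = east-drop t 1≤x x≤D
                  (≤-trans (s≤s (≤-trans (east-mono t 1≤d d≤D) (proj₁ (few d (rd , hd) z)))) two)
                R≡ = rowτ r₁ c₁ (<-≤-trans τ<x x≤c₁) c₁<D h₁
                h₁' = subst (λ r → Has t r c₁ (1 + q)) R≡ h₁
                w , hw , q≤w , w≤ = between ss hτ h₁' (<⇒≤ τ<x) x≤c₁
                w≢q : q ≢ w
                w≢q = λ e → east-zero-∉ t (s≤s z≤n) zτ τ<x (R' , subst (Has t R' x) (sym e) hw)
                hw' = subst (Has t R' x) (≤-antisym w≤ (≤∧≢⇒< q≤w w≢q)) hw
                R≡' = row-unique ss (next₂ ss hw' (o∉ x<d) (R , hx)) hx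
            in prev x τ<x x<d R≡' hx first
            where
            -- The square to the left of (R , x) lies below an entry q or 1 + q, and is not 3 + q.
            prev : ∀ x → τ < x → x < d → suc R' ≡ R → Has t R x (3 + q) → (∀ z → Has t R z (3 + q) → x ≤ z) → ⊥
            prev (suc x) (s≤s τ≤x) x<d refl hx first =
              let w , hw , w≤ = west ss (≤-trans (proj₂ (Has-pos t hτ)) τ≤x) (n≤1+n x) hx
                  q<w = nw-< ss hτ hw ≤-refl τ≤x
                  w≢₃ : w ≢ 3 + q
                  w≢₃ = λ e → <-irrefl refl (first x (subst (Has t R x) e hw))
                  w≢₂ : w ≢ 2 + q
                  w≢₂ = λ e → o∉ (<⇒≤ x<d) (R , subst (Has t R x) e hw)
                  w≡₁ = ≤-antisym (≤-pred (≤∧≢⇒< (≤-pred (≤∧≢⇒< w≤ w≢₃)) w≢₂)) q<w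
              in at-τ (subst (Has t R x) w≡₁ hw)
              where
              at-τ : Has t R x (1 + q) → ⊥
              at-τ h with m≤n⇒m<n∨m≡n τ≤x
              ... | inj₂ refl = ∉τ (R , h)
              ... | inj₁ τ<x = 1+n≢n (rowτ R x τ<x (≤-trans (<⇒≤ x<d) d≤D) h)

        -- This is what repairs the broken pair: the unique `2 + q` moves to column `x`, where a `q`
        -- is still available weakly east of it.
        q-at : 1 ≤ east t q x
        q-at = go shape
          where
          go : _ → 1 ≤ east t q x
          go (inj₁ (_ , f)) = east-In-pos t 1≤x ≤-refl (f x 1≤x (<-≤-trans x<d d≤D))
          go (inj₂ T@(R' , h , _)) = east-In-pos t 1≤x (x≤τ T) (R' , h)

        -- The exchange adds a `3 + q` to exactly these counts. East of `τ` the strictness is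
        -- inherited, between `x` and `τ` it comes from `strict-τ`.
        strict' : ∀ {c} → x < c → c ≤ d → east t (3 + q) c < east t (1 + q) c
        strict' {c} x<c c≤d = go shape
          where
          go : _ → east t (3 + q) c < east t (1 + q) c
          go (inj₁ (e , _)) = strict c D (subst (_< c) (sym e) (≤-<-trans z≤n x<c)) (≤-trans c≤d d≤D) D≤a top
          go (inj₂ T) with c ≤? τ
          ... | no c≰τ = strict c D (≰⇒> c≰τ) (≤-trans c≤d d≤D) D≤a top
          ... | yes c≤τ = low c x<c c≤τ
            where
            low : ∀ c → x < c → c ≤ τ → east t (3 + q) c < east t (1 + q) c
            low (suc c) (s≤s x≤c) c≤τ = let m , e = m≤n⇒∃[o]m+o≡n c≤τ in strict-τ T m c e x≤c

        module _ {t₁ t₂} (B₁ : Bump t t₁ (2 + q) rd d) (B₂ : Bump t₂ t₁ (2 + q) R x) where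
          private
            module B₁ = Bump B₁
            module B₂ = Bump B₂

          east-other₂ : ∀ {u} c → u ≢ 2 + q → u ≢ 3 + q → east t₂ u c ≡ east t u c
          east-other₂ c p p' = trans (sym (B₂.east-other c p p')) (B₁.east-other c p p')

          -- Up to column `x` the two changes cancel in every count; for `3 + q` they have no effect
          -- beyond `d` either, and a net gain of one in between.
          o-≤x : ∀ {c} → 1 ≤ c → c ≤ x → east t₂ (2 + q) c ≡ east t (2 + q) c
          o-≤x 1≤c c≤x = trans (B₂.east-lo≤ 1≤c c≤x) (sym (B₁.east-lo≤ 1≤c (≤-trans c≤x (<⇒≤ x<d))))

          o->x : ∀ {c} → x < c → east t₂ (2 + q) c ≡ 0
          o->x {c} x<c with c ≤? d
          ... | no c≰d = trans (sym (B₂.east-> x<c)) (trans (B₁.east-> (≰⇒> c≰d))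
                  (∉-east-zero t (≤-trans 1≤x (<⇒≤ x<c)) λ y c≤y i → c≰d (subst (c ≤_) (o-unique i) c≤y)))
          ... | yes c≤d = n≤0⇒n≡0 (≤-pred (≤-trans (≤-reflexive
                  (trans (cong suc (sym (B₂.east-> x<c))) (sym (B₁.east-lo≤ 1≤c c≤d)))) (east-o-≤1 1≤c)))
            where
            1≤c : 1 ≤ c
            1≤c = ≤-trans 1≤x (<⇒≤ x<c)

          e-≤x : ∀ {c} → 1 ≤ c → c ≤ x → east t₂ (3 + q) c ≡ east t (3 + q) c
          e-≤x 1≤c c≤x = suc-injective (trans (sym (B₂.east-hi≤ 1≤c c≤x)) (B₁.east-hi≤ 1≤c (≤-trans c≤x (<⇒≤ x<d))))

          e-≤d : ∀ {c} → x < c → c ≤ d → east t₂ (3 + q) c ≡ suc (east t (3 + q) c)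
          e-≤d x<c c≤d = trans (sym (B₂.east-> x<c)) (B₁.east-hi≤ (≤-trans 1≤x (<⇒≤ x<c)) c≤d)

          e->d : ∀ {c} → d < c → east t₂ (3 + q) c ≡ east t (3 + q) c
          e->d d<c = trans (sym (B₂.east-> (<-trans x<d d<c))) (B₁.east-> d<c)

          e-≥ : ∀ {c} → 1 ≤ c → east t (3 + q) c ≤ east t₂ (3 + q) c
          e-≥ {c} 1≤c with c ≤? x | c ≤? d
          ... | yes p | _     = ≤-reflexive (sym (e-≤x 1≤c p))
          ... | no p  | yes p' = ≤-trans (n≤1+n _) (≤-reflexive (sym (e-≤d (≰⇒> p) p')))
          ... | no _  | no p' = ≤-reflexive (sym (e->d (≰⇒> p')))

          content₂ : Content K' t₂
          content₂ v 1≤v = trans (same v) (content v 1≤v)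
            where
            same : ∀ v → count v t₂ ≡ count v t
            same v with v ≟ 2 + q | v ≟ 3 + q
            ... | yes refl | _        = trans B₂.count-lo (sym B₁.count-lo)
            ... | no _     | yes refl = suc-injective (trans (sym B₂.count-hi) B₁.count-hi)
            ... | no p     | no p'    = trans (sym (B₂.count-other p p')) (B₁.count-other p p')

          dom-new : Dominated t₂ q
          dom-new {c} 1≤c rewrite east-other₂ {q} c (m≢1+n+m q {1}) (m≢1+n+m q {2}) with c ≤? x
          ... | yes c≤x rewrite o-≤x 1≤c c≤x = ≤-trans (east-o-≤1 1≤c) (≤-trans q-at (east-mono t 1≤c c≤x))
          ... | no c≰x rewrite o->x (≰⇒> c≰x) = z≤n

          dom-even : Dominated t₂ (1 + q)
          dom-even {c} 1≤c rewrite east-other₂ {1 + q} c (m≢1+n+m (1 + q) {0}) (m≢1+n+m (1 + q) {1}) with c ≤? x | c ≤? d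
          ... | yes c≤x | _ rewrite e-≤x 1≤c c≤x = dom (1 + q) (s≤s z≤n) 1+n≢n 1≤c
          ... | no c≰x | yes c≤d rewrite e-≤d (≰⇒> c≰x) c≤d = strict' (≰⇒> c≰x) c≤d
          ... | no _ | no c≰d rewrite e->d (≰⇒> c≰d) = dom (1 + q) (s≤s z≤n) 1+n≢n 1≤c

          dom-next : Dominated t₂ (3 + q)
          dom-next {c} 1≤c rewrite east-other₂ {5 + q} c (≢-sym (m≢1+n+m (2 + q) {2})) (≢-sym (m≢1+n+m (3 + q) {1})) =
            ≤-trans (dom (3 + q) (s≤s z≤n) (≢-sym (m≢1+n+m q {2})) 1≤c) (e-≥ 1≤c)

          dom₂ : ∀ v → 1 ≤ v → v ≢ 2 + q → Dominated t₂ v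
          dom₂ v 1≤v ne with v ≟ q | v ≟ 1 + q | v ≟ 3 + q
          ... | yes refl | _ | _ = dom-new
          ... | no _ | yes refl | _ = dom-even
          ... | no _ | no _ | yes refl = dom-next
          ... | no p₀ | no p₁ | no p₃ = λ 1≤c → subst₂ _≤_
                  (sym (east-other₂ {2 + v} _ (λ e → p₀ (suc-injective (suc-injective e))) (λ e → p₁ (suc-injective (suc-injective e)))))
                  (sym (east-other₂ {v} _ ne p₃)) (dom v 1≤v p₀ 1≤c)

          into : ∀ {r' c' u} → u ≢ 2 + q → u ≢ 3 + q → Has t₂ r' c' u → Has t r' c' u
          into p p' h = B₁.from-value p' (B₂.to-value p h)

          from-e : ∀ {r' c'} → c' ≢ d → Has t₂ r' c' (3 + q) → Has t r' c' (3 + q)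
          from-e ne h = B₁.from (λ { refl → ne refl }) (B₂.to-value 1+n≢n h)

          -- The raised square provides the new `D = d`, the lowered one the new `τ = x`. Strictness
          -- east of `x` is the one `3 + q` gained there, and the `3 + q` strictly between the two
          -- columns are old ones, all in row `R` by `in-row`.
          critical₂ : Critical P (suc l) (2 + q) d x t₂
          critical₂ = record
            { top    = rd , B₂.from (λ { refl → <-irrefl refl x<d }) B₁.sq'
            ; strict = λ c D' x<c c≤D' _ i → strict₂ x<c (≤-trans c≤D' (e-bound i))
            ; few    = λ c i z' → few₂ i z' , λ l<i → many (<⇒≤ l<i)
            ; τ<D    = x<d
            ; shape  = inj₂ (R , B₂.sq , o->x ≤-refl , B₂.not-hi ,
                         λ r' c x<c c<d h → in-row (<⇒≤ x<c) (from-e (<⇒≢ c<d) h))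
            }
            where
            e-bound : ∀ {c} → In t₂ c (3 + q) → c ≤ d
            e-bound (r' , h) = ≮⇒≥ λ d<c → east-zero-∉ t 1≤d e-zero (<⇒≤ d<c) (r' , from-e (≢-sym (<⇒≢ d<c)) h)
            strict₂ : ∀ {c} → x < c → c ≤ d → east t₂ (5 + q) c < east t₂ (3 + q) c
            strict₂ {c} x<c c≤d rewrite e-≤d x<c c≤d
              | east-other₂ {5 + q} c (≢-sym (m≢1+n+m (2 + q) {2})) (≢-sym (m≢1+n+m (3 + q) {1})) =
              s≤s (dom (3 + q) (s≤s z≤n) (≢-sym (m≢1+n+m q {2})) (≤-trans 1≤x (<⇒≤ x<c)))
            few₂ : ∀ {c} → In t₂ c (4 + q) → east t₂ (2 + q) c ≡ 0 → east t₂ (3 + q) c ≤ 1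
            few₂ {c} (r' , h) z' with c ≤? d
            ... | no c≰d rewrite e->d (≰⇒> c≰d) =
                    ≤-trans (east-mono t 1≤d (<⇒≤ (≰⇒> c≰d))) (≤-trans (≤-reflexive e-zero) z≤n)
            ... | yes c≤d = ≤-trans (≤-reflexive (e-≤d x<c c≤d)) (s≤s (≮⇒≥ none))
              where
              1≤c : 1 ≤ c
              1≤c = proj₂ (Has-pos t₂ h)
              x<c : x < c
              x<c = ≰⇒> λ c≤x → east-zero-∉ t₂ 1≤c z' c≤x (R , B₂.sq)
              h' : Has t r' c (4 + q)
              h' = into (≢-sym (m≢1+n+m (2 + q) {1})) 1+n≢n h
              -- A 3 + q at or east of column c would force entries 4 + q below both (R , x) and (R , c).
              none : ¬ (0 < east t (3 + q) c)
              none p =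
                let c' , c≤c' , (r₁ , h₁) , _ = east-last t 1≤c p
                    h₂ = subst (λ r → Has t r c' (3 + q)) (in-row (≤-trans (<⇒≤ x<c) c≤c') h₁) h₁
                    hc = between≡ ss hx h₂ (<⇒≤ x<c) c≤c'
                    w , hw , w≤ = west ss 1≤x (<⇒≤ x<c) (next₁ ss hc (r' , h'))
                    w≡ = ≤-antisym w≤ (nw-< ss hx hw ≤-refl ≤-refl)
                in not-twice t {4 + q} next-once (suc R , subst (Has t (suc R) x) w≡ hw) (r' , h') x<c
                where
                next-once : count (4 + q) t ≤ 1
                next-once = ≤-trans (≤-reflexive (trans (cong (λ p → count (3 + p) t) q≡)
                  (trans (content _ (s≤s z≤n)) (K-after k≤l 2)))) (odd-≤1 P {suc l} (m≤n⇒m≤1+n k≤l))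

          advanceLate : Late P (suc l) (2 + q) t₂
          advanceLate = record
            { q≡ = cong (2 +_) q≡ ; 1≤q = s≤s z≤n ; k≤l = m≤n⇒m≤1+n k≤l ; l<n = suc-l<n
            ; ss = B₂.ss ; content = content₂ ; dom = dom₂ ; D = d ; τ = x ; D≤a = ≤-trans d≤D D≤a
            ; bound = n≤0⇒n≡0 (≤-trans
                (≤-reflexive (east-other₂ (suc d) (≢-sym (m≢1+n+m (2 + q) {1})) (≢-sym (m≢1+n+m (3 + q) {0}))))
                (≤-trans (dom (2 + q) (s≤s z≤n) (≢-sym (m≢1+n+m q {1})) (s≤s z≤n))
                  (≤-reflexive (∉-east-zero t (s≤s z≤n) λ y d<y i → <-irrefl (sym (o-unique i)) d<y))))
            ; critical = λ _ _ _ → critical₂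
            }

      -- One repetition of step (3).
      repair : ∃ λ R → ∃ λ x → RightmostFree t (2 + q) R x
        × ∃ λ t₁ → t₁ ≡ setEntry t rd d (3 + q)
        × Bump t t₁ (2 + q) rd d × Bump (setEntry t₁ R x (2 + q)) t₁ (2 + q) R x
        × x < d × Late P (suc l) (2 + q) (setEntry t₁ R x (2 + q))
      repair =
        -- `many` guarantees that some `3 + q` exists; `y` is the column of the easternmost one, `x`
        -- the start of the stretch of `3 + q` in its row.
        let y , 1≤y , (R , hy) , last = east-last t ≤-refl
              (≤-trans (many ≤-refl suc-l<n) (≤-reflexive (trans (sym count-e) (count-east (3 + q) t))))
            x , x≤y , hx , first = rowStart ss hy
            x<d' = x<d hx hy first last
            B₁ = raise ss hd (λ h → 1+n≢n (o-unique (rd , h))) (λ h → east-zero-∉ t 1≤d e-zero ≤-refl (suc rd , h))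
            module B₁ = Bump B₁
            B₂ = lower B₁.ss' (s≤s z≤n) (B₁.to-value 1+n≢n hx)
              (λ { {c'} e h → <⇒≱ (≤-reflexive e)
                   (first c' (B₁.from (λ e' → <-irrefl (cong proj₂ e') (<-trans (≤-reflexive e) x<d')) h)) })
              (λ { {r'} e h → o∉ x<d' (r' , B₁.from-value (m≢1+n+m (2 + q) {0}) h) })
        in R , x , rightmost hx hy first last , _ , refl , B₁ , B₂ , x<d' , advanceLate hx hy first last B₁ B₂

-- Existence, uniqueness and injectivity of runs

two* : ∀ i → 2 * suc i ≡ 2 + dbl i
two* zero    = refl
two* (suc i) = cong suc (trans (+-suc (suc i) _) (cong suc (two* i)))

module _ (t : Tab) (c₀ r c : ℕ) where

  private
    Ch : ℕ → ℕ → ℕ → Set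
    Ch x r c = Has t r c (x ∸ 1) × (∀ c' → Has t r c' (x ∸ 1) → c' ≤ c) × ¬ Has t (suc r) c x

    Leftmost : ℕ → Set
    Leftmost x = Ch x r c × c₀ ≤ c × (∀ r' c' → Ch x r' c' → c₀ ≤ c' → c ≤ c')

  leftmost⇒ : ∀ i → LeftmostChOddFrom t (suc i) c₀ r c → LeftmostFree t (1 + dbl i) c₀ r c
  leftmost⇒ i = subst Leftmost (two* i)

  leftmost⇐ : ∀ i → LeftmostFree t (1 + dbl i) c₀ r c → LeftmostChOddFrom t (suc i) c₀ r c
  leftmost⇐ i = subst Leftmost (sym (two* i))

module _ (t : Tab) (r c : ℕ) where

  private
    ChE : ℕ → ℕ → ℕ → Set
    ChE x r c = Has t r c x × (∀ c' → Has t r c' x → c ≤ c') × ¬ Has t (r ∸ 1) c (x ∸ 1)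

    Rightmost : ℕ → Set
    Rightmost x = ChE x r c × (∀ r' c' → ChE x r' c' → c' ≤ c)

  rightmost⇒ : ∀ i → RightmostChEven t (suc i) r c → RightmostFree t (1 + dbl i) r c
  rightmost⇒ i = subst Rightmost (two* i)

  rightmost⇐ : ∀ i → RightmostFree t (1 + dbl i) r c → RightmostChEven t (suc i) r c
  rightmost⇐ i = subst Rightmost (sym (two* i))

phase1-end : ∀ {k c t t'} → Phase1 k (suc k) c t t' → t' ≡ t
phase1-end (p1-done _)        = refl
phase1-end (p1-step r c le _ _) = ⊥-elim (<-irrefl refl le)

phase1⇒ : ∀ {k i p c t t'} → p ≡ dbl i → i < k → Phase1 k (suc i) c t t' →
  ∃ λ r → ∃ λ c' → LeftmostFree t (1 + p) c r c' × Phase1 k (2 + i) c' (setEntry t r c' (2 + p)) t'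
phase1⇒ refl i<k (p1-done gt) = ⊥-elim (<⇒≱ gt i<k)
phase1⇒ {k} {i} {t = t} {t'} refl i<k (p1-step r c le L ph) =
  r , c , leftmost⇒ t _ r c i L , subst (λ v → Phase1 k (2 + i) c (setEntry t r c v) t') (two* i) ph

phase1⇐ : ∀ {k i p c t t' r c'} → p ≡ dbl i → i < k → LeftmostFree t (1 + p) c r c' →
  Phase1 k (2 + i) c' (setEntry t r c' (2 + p)) t' → Phase1 k (suc i) c t t'
phase1⇐ {k} {i} {t = t} {t'} {r} {c'} refl i<k L ph = p1-step r c' i<k (leftmost⇐ t _ r c' i L)
  (subst (λ v → Phase1 k (2 + i) c' (setEntry t r c' v) t') (sym (two* i)) ph)

module _ {n : ℕ} {nu rho : Weight n} where

  phase2⇒ : ∀ {l p t t'} → p ≡ dbl l → Phase2 nu rho (suc l) t t' → (t' ≡ t × Peelable nu rho t)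
    ⊎ (¬ Peelable nu rho t × ∃ λ r → ∃ λ c → ∃ λ r' → ∃ λ c' → UniqueSq t (1 + p) r c × RightmostFree t (1 + p) r' c'
       × Phase2 nu rho (2 + l) (setEntry (setEntry t r c (2 + p)) r' c' (1 + p)) t')
  phase2⇒ refl (p2-done pe) = inj₁ (refl , pe)
  phase2⇒ {l} {t = t} {t'} refl (p2-step r c r' c' ¬pe U R ph) = inj₂ (¬pe , r , c , r' , c' ,
    subst (λ v → UniqueSq t (v ∸ 1) r c) (two* l) U , rightmost⇒ t r' c' l R ,
    subst (λ v → Phase2 nu rho (2 + l) (setEntry (setEntry t r c v) r' c' (v ∸ 1)) t') (two* l) ph)

  phase2⇐ : ∀ {l p t t' r c r' c'} → p ≡ dbl l → ¬ Peelable nu rho t → UniqueSq t (1 + p) r c →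
    RightmostFree t (1 + p) r' c' → Phase2 nu rho (2 + l) (setEntry (setEntry t r c (2 + p)) r' c' (1 + p)) t' →
    Phase2 nu rho (suc l) t t'
  phase2⇐ {l} {t = t} {t'} {r} {c} {r'} {c'} refl ¬pe U R ph = p2-step r c r' c' ¬pe
    (subst (λ v → UniqueSq t (v ∸ 1) r c) (sym (two* l)) U) (rightmost⇐ t r' c' l R)
    (subst (λ v → Phase2 nu rho (2 + l) (setEntry (setEntry t r c v) r' c' (v ∸ 1)) t') (sym (two* l)) ph)

  phase2-peelable : ∀ {l t t'} → Phase2 nu rho l t t' → Peelable nu rho t'
  phase2-peelable (p2-done pe)               = pe
  phase2-peelable (p2-step _ _ _ _ _ _ _ ph) = phase2-peelable ph

module _ (P : Params) where
  open Params P

  phase1-run : ∀ m {i p c t} → i + m ≡ k → Stage P i p c t →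
    ∃ λ t₁ → ∃ λ c₁ → Phase1 k (suc i) c t t₁ × Stage P k (dbl k) c₁ t₁ × (∀ {t₂} → Phase1 k (suc i) c t t₂ → t₂ ≡ t₁)
  phase1-run zero {i} {p} {c} {t} e S with trans (sym (+-identityʳ i)) e
  ... | refl with Stage.p≡ S
  ...   | refl = t , c , p1-done ≤-refl , S , phase1-end
  phase1-run (suc m) {i} {p} {c} {t} e S =
    let r , c' , L , B , S' = advance P S i<k
        t₁ , c₁ , ph , S₁ , uniq = phase1-run m (trans (sym (+-suc i m)) e) S'
    in t₁ , c₁ , phase1⇐ p≡ i<k L ph , S₁ , λ ph' → same L uniq (phase1⇒ p≡ i<k ph')
    where
    open Stage S
    i<k : i < k
    i<k = ≤-trans (m≤m+n (suc i) m) (≤-reflexive (trans (sym (+-suc i m)) e))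
    same : ∀ {r c' t₁ t₂} → LeftmostFree t (1 + p) c r c' →
      (∀ {t₂} → Phase1 k (2 + i) c' (setEntry t r c' (2 + p)) t₂ → t₂ ≡ t₁) →
      (∃ λ r → ∃ λ c' → LeftmostFree t (1 + p) c r c' × Phase1 k (2 + i) c' (setEntry t r c' (2 + p)) t₂) → t₂ ≡ t₁
    same L uniq (r , c' , L' , ph) with leftmost-unique ss L L'
    ... | refl = uniq ph

  raised-same : ∀ {i p c d t u r c' r' d' w} (S : Stage P i p c t) (U : Stage P i p d u) → i < k →
    Bump t w (1 + p) r c' → Bump u w (1 + p) r' d' → t ≡ u
  raised-same {p = p} {t = t} {u} {c' = c'} {d' = d'} {w = w} S U i<k B B' = conclude c'≡d'
    where
    module B = Bump B
    module B' = Bump B'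
    c'≡d' : c' ≡ d'
    c'≡d' with c' ≟ d'
    ... | yes e = e
    ... | no ne = ⊥-elim (B.not-lo (B'.to-col ne (o∈ P U i<k B.1≤c (o-bound P S i<k (_ , B.sq)))))
    conclude : c' ≡ d' → t ≡ u
    conclude refl = trans B.undo (trans (cong (λ r → setEntry w r c' (1 + p)) (row-unique B.ss' B.sq' B'.sq')) (sym B'.undo))

  phase1-injective : ∀ m {i p c d t u w} → i + m ≡ k → Stage P i p c t → Stage P i p d u →
    Phase1 k (suc i) c t w → Phase1 k (suc i) d u w → t ≡ u
  phase1-injective zero {i} e S U ph ph' with trans (sym (+-identityʳ i)) e
  ... | refl = trans (sym (phase1-end ph)) (phase1-end ph')
  phase1-injective (suc m) {i} {p} {c} {d} {t} {u} {w} e S U ph ph' =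
    go (advance P S i<k) (advance P U i<k) (phase1⇒ p≡ i<k ph) (phase1⇒ p≡ i<k ph')
    where
    open Stage S using (p≡)
    i<k : i < k
    i<k = ≤-trans (m≤m+n (suc i) m) (≤-reflexive (trans (sym (+-suc i m)) e))
    Adv : ℕ → Tab → Set
    Adv c t = ∃ λ r → ∃ λ c' → LeftmostFree t (1 + p) c r c'
      × Bump t (setEntry t r c' (2 + p)) (1 + p) r c' × Stage P (suc i) (2 + p) c' (setEntry t r c' (2 + p))
    Run : ℕ → Tab → Set
    Run c t = ∃ λ r → ∃ λ c' → LeftmostFree t (1 + p) c r c' × Phase1 k (2 + i) c' (setEntry t r c' (2 + p)) w
    go : Adv c t → Adv d u → Run c t → Run d u → t ≡ u
    go (r , c' , L , B , S') (r' , d' , M , C , U') (_ , _ , L' , ph) (_ , _ , M' , ph')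
      with leftmost-unique (Stage.ss S) L L' | leftmost-unique (Stage.ss U) M M'
    ... | refl | refl = raised-same S U i<k B
            (subst (λ w → Bump u w (1 + p) r' d') (sym (phase1-injective m (trans (sym (+-suc i m)) e) S' U' ph ph')) C)

  -- An exchange changes only `2 + q` and `3 + q`, and later ones only larger entries, so everything
  -- up to `1 + q` is settled for the rest of the run.
  SameUpTo : ℕ → Tab → Tab → Set
  SameUpTo v t u = ∀ {w} → w ≤ v → (∀ {r c} → Has t r c w → Has u r c w) × (∀ {r c} → Has u r c w → Has t r c w)

  bump-same : ∀ {t u v r c} → Bump t u (suc v) r c → SameUpTo v t u
  bump-same {v = v} B w≤v = to-value (<⇒≢ (s≤s w≤v)) , from-value (<⇒≢ (s≤s (m≤n⇒m≤1+n w≤v)))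
    where open Bump B

  east-same : ∀ {t u v} → SSYT t → SSYT u → width u ≡ width t → SameUpTo v t u → ∀ {w} → w ≤ v → ∀ c → east u w c ≡ east t w c
  east-same ss ss' e same w≤v c = east-cong ss ss' e c (λ { x _ (r , h) → r , proj₁ (same w≤v) h })
    (λ { x _ (r , h) → r , proj₂ (same w≤v) h })

  module _ {n' : ℕ} {nu rho : Weight n'} (to : ∀ {t} → Peelable nu rho t → Yamanouchi K' t)
    (from : ∀ {t} → Yamanouchi K' t → Peelable nu rho t) where

    record Step (l q : ℕ) (t : Tab) : Set where
      field
        inv : Late P l q t
        rd d R x : ℕ
        hd   : Has t rd d (2 + q)
        z    : east t q d ≡ 0
        rmf  : RightmostFree t (2 + q) R x
        t₁   : Tab
        t₁≡  : t₁ ≡ setEntry t rd d (3 + q)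
        B₁   : Bump t t₁ (2 + q) rd d
        B₂   : Bump (setEntry t₁ R x (2 + q)) t₁ (2 + q) R x
        left-of  : x < d
        inv₂ : Late P (suc l) (2 + q) (setEntry t₁ R x (2 + q))

      t₂ : Tab
      t₂ = setEntry t₁ R x (2 + q)

      t₂≡ : t₂ ≡ setEntry (setEntry t rd d (3 + q)) R x (2 + q)
      t₂≡ = cong (λ t → setEntry t R x (2 + q)) t₁≡

      width₂ : width t₂ ≡ width t
      width₂ = trans (sym (Bump.width≡ B₂)) (Bump.width≡ B₁)

      same₂ : SameUpTo (1 + q) t t₂
      same₂ w≤ = (λ h → proj₂ (bump-same B₂ w≤) (proj₁ (bump-same B₁ w≤) h)) ,
                 (λ h → proj₂ (bump-same B₁ w≤) (proj₁ (bump-same B₂ w≤) h))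

      uniqueSq : UniqueSq t (2 + q) rd d
      uniqueSq = hd , λ r' c' h → unique (o-unique P inv hd z (r' , h)) h
        where
        unique : ∀ {r' c'} → c' ≡ d → Has t r' c' (2 + q) → (r' , c') ≡ (rd , d)
        unique refl h = cong (_, d) (row-unique (Late.ss inv) h hd)

    step : ∀ {l q t} → Late P l q t → Peelable nu rho t ⊎ (¬ Peelable nu rho t × Step l q t)
    step {l} {q} {t} S = go (dominated? P S)
      where
      go : Dominated t q ⊎ (∃ λ d → In t d (2 + q) × east t q d ≡ 0) → Peelable nu rho t ⊎ (¬ Peelable nu rho t × Step l q t)
      go (inj₁ dq) = inj₁ (from (finished P S dq))
      go (inj₂ (d , (rd , hd) , z)) =
        let R , x , rmf , t₁ , e , B₁ , B₂ , left-of , S₂ = repair P S hd z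
        in inj₂ ((λ pe → unfinished P S (rd , hd) z (proj₂ (proj₂ (to pe)) q (Late.1≤q S)))
           , record { inv = S ; rd = rd ; d = d ; R = R ; x = x ; hd = hd ; z = z ; rmf = rmf ; t₁ = t₁ ; t₁≡ = e
                    ; B₁ = B₁ ; B₂ = B₂ ; left-of = left-of ; inv₂ = S₂ })

    continue : ∀ {l q t t'} (s : Step l q t) → Phase2 nu rho (suc l) t t' → ¬ Peelable nu rho t →
      Phase2 nu rho (2 + l) (Step.t₂ s) t'
    continue {l} {q} {t} {t'} s ph ¬pe = go (phase2⇒ (Late.q≡ inv) ph)
      where
      open Step s
      go : _ → Phase2 nu rho (2 + l) t₂ t'
      go (inj₁ (_ , pe)) = ⊥-elim (¬pe pe)
      go (inj₂ (_ , r , c , r' , c' , U , M , ph')) with proj₂ uniqueSq r c (proj₁ U) | rightmost-unique (Late.ss inv) rmf M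
      ... | refl | refl = subst (λ t → Phase2 nu rho (2 + l) t t') (sym t₂≡) ph'

    stop : ∀ {l q t t'} → Late P l q t → Phase2 nu rho (suc l) t t' → Peelable nu rho t → t' ≡ t
    stop S ph pe with phase2⇒ (Late.q≡ S) ph
    ... | inj₁ (e , _)    = e
    ... | inj₂ (¬pe , _) = ⊥-elim (¬pe pe)

    -- Termination comes from `l < n`: another exchange needs a square o_{l+1}, hence a nonzero
    -- λ_{l+1}.
    phase2-run : ∀ m {l q t} → l + m ≡ n → Late P l q t →
      ∃ λ t' → Phase2 nu rho (suc l) t t' × (∀ {t''} → Phase2 nu rho (suc l) t t'' → t'' ≡ t')
    phase2-run zero {l} e S = ⊥-elim (<-irrefl (trans (sym (+-identityʳ l)) e) (Late.l<n S))
    phase2-run (suc m) {l} {q} {t} e S = go (step S)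
      where
      go : _ → ∃ λ t' → Phase2 nu rho (suc l) t t' × (∀ {t''} → Phase2 nu rho (suc l) t t'' → t'' ≡ t')
      go (inj₁ pe) = t , p2-done pe , λ ph → stop S ph pe
      go (inj₂ (¬pe , s)) =
        let open Step s
            t' , ph , uniq = phase2-run m (trans (sym (+-suc l m)) e) inv₂
        in t' , phase2⇐ (Late.q≡ S) ¬pe uniqueSq rmf (subst (λ t → Phase2 nu rho (2 + l) t t') t₂≡ ph)
             , λ ph' → uniq (continue s ph' ¬pe)

    phase2-same : ∀ m {l q t t'} → l + m ≡ n → Late P l q t → Phase2 nu rho (suc l) t t' →
      SameUpTo (1 + q) t t' × width t' ≡ width t
    phase2-same zero {l} e S = ⊥-elim (<-irrefl (trans (sym (+-identityʳ l)) e) (Late.l<n S))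
    phase2-same (suc m) {l} {q} {t} {t'} e S ph = go (step S)
      where
      go : _ → SameUpTo (1 + q) t t' × width t' ≡ width t
      go (inj₁ pe) with stop S ph pe
      ... | refl = (λ _ → (λ h → h) , (λ h → h)) , refl
      go (inj₂ (¬pe , s)) =
        let open Step s
            same , e' = phase2-same m (trans (sym (+-suc l m)) e) inv₂ (continue s ph ¬pe)
        in (λ w≤ → (λ h → proj₁ (same (m≤n⇒m≤1+n (m≤n⇒m≤1+n w≤))) (proj₁ (same₂ w≤) h)) ,
                   (λ h → proj₂ (same₂ w≤) (proj₂ (same (m≤n⇒m≤1+n (m≤n⇒m≤1+n w≤))) h)))
           , trans e' width₂

    -- The step of u puts 3 + q into a column where the original of t cannot have had one.
    no-merge : ∀ m {l q t u} → suc l + m ≡ n → Late P l q t → Peelable nu rho t → (s : Step l q u) →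
      ¬ Phase2 nu rho (2 + l) (Step.t₂ s) t
    no-merge m {l} {q} {t} {u} e S pe s ph = east-zero-∉ t 1≤d' zero₃ ≤-refl (rd , hd₃)
      where
      open Step s
      module U = Late inv
      1≤d' : 1 ≤ d
      1≤d' = 1≤d P inv hd z
      d≤a : d ≤ a
      d≤a = ≤-trans (d≤D P inv hd z) U.D≤a
      later : SameUpTo (3 + q) t₂ t × width t ≡ width t₂
      later = phase2-same m e inv₂ ph
      same : SameUpTo (1 + q) u t
      same w≤ = (λ h → proj₁ (proj₁ later (m≤n⇒m≤1+n (m≤n⇒m≤1+n w≤))) (proj₁ (same₂ w≤) h)) ,
                (λ h → proj₂ (same₂ w≤) (proj₂ (proj₁ later (m≤n⇒m≤1+n (m≤n⇒m≤1+n w≤))) h))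
      hd₃ : Has t rd d (3 + q)
      hd₃ = proj₁ (proj₁ later ≤-refl) (Bump.from B₂ (λ { refl → <-irrefl refl left-of }) (Bump.sq' B₁))
      east≡ : ∀ {w} → w ≤ 1 + q → east t w d ≡ east u w d
      east≡ w≤ = east-same U.ss (Late.ss S) (trans (proj₂ later) width₂) same w≤ d
      zt : east t q d ≡ 0
      zt = trans (east≡ (n≤1+n q)) z
      module C = Critical (Late.critical S 1≤d' d≤a zt)
      module Cᵤ = Critical (crit P inv hd z)
      zero₃ : east t (3 + q) d ≡ 0
      zero₃ = n≤0⇒n≡0 (≤-pred (≤-trans
        -- Both tableaux agree up to `1 + q`. So `t` lacks `q` from column `d` on just as `u` does,
        -- has the `1 + q` of `u` in column `U.D`, and has at most one `1 + q` from `d` on;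
        -- strictness leaves no `3 + q` there.
        (C.strict d U.D (τ< P S 1≤d' d≤a zt) (d≤D P inv hd z) U.D≤a
          (proj₁ Cᵤ.top , proj₁ (same ≤-refl) (proj₂ Cᵤ.top)))
        (≤-trans (≤-reflexive (east≡ ≤-refl)) (proj₁ (Cᵤ.few d (rd , hd) z)))))

    -- A `3 + q` raised further east in the other step would already be present in `t`, where
    -- `e-zero` excludes any from column `d` on.
    raised-once : ∀ {l q t u} (s : Step l q t) (s' : Step l q u) → Step.t₁ s ≡ Step.t₁ s' → ¬ (Step.d s < Step.d s')
    raised-once {q = q} s s' e d<d' = east-zero-∉ _ (Bump.1≤c S.B₁) (e-zero P S.inv S.hd S.z) (<⇒≤ d<d')
      (Bump.from-col S.B₁ (≢-sym (<⇒≢ d<d')) (S'.rd , subst (λ t → Has t S'.rd S'.d (3 + q)) (sym e) (Bump.sq' S'.B₁)))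
      where
      module S = Step s
      module S' = Step s'

    step-injective : ∀ {l q t u} (s : Step l q t) (s' : Step l q u) → Step.t₂ s ≡ Step.t₂ s' → t ≡ u
    step-injective {l} {q} {t} {u} s s' e = trans B₁.undo (trans
        (cong₂ (λ r d → setEntry S.t₁ r d (2 + q)) rd≡ d≡) (trans (cong (λ t → setEntry t S'.rd S'.d (2 + q)) t₁≡') (sym B₁'.undo)))
      where
      module S = Step s
      module S' = Step s'
      module B₁ = Bump S.B₁
      module B₂ = Bump S.B₂
      module B₁' = Bump S'.B₁
      module B₂' = Bump S'.B₂
      sq : Has S.t₂ S'.R S'.x (2 + q)
      sq = subst (λ t → Has t S'.R S'.x (2 + q)) (sym e) B₂'.sq
      x≡ : S.x ≡ S'.x
      x≡ = once S.t₂ (≤-trans (≤-reflexive (trans B₂.count-lo (sym B₁.count-lo))) (o-once P S.inv)) (S.R , B₂.sq) (S'.R , sq)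
      R≡ : S.R ≡ S'.R
      R≡ = row-unique B₂.ss B₂.sq (subst (λ x → Has S.t₂ S'.R x (2 + q)) (sym x≡) sq)
      t₁≡' : S.t₁ ≡ S'.t₁
      t₁≡' = trans B₂.eq (trans (cong₂ (λ r x → setEntry S.t₂ r x (3 + q)) R≡ x≡)
        (trans (cong (λ t → setEntry t S'.R S'.x (3 + q)) e) (sym B₂'.eq)))
      d≡ : S.d ≡ S'.d
      d≡ = ≤-antisym (≮⇒≥ (raised-once s' s (sym t₁≡'))) (≮⇒≥ (raised-once s s' t₁≡'))
      rd≡ : S.rd ≡ S'.rd
      rd≡ = row-unique B₁.ss' B₁.sq' (subst₂ (λ t d → Has t S'.rd d (3 + q)) (sym t₁≡') (sym d≡) B₁'.sq')

    phase2-injective : ∀ m {l q t u w} → l + m ≡ n → Late P l q t → Late P l q u →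
      Phase2 nu rho (suc l) t w → Phase2 nu rho (suc l) u w → t ≡ u
    phase2-injective zero {l} e S = ⊥-elim (<-irrefl (trans (sym (+-identityʳ l)) e) (Late.l<n S))
    phase2-injective (suc m) {l} {q} {t} {u} {w} e S U ph ph' = go (step S) (step U)
      where
      e' : suc l + m ≡ n
      e' = trans (sym (+-suc l m)) e
      go : Peelable nu rho t ⊎ (¬ Peelable nu rho t × Step l q t) → Peelable nu rho u ⊎ (¬ Peelable nu rho u × Step l q u) → t ≡ u
      go (inj₁ pe) (inj₁ pe') = trans (sym (stop S ph pe)) (stop U ph' pe')
      go (inj₁ pe) (inj₂ (¬pe' , s')) = ⊥-elim (no-merge m e' S pe s'
        (subst (Phase2 nu rho (2 + l) (Step.t₂ s')) (stop S ph pe) (continue s' ph' ¬pe')))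
      go (inj₂ (¬pe , s)) (inj₁ pe') = ⊥-elim (no-merge m e' U pe' s
        (subst (Phase2 nu rho (2 + l) (Step.t₂ s)) (stop U ph' pe') (continue s ph ¬pe)))
      go (inj₂ (¬pe , s)) (inj₂ (¬pe' , s')) = step-injective s s'
        (phase2-injective m e' (Step.inv₂ s) (Step.inv₂ s') (continue s ph ¬pe) (continue s' ph' ¬pe'))

-- From weights to contents

at-lookup : ∀ {n} (v : Weight n) {j} (j<n : j < n) → at v (suc j) ≡ v (fromℕ< j<n)
at-lookup {suc n} v {zero}  (s≤s _)   = refl
at-lookup {suc n} v {suc j} (s≤s j<n) = at-lookup {n} (λ i → v (fsuc i)) j<n

at-beyond : ∀ {n} (v : Weight n) {j} → n ≤ j → at v (suc j) ≡ 0
at-beyond {zero}  v         _         = refl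
at-beyond {suc n} v {suc j} (s≤s n≤j) = at-beyond {n} (λ i → v (fsuc i)) n≤j

at-anti : ∀ {n} {v : Weight n} → IsPartition v → ∀ {i j} → i ≤ j → at v (suc j) ≤ at v (suc i)
at-anti {n} {v} (decr , _) {i} {j} i≤j with j <? n
... | no p rewrite at-beyond v (≮⇒≥ p) = z≤n
... | yes j<n rewrite at-lookup v j<n | at-lookup v (≤-<-trans i≤j j<n) = decr _ _
        (subst₂ _≤_ (sym (toℕ-fromℕ< (≤-<-trans i≤j j<n))) (sym (toℕ-fromℕ< j<n)) i≤j)

at-≤sum : ∀ {n} (v : Weight n) j → at v j ≤ sumW v
at-≤sum {zero}  v j             = z≤n
at-≤sum {suc n} v zero          = z≤n
at-≤sum {suc n} v (suc zero)    = m≤m+n _ _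
at-≤sum {suc n} v (suc (suc j)) = ≤-trans (at-≤sum {n} (λ i → v (fsuc i)) (suc j)) (m≤n+m _ _)

seqC-odd : ∀ a b i → seqC a b (1 + dbl i) ≡ a (suc i)
seqC-odd a b zero    = refl
seqC-odd a b (suc i) = seqC-odd (λ i → a (suc i)) (λ i → b (suc i)) i

seqC-even : ∀ a b i → seqC a b (2 + dbl i) ≡ b (suc i)
seqC-even a b zero    = refl
seqC-even a b (suc i) = seqC-even (λ i → a (suc i)) (λ i → b (suc i)) i

-- Columns shared by two rows of the shuffle diagram

data OddEven : ℕ → Set where
  odd  : ∀ i → OddEven (1 + dbl i)
  even : ∀ i → OddEven (2 + dbl i)

oddEven : ∀ v → 1 ≤ v → OddEven v
oddEven (suc zero)          _ = odd 0
oddEven (suc (suc zero))    _ = even 0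
oddEven (suc (suc (suc v))) _ with oddEven (suc v) (s≤s z≤n)
... | odd i  = odd (suc i)
... | even i = even (suc i)

oddHalf-odd : ∀ i → oddHalf (1 + dbl i) ≡ just (suc i)
oddHalf-odd zero    = refl
oddHalf-odd (suc i) rewrite oddHalf-odd i = refl

oddHalf-dbl : ∀ i → oddHalf (dbl i) ≡ nothing
oddHalf-dbl zero    = refl
oddHalf-dbl (suc i) rewrite oddHalf-dbl i = refl

module _ (a b : ℕ → ℕ) where

  shuffle-oo : ∀ i j → inShuffle a b (1 + dbl i) (1 + dbl j) ≡ (suc j ≤ᵇ a (suc i))
  shuffle-oo i j rewrite oddHalf-odd i | oddHalf-odd j | oddHalf-dbl i with suc j ≤ᵇ a (suc i)
  ... | true  = refl
  ... | false = refl

  shuffle-oe : ∀ i j → inShuffle a b (1 + dbl i) (2 + dbl j) ≡ false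
  shuffle-oe i j rewrite oddHalf-odd i | oddHalf-dbl j | oddHalf-dbl i = refl

  shuffle-eo : ∀ i j → inShuffle a b (2 + dbl i) (1 + dbl j) ≡ false
  shuffle-eo i j rewrite oddHalf-dbl i | oddHalf-odd i | oddHalf-dbl j = refl

  shuffle-ee : ∀ i j → inShuffle a b (2 + dbl i) (2 + dbl j) ≡ (suc j ≤ᵇ b (suc i))
  shuffle-ee i j rewrite oddHalf-dbl i | oddHalf-odd i | oddHalf-odd j = refl

⊓-step : ∀ M {A B} → A ≤ B → (M ⊓ A) + (if (suc M ≤ᵇ B) ∧ (suc M ≤ᵇ A) then 1 else 0) ≡ suc M ⊓ A
⊓-step M {A} {B} A≤B with suc M ≤? A
... | yes p rewrite ≤ᵇ-true (≤-trans p A≤B) | ≤ᵇ-true p | m≤n⇒m⊓n≡m p | m≤n⇒m⊓n≡m (<⇒≤ p) = +-comm M 1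
... | no p rewrite ≤ᵇ-false p | m≥n⇒m⊓n≡n (≤-pred (≰⇒> p)) | m≥n⇒m⊓n≡n (m≤n⇒m≤1+n (≤-pred (≰⇒> p))) =
  trans (cong (λ x → A + x) (∧-false (suc M ≤ᵇ B))) (+-identityʳ A)
  where
  ∧-false : ∀ x → (if x ∧ false then 1 else 0) ≡ 0
  ∧-false true  = refl
  ∧-false false = refl

module _ (a b : ℕ → ℕ) where

  columns-odd : ∀ i → a (2 + i) ≤ a (1 + i) → ∀ M → countCols a b (1 + dbl i) (dbl M) ≡ M ⊓ a (2 + i)
  columns-odd i le zero = refl
  columns-odd i le (suc M) rewrite +-comm (dbl i) 2 | shuffle-oe a b i M | shuffle-oo a b i M | shuffle-oo a b (suc i) M
    | columns-odd i le M = trans (+-identityʳ _) (⊓-step M le)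

  columns-even : ∀ i → b (2 + i) ≤ b (1 + i) → ∀ M → countCols a b (2 + dbl i) (dbl M) ≡ M ⊓ b (2 + i)
  columns-even i le zero = refl
  columns-even i le (suc M) rewrite +-comm (dbl i) 2 | shuffle-eo a b i M | shuffle-ee a b i M | shuffle-ee a b (suc i) M
    | columns-even i le M | +-identityʳ (M ⊓ b (2 + i)) = ⊓-step M le

2*≡dbl : ∀ M → 2 * M ≡ dbl M
2*≡dbl zero    = refl
2*≡dbl (suc M) = two* M

-- The parts decrease, so every square of row `2 + v` of the diagram has one of row `v` above it in
-- its column. Thus every `(2 + v)`-square has to be paired. The cut-off column is far enough east
-- because no part exceeds the sum of all.
aNum-content : ∀ {n} {al be : Weight n} → IsPartition al → IsPartition be →
  ∀ v → 1 ≤ v → aNum al be v ≡ seqC (at al) (at be) (2 + v)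
aNum-content {n} {al} {be} pa pb v 1≤v = trans (cong (countCols (at al) (at be) v) (2*≡dbl M)) (go v (oddEven v 1≤v))
  where
  M = sumW al + sumW be
  go : ∀ v → OddEven v → countCols (at al) (at be) v (dbl M) ≡ seqC (at al) (at be) (2 + v)
  go _ (odd i) = trans (columns-odd (at al) (at be) i (at-anti pa (n≤1+n i)) M)
    (trans (m≥n⇒m⊓n≡n (≤-trans (at-≤sum al (2 + i)) (m≤m+n (sumW al) (sumW be)))) (sym (seqC-odd (at al) (at be) (suc i))))
  go _ (even i) = trans (columns-even (at al) (at be) i (at-anti pb (n≤1+n i)) M)
    (trans (m≥n⇒m⊓n≡n (≤-trans (at-≤sum be (2 + i)) (m≤n+m (sumW be) (sumW al)))) (sym (seqC-even (at al) (at be) (suc i))))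

-- The polytope condition as inequalities between parts

⊖-≤⇒ : ∀ {x y z w} → x ⊖ y ≤ℤ z ⊖ w → x + w ≤ z + y
⊖-≤⇒ {x} {y} {z} {w} p = ℤₚ.drop‿+≤+ (subst₂ _≤ℤ_ (shift x w y)
    (trans (cong (λ c → z ⊖ w +ℤ ℤ.pos c) (+-comm w y)) (shift z y w))
    (ℤₚ.+-monoˡ-≤ (ℤ.pos (w + y)) p))
  where
  shift : ∀ x w y → x ⊖ y +ℤ ℤ.pos (w + y) ≡ ℤ.pos (x + w)
  shift x w y = trans (ℤₚ.distribˡ-⊖-+-pos (w + y) x y)
    (trans (cong₂ _⊖_ (trans (sym (+-assoc x w y)) (+-comm (x + w) y)) (sym (+-identityʳ y)))
      (ℤₚ.+-cancelˡ-⊖ y (x + w) 0))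

-- Here m = suc s and n = suc n₀.
module Weights (n₀ a s k : ℕ) (1≤a : 1 ≤ a) (s<k : s < k) (k≤n₀ : k ≤ n₀)
  (mu rho : Weight (suc n₀))
  (λ-part : IsPartition (lamV (suc n₀) a k)) (μ-part : IsPartition mu)
  (ν-part : IsPartition (nuV (suc n₀) a (suc s) k)) (ρ-part : IsPartition rho)
  (sums : ∀ i → lamV (suc n₀) a k i + mu i ≡ nuV (suc n₀) a (suc s) k i + rho i)
  (ν∈P : InP (lamV (suc n₀) a k) mu (nuV (suc n₀) a (suc s) k)) where

  n = suc n₀
  lam = lamV n a k
  nu = nuV n a (suc s) k

  k<n : k < n
  k<n = s≤s k≤n₀

  lam-low : ∀ {j} → j < k → at lam (suc j) ≡ a
  lam-low {j} j<k rewrite at-lookup lam (<-trans j<k k<n) | toℕ-fromℕ< (<-trans j<k k<n) | ≤ᵇ-true j<k = refl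

  lam-mid : ∀ {j} → k ≤ j → suc j < n → at lam (suc j) ≡ 1
  lam-mid {j} k≤j j<n rewrite at-lookup lam (<⇒≤ j<n) | toℕ-fromℕ< (<⇒≤ j<n)
    | ≤ᵇ-false (≤⇒≯ k≤j) | ≤ᵇ-true j<n = refl

  lam-end : ∀ {j} → n ≤ suc j → at lam (suc j) ≡ 0
  lam-end {j} n≤j with j <? n
  ... | no p = at-beyond lam (≮⇒≥ p)
  ... | yes p rewrite at-lookup lam p | toℕ-fromℕ< p | ≤ᵇ-false (≤⇒≯ (≤-trans k≤n₀ (≤-pred n≤j))) | ≤ᵇ-false (≤⇒≯ n≤j) = refl

  nu-in : ∀ {j} → s ≤ j → j < k → at nu (suc j) ≡ a ∸ 1
  nu-in {j} s≤j j<k rewrite at-lookup nu (<-trans j<k k<n) | toℕ-fromℕ< (<-trans j<k k<n)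
    | ≤ᵇ-true (s≤s s≤j) | ≤ᵇ-true j<k = refl

  nu-out : ∀ {j} → j < s ⊎ k ≤ j → at nu (suc j) ≡ at lam (suc j)
  nu-out {j} out with j <? n
  ... | no p = trans (at-beyond nu (≮⇒≥ p)) (sym (at-beyond lam (≮⇒≥ p)))
  nu-out {j} (inj₁ j<s) | yes p rewrite at-lookup nu p | at-lookup lam p | toℕ-fromℕ< p | ≤ᵇ-false (<⇒≱ (s≤s j<s)) = refl
  nu-out {j} (inj₂ k≤j) | yes p rewrite at-lookup nu p | at-lookup lam p | toℕ-fromℕ< p | ≤ᵇ-false (≤⇒≯ k≤j)
    with suc s ≤ᵇ suc j
  ... | true  = refl
  ... | false = refl

  at-sums : ∀ j → at lam (suc j) + at mu (suc j) ≡ at nu (suc j) + at rho (suc j)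
  at-sums j with j <? n
  ... | yes p rewrite at-lookup lam p | at-lookup mu p | at-lookup nu p | at-lookup rho p = sums (fromℕ< p)
  ... | no p rewrite at-beyond lam (≮⇒≥ p) | at-beyond mu (≮⇒≥ p) | at-beyond nu (≮⇒≥ p) | at-beyond rho (≮⇒≥ p) = refl

  a≡ : suc (a ∸ 1) ≡ a
  a≡ = m+[n∸m]≡n 1≤a

  rho-in : ∀ {j} → s ≤ j → j < k → at rho (suc j) ≡ suc (at mu (suc j))
  rho-in {j} s≤j j<k = +-cancelˡ-≡ (a ∸ 1) _ _ (begin
    (a ∸ 1) + at rho (suc j)          ≡⟨ cong (_+ at rho (suc j)) (nu-in s≤j j<k) ⟨
    at nu (suc j) + at rho (suc j)    ≡⟨ at-sums j ⟨
    at lam (suc j) + at mu (suc j)    ≡⟨ cong (_+ at mu (suc j)) (trans (lam-low j<k) (sym a≡)) ⟩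
    suc (a ∸ 1) + at mu (suc j)       ≡⟨ +-suc (a ∸ 1) _ ⟨
    (a ∸ 1) + suc (at mu (suc j))     ∎)
    where open ≡-Reasoning

  rho-out : ∀ {j} → j < s ⊎ k ≤ j → at rho (suc j) ≡ at mu (suc j)
  rho-out {j} out = +-cancelˡ-≡ (at nu (suc j)) _ _
    (trans (sym (at-sums j)) (cong (_+ at mu (suc j)) (sym (nu-out out))))

  -- The difference of the coordinates m and j is one less for ν than for λ. Lying between the
  -- differences for λ and μ, it must then be at least the one for μ.
  separation : ∀ {j} → j < s ⊎ k ≤ j → j < n → at mu (suc s) + at lam (suc j) < a + at mu (suc j)
  separation {j} out j<n = go (ν∈P (fromℕ< s<n) (fromℕ< j<n))
    where
    s<n : s < n
    s<n = <-trans s<k k<n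
    λₛ : lam (fromℕ< s<n) ≡ a
    λₛ = trans (sym (at-lookup lam s<n)) (lam-low s<k)
    νₛ : nu (fromℕ< s<n) ≡ a ∸ 1
    νₛ = trans (sym (at-lookup nu s<n)) (nu-in ≤-refl s<k)
    νⱼ : nu (fromℕ< j<n) ≡ at lam (suc j)
    νⱼ = trans (sym (at-lookup nu j<n)) (nu-out out)
    λⱼ : lam (fromℕ< j<n) ≡ at lam (suc j)
    λⱼ = sym (at-lookup lam j<n)
    go : Between (nu (fromℕ< s<n) ⊖ nu (fromℕ< j<n)) (lam (fromℕ< s<n) ⊖ lam (fromℕ< j<n))
        (mu (fromℕ< s<n) ⊖ mu (fromℕ< j<n)) →
      at mu (suc s) + at lam (suc j) < a + at mu (suc j)
    go (inj₁ (le , _)) = ⊥-elim (<-irrefl refl (begin-strict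
      (a ∸ 1) + at lam (suc j)  <⟨ ≤-reflexive (cong (_+ at lam (suc j)) a≡) ⟩
      a + at lam (suc j)        ≤⟨ subst₂ _≤_ (cong₂ _+_ λₛ νⱼ) (cong₂ _+_ νₛ λⱼ)
                                     (⊖-≤⇒ {lam (fromℕ< s<n)} {lam (fromℕ< j<n)} {nu (fromℕ< s<n)} {nu (fromℕ< j<n)} le) ⟩
      (a ∸ 1) + at lam (suc j)  ∎))
      where open ≤-Reasoning
    go (inj₂ (le , _)) = begin-strict
      at mu (suc s) + at lam (suc j)  ≤⟨ subst₂ _≤_ (cong₂ _+_ (sym (at-lookup mu s<n)) νⱼ) (cong₂ _+_ νₛ (sym (at-lookup mu j<n)))
                                           (⊖-≤⇒ {mu (fromℕ< s<n)} {mu (fromℕ< j<n)} {nu (fromℕ< s<n)} {nu (fromℕ< j<n)} le) ⟩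
      (a ∸ 1) + at mu (suc j)         <⟨ ≤-reflexive (cong (_+ at mu (suc j)) a≡) ⟩
      a + at mu (suc j)               ∎
      where open ≤-Reasoning

  mu-end : ∀ {j} → n ≤ suc j → at mu (suc j) ≡ 0
  mu-end {j} n≤j with j <? n
  ... | no p = at-beyond mu (≮⇒≥ p)
  ... | yes p = trans (at-lookup mu p) (proj₂ μ-part _ (trans (cong suc (toℕ-fromℕ< p)) (≤-antisym p n≤j)))

  -- The largest bound with μ_m < β ≤ a that the separation inequalities give for all columns at once.
  Bound : Set
  Bound = ∃ λ β → β ≤ a × at mu (suc s) < β × (a ≤ β → ∀ {i} → k ≤ i → suc i < n → 1 ≤ at mu (suc i))

  mu<a : at mu (suc s) < a
  mu<a = subst₂ _<_
    (trans (cong (at mu (suc s) +_) (lam-end ≤-refl)) (+-identityʳ _))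
    (trans (cong (a +_) (mu-end ≤-refl)) (+-identityʳ a)) (separation (inj₂ k≤n₀) ≤-refl)

  β-bound : Bound
  β-bound with k <? n₀
  ... | no k≮n₀ = a , ≤-refl , mu<a , λ _ k≤i i<n → ⊥-elim (k≮n₀ (≤-trans (s≤s k≤i) (≤-pred i<n)))
  ... | yes k<n₀ = go n₀ refl k<n₀
    where
    go : ∀ l → l ≡ n₀ → k < l → Bound
    go (suc l) refl (s≤s k≤l) with at mu (suc l) in e
    ... | suc y = a , ≤-refl , mu<a , λ _ {i} _ i<n →
            ≤-trans (≤-trans (s≤s z≤n) (≤-reflexive (sym e))) (at-anti μ-part (≤-pred (≤-pred i<n)))
    -- Coordinate n - 1 has λ = 1 and μ = 0, so `separation` there is sharper by one than at
    -- coordinate n and permits the bound `a ∸ 1`.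
    ... | zero = a ∸ 1 , m∸n≤m a 1
            , ≤-pred (≤-trans (≤-reflexive (cong suc (+-comm 1 _))) (≤-trans tight (≤-reflexive (sym a≡))))
            , λ a≤ → ⊥-elim (<-irrefl refl (≤-trans (≤-reflexive a≡) a≤))
      where
      tight : at mu (suc s) + 1 < a
      tight = subst₂ _<_ (cong (at mu (suc s) +_) (lam-mid k≤l ≤-refl)) (trans (cong (a +_) e) (+-identityʳ a))
        (separation (inj₂ k≤l) (m≤n⇒m≤1+n (n<1+n l)))

  K K' : ℕ → ℕ
  K  = seqC (at lam) (at mu)
  K' = seqC (at nu) (at rho)

  dbl-reflect : ∀ i j → dbl i ≤ 1 + dbl j → i ≤ j
  dbl-reflect i j le = ≮⇒≥ λ j<i → <⇒≱ (dbl-< j<i) le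

  outside : ∀ i → i < s ⊎ k ≤ i → K' (1 + dbl i) ≡ K (1 + dbl i) × K' (2 + dbl i) ≡ K (2 + dbl i)
  outside i out =
      trans (seqC-odd (at nu) (at rho) i) (trans (nu-out out) (sym (seqC-odd (at lam) (at mu) i)))
    , trans (seqC-even (at nu) (at rho) i) (trans (rho-out out) (sym (seqC-even (at lam) (at mu) i)))

  params : Params
  params = record
    { a = a ; s = s ; k = k ; n = n ; β = proj₁ β-bound ; K = K ; K' = K' ; s<k = s<k ; k<n = k<n
    ; odd-full  = λ {i} i<k → trans (K-odd i) (lam-low i<k)
    ; odd-one   = λ {i} k≤i i<n → trans (K-odd i) (lam-mid k≤i i<n)
    ; odd-zero  = λ {i} n≤i → trans (K-odd i) (lam-end n≤i)
    ; before    = λ {v} → before v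
    ; after     = λ {v} → after v
    ; drop      = λ {i} s≤i i<k → trans (K-odd i) (trans (lam-low i<k)
                    (trans (sym a≡) (cong suc (sym (trans (seqC-odd (at nu) (at rho) i) (nu-in s≤i i<k))))))
    ; gain      = λ {i} s≤i i<k → trans (seqC-even (at nu) (at rho) i) (trans (rho-in s≤i i<k) (cong suc (sym (K-even i))))
    ; β≤a       = proj₁ (proj₂ β-bound)
    ; K<β       = subst (_< proj₁ β-bound) (sym (K-even s)) (proj₁ (proj₂ (proj₂ β-bound)))
    ; β-tight   = λ a≤β {i} k≤i i<n → subst (1 ≤_) (sym (K-even i)) (proj₂ (proj₂ (proj₂ β-bound)) a≤β k≤i i<n)
    ; separated = separated s refl
    }
    where
    K-odd : ∀ i → K (1 + dbl i) ≡ at lam (suc i)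
    K-odd = seqC-odd (at lam) (at mu)
    K-even : ∀ i → K (2 + dbl i) ≡ at mu (suc i)
    K-even = seqC-even (at lam) (at mu)
    before : ∀ v → v ≤ dbl s → K' v ≡ K v
    before zero _ = refl
    before v@(suc _) le with oddEven v (s≤s z≤n)
    ... | odd i  = proj₁ (outside i (inj₁ (≰⇒> λ s≤i → <⇒≱ le (dbl-≤ s≤i))))
    ... | even i = proj₂ (outside i (inj₁ (dbl-reflect (suc i) s (≤-trans le (n≤1+n _)))))
    after : ∀ v → dbl k < v → K' v ≡ K v
    after v l with oddEven v (≤-trans (s≤s z≤n) l)
    ... | odd i  = proj₁ (outside i (inj₂ (dbl-reflect k i (≤-trans (≤-pred l) (n≤1+n _)))))
    ... | even i = proj₂ (outside i (inj₂ (dbl-reflect k i (≤-pred l))))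
    separated : ∀ s' → s' ≡ s → 1 ≤ s' → K (2 + dbl s') < K (dbl s')
    separated (suc s') refl _ = subst₂ _<_ (sym (K-even (suc s'))) (sym (K-even s'))
      -- `separation` at coordinate m - 1, where λ equals `a` as well and cancels.
      (+-cancelˡ-< a _ _ (subst (_< a + at mu (suc s')) (trans (cong (at mu (2 + s') +_) (lam-low (<⇒≤ s<k))) (+-comm _ a))
        (separation (inj₁ ≤-refl) (<-trans (<⇒≤ s<k) k<n))))

  source : ∀ {t} → Peelable lam mu t → Yamanouchi K t
  source = peelable⇒ {n} {lam} {mu} (aNum-content λ-part μ-part)

  target : ∀ {t} → Peelable nu rho t → Yamanouchi K' t
  target = peelable⇒ {n} {nu} {rho} (aNum-content ν-part ρ-part)

  target⇐ : ∀ {t} → Yamanouchi K' t → Peelable nu rho t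
  target⇐ = peelable⇐ {n} {nu} {rho} (aNum-content ν-part ρ-part)

  start : ∀ {t} → Peelable lam mu t → Stage params s (dbl s) 0 t
  start p = initial params (source p)

  s+ : s + (k ∸ s) ≡ k
  s+ = m+[n∸m]≡n (<⇒≤ s<k)

  k+ : k + (n ∸ k) ≡ n
  k+ = m+[n∸m]≡n (<⇒≤ k<n)

  theta-run : ∀ {t} → Peelable lam mu t → ∃ λ t' → ThetaRun nu rho (suc s) k t t'
    × (∀ {t''} → ThetaRun nu rho (suc s) k t t'' → t'' ≡ t')
  theta-run {t} p =
    let t₁ , _ , ph₁ , S₁ , uniq₁ = phase1-run params (k ∸ s) s+ (start p)
        q , L = late params S₁
        t' , ph₂ , uniq₂ = phase2-run params target target⇐ (n ∸ k) k+ L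
    in t' , (t₁ , ph₁ , ph₂)
       , λ { (u , ph₁' , ph₂') → uniq₂ (subst (λ u → Phase2 nu rho (suc k) u _) (uniq₁ ph₁') ph₂') }

  theta-injective : ∀ {t u t'} → Peelable lam mu t → Peelable lam mu u →
    ThetaRun nu rho (suc s) k t t' → ThetaRun nu rho (suc s) k u t' → t ≡ u
  theta-injective {t} {u} {t'} pt pu (t₁ , pht₁ , pht₂) (u₁ , phu₁ , phu₂) =
    phase1-injective params (k ∸ s) s+ (start pt) (start pu) pht₁ (subst (Phase1 k (suc s) 0 u) (sym t₁≡u₁) phu₁)
    where
    lateAfter : ∀ {t t₁} → Peelable lam mu t → Phase1 k (suc s) 0 t t₁ → ∃ λ q → Late params k q t₁
    lateAfter p ph = let t₂ , _ , _ , S , uniq = phase1-run params (k ∸ s) s+ (start p)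
                     in subst (λ t → ∃ λ q → Late params k q t) (sym (uniq ph)) (late params S)
    t₁≡u₁ : t₁ ≡ u₁
    t₁≡u₁ = let q , L = lateAfter pt pht₁
                q' , L' = lateAfter pu phu₁
                q'≡q = suc-injective (trans (Late.q≡ L') (sym (Late.q≡ L)))
            in phase2-injective params target target⇐ (n ∸ k) k+ L (subst (λ q → Late params k q u₁) q'≡q L') pht₂ phu₂

theorem4p6 : (n a m k : ℕ) → 2 ≤ n → 1 ≤ a → 1 ≤ m → m ≤ k → k ≤ n ∸ 1 →
    (mu rho : Weight n) →
    IsPartition (lamV n a k) → IsPartition mu → IsPartition (nuV n a m k) → IsPartition rho →
    (∀ i → lamV n a k i + mu i ≡ nuV n a m k i + rho i) →
    InP (lamV n a k) mu (nuV n a m k) → InP (lamV n a k) mu rho →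
    -- θ is well defined (defined and single-valued) on peelable tableaux
    (∀ T → Peelable (lamV n a k) mu T → ∃ λ T' → ThetaRun (nuV n a m k) rho m k T T') ×
    (∀ T T' T'' → Peelable (lamV n a k) mu T →
       ThetaRun (nuV n a m k) rho m k T T' → ThetaRun (nuV n a m k) rho m k T T'' → T' ≡ T'') ×
    -- θ maps into ν ⊛ ρ-peelable tableaux
    (∀ T T' → Peelable (lamV n a k) mu T →
       ThetaRun (nuV n a m k) rho m k T T' → Peelable (nuV n a m k) rho T') ×
    -- θ is injective
    (∀ T₁ T₂ T' → Peelable (lamV n a k) mu T₁ → Peelable (lamV n a k) mu T₂ →
       ThetaRun (nuV n a m k) rho m k T₁ T' → ThetaRun (nuV n a m k) rho m k T₂ T' → T₁ ≡ T₂)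
theorem4p6 (suc n₀) a (suc s) k _ 1≤a _ s<k k≤n₀ mu rho λ-part μ-part ν-part ρ-part sums ν∈P _ =
    (λ T p → let T' , run , _ = theta-run p in T' , run)
  , (λ T T' T'' p run run' → let _ , _ , uniq = theta-run p in trans (uniq run) (sym (uniq run')))
  , (λ { T T' p (_ , _ , ph) → phase2-peelable ph })
  , (λ T₁ T₂ T' p₁ p₂ → theta-injective p₁ p₂)
  where open Weights n₀ a s k 1≤a s<k k≤n₀ mu rho λ-part μ-part ν-part ρ-part sums ν∈P
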